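{- Let $k,m\ge1$. Then the coded functions $\lceil R|_{\Psi^m_k}\rceil_E$, $\lceil L|_{\Psi^m_k}\rceil_E$ and $\lceil G|_{\Psi^m_k}\rceil_E$ are all in $\mathcal{E}^\Sigma_2$, i.e. they are computable in linear space.
   Context: Constructive ordinals: $\Omega$ is generated by $0$, successor $\alpha+1$, and limits $\langle\alpha_i\rangle_{i\in\mathbb{N}}$; equality is syntactic. $o(0)=0$, $o(n+1)=o(n)+1$, $\omega=\langle o(i+1)\rangle_i$; finite ordinals are the $o(n)$. Arithmetic: $\alpha+0=\alpha$, $\alpha+(\beta+1)=(\alpha+\beta)+1$, $\alpha+\langle\beta_i\rangle=\langle\alpha+\beta_i\rangle$; $\alpha\cdot0=0$, $\alpha\cdot(\beta+1)=\alpha\cdot\beta+\alpha$, $\alpha\cdot\langle\beta_i\rangle=\langle\alpha\cdot\beta_i\rangle$; $\alpha^0=o(1)$, $\alpha^{\beta+1}=\alpha^\beta\cdot\alpha$, $\alpha^{\langle\beta_i\rangle}=\langle\alpha^{\beta_i}\rangle$; write $\omega^p c$ for $\omega^{o(p)}\cdot o(c)$. $\Psi_\omega$ is the closure of $\{0\}\cup\{\omega^{o(p)}:p\in\mathbb{N}\}$ under $+$. For $k,m\ge1$, $\Psi_k^m=\{0\}\cup\{\sum_{i=1}^m\omega^{o(p_i)}c_i+\sum_{j=0}^{k-1}\omega^{o(k-1-j)}d_j : p_i<k\}$ with $c_i,d_j$ finite ordinals. Every nonzero $\alpha\in\Psi_\omega$ has a unique normal form $\alpha=\sum_{i=1}^l\omega^{p_i}c_i$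 with $l\ge1$, $c_i\ge1$, and $p_i\neq p_{i+1}$. Predecessor: $p(0,n)=0$, $p(\alpha+1,n)=\alpha$, $p(\langle\alpha_i\rangle,n)=\alpha_n$. $R^b(0,\alpha,n)=\alpha$, $R^b(i+1,\alpha,n)=p(R^b(i,\alpha,n),n)$. Length hierarchy $L_0(n)=0$, $L_{\alpha+1}(n)=L_\alpha(n)+1$, $L_{\langle\alpha_i\rangle}(n)=L_{\alpha_n}(n)+1$ (as $L(\alpha,n)$); slow-growing hierarchy $G_0(n)=0$, $G_{\alpha+1}(n)=G_\alpha(n)+1$, $G_{\langle\alpha_i\rangle}(n)=G_{\alpha_n}(n)$ (as $G(\alpha,n)$). $R(i,\alpha,n)=R^b(L_\alpha(n)\dot-i,\alpha,n)$. $F|_X$ denotes restriction of ordinal arguments to $X$. Coding over $\Sigma=\{0,1,(,),;,\bot\}$: $\lceil n\rceil_E$ is the binary expansion of $n$; $\lceil0\rceil_E=()$ and, for $\alpha$ with normal form $\sum_{i=1}^l\omega^{p_i}c_i$, $\lceil\alpha\rceil_E=(\lceil p_1\rceil;\lceil c_1\rceil;\cdots;\lceil p_l\rceil;\lceil c_l\rceil)$. For a function $F$ with ordinal arguments in $X\subseteq\Psi_\omega$ and numeral arguments, valued in $\mathbb{N}$ or $X$, $\lceil F\rceil_E$ returns $\lceil F(\bar\alpha,\bar n)\rceil_E$ when each ordinal position holds $\lceil\alpha\rceil_E$ with $\alpha\in X$ and each numeral position holds $\lceil n\rceil_E$, and $\bot$ otherwise. $\mathcal{E}^\Sigma_2$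 is the class of functions $(\Sigma^*)^m\to\Sigma^*$ computable by a multitape Turing machine in space linear in the input lengths. -}

module Defs where

open import Data.Nat using (ℕ; zero; suc; _+_; _*_; _∸_; _≤_; _<_; _/_; _%_; _≟_)
open import Data.Fin using (Fin; toℕ; _↑ˡ_; splitAt)
import Data.Fin as Fin
open import Data.List using (List; []; _∷_; _++_; length; concat; concatMap; intersperse)
open import Data.List.Relation.Unary.All using (All)
open import Data.List.Relation.Unary.Linked using (Linked)
open import Data.Vec using (Vec; []; _∷_; lookup; foldl; tabulate; zipWith; map)
open import Data.Product using (Σ; _×_; _,_; proj₁; proj₂; ∃)
open import Data.Sum using (_⊎_; inj₁; inj₂)
open import Data.Maybe using (Maybe; just; nothing)
open import Data.Bool using (if_then_else_)
open import Relation.Nullary using (¬_; does)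
open import Relation.Binary.PropositionalEquality using (_≡_; _≢_)

data Ω : Set where
  𝟎   : Ω
  _⁺  : Ω → Ω
  lim : (ℕ → Ω) → Ω

-- "Syntactic" equality of (infinitary) trees: extensional on limits.
data _≈_ : Ω → Ω → Set where
  ≈𝟎   : 𝟎 ≈ 𝟎
  ≈⁺   : ∀ {α β} → α ≈ β → (α ⁺) ≈ (β ⁺)
  ≈lim : ∀ {f g} → (∀ i → f i ≈ g i) → lim f ≈ lim g

o : ℕ → Ω
o zero    = 𝟎
o (suc n) = o n ⁺

ω : Ω
ω = lim (λ i → o (suc i))

infixl 6 _⊕_
infixl 7 _⊗_
infixr 8 _^Ω_

_⊕_ : Ω → Ω → Ω
α ⊕ 𝟎     = α
α ⊕ (β ⁺) = (α ⊕ β) ⁺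
α ⊕ lim f = lim (λ i → α ⊕ f i)

_⊗_ : Ω → Ω → Ω
α ⊗ 𝟎     = 𝟎
α ⊗ (β ⁺) = (α ⊗ β) ⊕ α
α ⊗ lim f = lim (λ i → α ⊗ f i)

_^Ω_ : Ω → Ω → Ω
α ^Ω 𝟎     = o 1
α ^Ω (β ⁺) = (α ^Ω β) ⊗ α
α ^Ω lim f = lim (λ i → α ^Ω f i)

ωpow : ℕ → ℕ → Ω
ωpow p c = (ω ^Ω o p) ⊗ o c

-- left-associated sum a₁ + ... + aₙ (starting from 0; note 0 + α ≈ α)
sumΩ : ∀ {n} → Vec Ω n → Ω
sumΩ = foldl (λ _ → Ω) _⊕_ 𝟎

InΨ : ℕ → ℕ → Ω → Set
InΨ k m α =
  α ≈ 𝟎 ⊎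
  Σ (Vec (Fin k) m) λ ps → Σ (Vec ℕ m) λ cs → Σ (Vec ℕ k) λ ds →
    α ≈ (sumΩ (zipWith (λ p c → ωpow (toℕ p) c) ps cs)
         ⊕ sumΩ (tabulate (λ j → ωpow (k ∸ 1 ∸ toℕ j) (lookup ds j))))

pred : Ω → ℕ → Ω
pred 𝟎       n = 𝟎
pred (α ⁺)   n = α
pred (lim f) n = f n

Rb : ℕ → Ω → ℕ → Ω
Rb zero    α n = α
Rb (suc i) α n = pred (Rb i α n) n

L : Ω → ℕ → ℕ
L 𝟎       n = 0
L (α ⁺)   n = suc (L α n)
L (lim f) n = suc (L (f n) n)

G : Ω → ℕ → ℕ
G 𝟎       n = 0
G (α ⁺)   n = suc (G α n)
G (lim f) n = G (f n) n

R : ℕ → Ω → ℕ → Ω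
R i α n = Rb (L α n ∸ i) α n

data Sym : Set where
  s0 s1 sOpen sClose sSemi sBot : Sym

Word : Set
Word = List Sym

-- binary digits, most significant first, no leading zeros (fuel = n suffices)
bits : ℕ → ℕ → Word
bits zero    n       = []
bits (suc f) zero    = []
bits (suc f) (suc n) = bits f (suc n / 2) ++ (digit (suc n % 2) ∷ [])
  where
  digit : ℕ → Sym
  digit zero = s0
  digit (suc _) = s1

bin : ℕ → Word
bin zero    = s0 ∷ []
bin (suc n) = bits (suc n) (suc n)

evalNF : List (ℕ × ℕ) → Ω
evalNF [] = 𝟎
evalNF (pc ∷ nf) = go (ωpow (proj₁ pc) (proj₂ pc)) nf
  where
  go : Ω → List (ℕ × ℕ) → Ω
  go acc [] = acc
  go acc (qd ∷ r) = go (acc ⊕ ωpow (proj₁ qd) (proj₂ qd)) r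

ValidNF : List (ℕ × ℕ) → Set
ValidNF nf = (1 ≤ length nf) × All (λ pc → 1 ≤ proj₂ pc) nf
             × Linked (λ a b → proj₁ a ≢ proj₁ b) nf

encNF : List (ℕ × ℕ) → Word
encNF nf = sOpen ∷ (concat (intersperse (sSemi ∷ [])
             (concatMap (λ pc → bin (proj₁ pc) ∷ bin (proj₂ pc) ∷ []) nf))
           ++ (sClose ∷ []))

-- Codes α w  :⇔  w = ⌈α⌉_E  (graph of the coding ⌈·⌉_E on Ψ_ω)
Codes : Ω → Word → Set
Codes α w = (α ≈ 𝟎 × w ≡ sOpen ∷ sClose ∷ [])
          ⊎ Σ (List (ℕ × ℕ)) λ nf → ValidNF nf × α ≈ evalNF nf × w ≡ encNF nf

botW : Word
botW = sBot ∷ []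

ValidR : ℕ → ℕ → Vec Word 3 → Set
ValidR k m ws = Σ ℕ λ i → Σ Ω λ α → Σ ℕ λ n → Σ Word λ c →
  InΨ k m α × Codes α c × ws ≡ bin i ∷ c ∷ bin n ∷ []

CodedR : ℕ → ℕ → Vec Word 3 → Word → Set
CodedR k m ws w =
  (∀ i α n c → InΨ k m α → Codes α c → ws ≡ bin i ∷ c ∷ bin n ∷ [] →
     Codes (R i α n) w)
  × (¬ ValidR k m ws → w ≡ botW)

Valid2 : ℕ → ℕ → Vec Word 2 → Set
Valid2 k m ws = Σ Ω λ α → Σ ℕ λ n → Σ Word λ c →
  InΨ k m α × Codes α c × ws ≡ c ∷ bin n ∷ []

CodedL : ℕ → ℕ → Vec Word 2 → Word → Set
CodedL k m ws w =
  (∀ α n c → InΨ k m α → Codes α c → ws ≡ c ∷ bin n ∷ [] → w ≡ bin (L α n))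
  × (¬ Valid2 k m ws → w ≡ botW)

CodedG : ℕ → ℕ → Vec Word 2 → Word → Set
CodedG k m ws w =
  (∀ α n c → InΨ k m α → Codes α c → ws ≡ c ∷ bin n ∷ [] → w ≡ bin (G α n))
  × (¬ Valid2 k m ws → w ≡ botW)

data TSym (e : ℕ) : Set where
  blank : TSym e
  inp   : Sym → TSym e
  wrk   : Fin e → TSym e

data Move : Set where
  left right stay : Move

-- An m-ary machine: tape 0 is the output tape, tapes 1..m hold the inputs,
-- the remaining `work` tapes are work tapes.  Tapes are one-way infinite
-- (cells indexed by ℕ); moving left at cell 0 stays.  State 0 is initial;
-- the machine halts when δ returns nothing.
record TM (m : ℕ) : Set where
  field
    extra  : ℕ
    work   : ℕ
    states : ℕ
    δ : Fin (suc states) → (Fin (suc (m + work)) → TSym extra) →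
        Maybe (Fin (suc states) × (Fin (suc (m + work)) → TSym extra)
                                × (Fin (suc (m + work)) → Move))

module _ {m : ℕ} (M : TM m) where
  open TM M

  T : ℕ
  T = suc (m + work)

  record Config : Set where
    field
      state : Fin (suc states)
      tape  : Fin T → ℕ → TSym extra
      head  : Fin T → ℕ
  open Config public

  move : Move → ℕ → ℕ
  move left  zero    = zero
  move left  (suc h) = h
  move right h       = suc h
  move stay  h       = h

  step : Config → Maybe Config
  step C with δ (state C) (λ t → tape C t (head C t))
  ... | nothing = nothing
  ... | just (q , wr , mv) = just record
        { state = q
        ; tape  = λ t p → if does (p ≟ head C t) then wr t else tape C t p
        ; head  = λ t → move (mv t) (head C t)
        }

  run : ℕ → Config → Config
  run zero    C = C
  run (suc s) C with step C
  ... | nothing = C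
  ... | just C' = run s C'

  listTape : Word → ℕ → TSym extra
  listTape []       p       = blank
  listTape (x ∷ xs) zero    = inp x
  listTape (x ∷ xs) (suc p) = listTape xs p

  initTape : Vec Word m → Fin T → ℕ → TSym extra
  initTape ws Fin.zero    = λ _ → blank
  initTape ws (Fin.suc t) with splitAt m t
  ... | inj₁ j = listTape (lookup ws j)
  ... | inj₂ _ = λ _ → blank

  init : Vec Word m → Config
  init ws = record { state = Fin.zero ; tape = initTape ws ; head = λ _ → 0 }

  -- the output tape holds w followed by a blank, starting at cell 0
  Output : Config → Word → Set
  Output C w = ∀ p → p ≤ length w → tape C Fin.zero p ≡ listTape w p

totalLen : ∀ {m} → Vec Word m → ℕ
totalLen []       = 0
totalLen (w ∷ ws) = length w + totalLen ws

-- f : (Σ*)^m → Σ* (given by its graph F) is in 𝓔^Σ_2: some multitape TM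
-- computes it, on every input halting and never moving any head beyond
-- cell c·(|w₁|+…+|wₘ|+1).
E2 : (m : ℕ) → (Vec Word m → Word → Set) → Set
E2 m F = Σ (TM m) λ M → Σ ℕ λ c → ∀ (ws : Vec Word m) →
  Σ ℕ λ s → Σ Word λ w →
    step M (run M s (init M ws)) ≡ nothing
    × Output M (run M s (init M ws)) w
    × F ws w
    × (∀ s' → s' ≤ s → ∀ t → head (run M s' (init M ws)) t ≤ c * suc (totalLen ws))

{-# OPTIONS --safe #-}
module Submission where

-- The normal form of an element of Ψ_k^m has at most m + k terms ω^p c, with p < k.  So its exponents
-- fit into the finite control of a machine, and only the coefficients need registers.  Since
-- ω^(p+1) = ⟨ω^p (i+1)⟩ᵢ, the predecessor at n decrements the last nonzero coefficient, of exponent p,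
-- and for p > 0 appends a term ω^(p-1) (n+1).  L counts the predecessor steps down to 0, G those of
-- them that start at a successor, and R(i, α, n) is reached from α after L_α(n) ∸ i steps.  From
-- L_{ω^p}(n) < (n+2)^(p+1), all numbers involved have length linear in that of the input.  So it
-- suffices to keep each register in binary on a tape of its own, and to increment, decrement and
-- test for zero.
--
-- For the rejection of invalid input, note that α + ω^p determines p and α.  Hence normal forms are
-- unique, and membership in Ψ_k^m means that the exponents of the normal form are below k and strictly
-- decrease from the one after the first m on.

open import Defs renaming (_≈_ to infix 4 _≈_)
open import Data.Bool using (Bool; true; false; if_then_else_)
open import Data.Empty using (⊥; ⊥-elim)
open import Data.Fin as Fin using (Fin; toℕ; fromℕ<; splitAt; join; _↑ˡ_; _↑ʳ_)
open import Data.Fin.Patterns using (0F; 1F; 2F; 3F; 4F; 5F; 6F)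
import Data.Fin.Properties as Finₚ
open import Data.List
  using (List; []; _∷_; _++_; [_]; _ʳ++_; concat; concatMap; foldl; foldr; intersperse; length; map; replicate; reverse)
import Data.List.Properties as Listₚ
open import Data.List.Relation.Unary.All as All using (All; []; _∷_)
import Data.List.Relation.Unary.All.Properties as Allₚ
open import Data.List.Relation.Unary.Linked as Linked using (Linked; []; [-]; _∷_)
import Data.List.Relation.Unary.Linked.Properties as Linkedₚ
open import Data.Maybe as Maybe using (Maybe; just; nothing)
open import Data.Maybe.Properties using (just-injective)
open import Data.Nat using (ℕ; zero; suc; _+_; _*_; _^_; _∸_; _/_; _%_; _≤_; _<_; z≤n; s≤s; _≟_; _≡ᵇ_; _<?_; >-nonZero)
open import Data.Nat.Divisibility using (divides)
open import Data.Nat.DivMod using (m/n<m; m*n/n≡m; m%n<n; m≡m%n+[m/n]*n; [m+kn]%n≡m%n; +-distrib-/-∣ʳ)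
open import Data.Nat.Properties hiding (_≟_; _<?_)
open import Data.Nat.Solver using (module +-*-Solver)
open import Data.Product using (Σ; _×_; _,_; proj₁; proj₂)
open import Data.Sum as Sum using (_⊎_; inj₁; inj₂)
open import Data.Unit using (⊤; tt)
open import Data.Vec as Vec using (Vec; []; _∷_; lookup; _[_]≔_)
import Data.Vec.Properties as Vecₚ
open import Function using (_∘_; id)
open import Relation.Binary.PropositionalEquality using (_≡_; _≢_; refl; sym; trans; cong; cong₂; subst; subst₂)
open import Relation.Nullary using (Dec; does; yes; no; ¬_; contradiction)
open import Relation.Nullary.Decidable using (_×-dec_; ¬?)

-- Structured programs and their compilation to Turing machines

-- The exponents sit in the control, so taking predecessors must not disturb them. It does not: only
-- the last nonzero term changes, and if its exponent is p + 1, the new term of exponent p goes to a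
-- scratch register reserved for exponent p, which comes later in the sum and is zero at that
-- moment. Thus k scratch registers behind the m + k registers for the input terms suffice for any
-- number of steps. In exchange, a file may contain zero coefficients and, once a term between them
-- has vanished, neighbouring terms of equal exponent; so the result of R is normalised while it is
-- printed.
--
-- Programs are generated with one branch for each list of exponents, so that exponents are
-- compared, and the shape is checked, while the program is built.
--
-- Halting and space come together: `Exec B` is inductive and bounds the heads by B, so a derivation
-- from the initial tapes is a halting computation in that space. The derivations of loops are built
-- by induction on numbers, for the counting loop on the value of L.
--
-- Counting destroys the ordinal, whence the second copy of the register file.

Cell : Set
Cell = TSym 0

record Tape : Set where
  constructor _at_
  field
    cells : ℕ → Cell
    pos   : ℕ
open Tape public

scan : Tape → Cell
scan τ = cells τ (pos τ)

shift : Move → ℕ → ℕ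
shift left  zero    = zero
shift left  (suc h) = h
shift right h       = suc h
shift stay  h       = h

write : Cell × Move → Tape → Tape
write (a , d) (f at h) = (λ p → if does (p ≟ h) then a else f p) at shift d h

-- At each control point a single tape is read, so a transition depends on one cell only. `skip`
-- names a tape so that this holds for it too.
data Prog (t : ℕ) : Set where
  act   : Fin t → (Cell → Cell × Move) → Prog t
  skip  : Fin t → Prog t
  _▹_   : Prog t → Prog t → Prog t
  cond  : Fin t → (Cell → Bool) → Prog t → Prog t → Prog t
  while : Fin t → (Cell → Bool) → Prog t → Prog t

infixr 4 _▹_

Tapes : ℕ → Set
Tapes t = Fin t → Tape

_[_≔_] : ∀ {t} → Tapes t → Fin t → Tape → Tapes t
(c [ i ≔ τ ]) j = if does (j Finₚ.≟ i) then τ else c j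

≔-same : ∀ {t} (c : Tapes t) i {τ} → (c [ i ≔ τ ]) i ≡ τ
≔-same c i with i Finₚ.≟ i
... | yes _ = refl
... | no ¬p = contradiction refl ¬p

≔-other : ∀ {t} (c : Tapes t) {i j} {τ} → j ≢ i → (c [ i ≔ τ ]) j ≡ c j
≔-other c {i} {j} j≢i with j Finₚ.≟ i
... | yes p = contradiction p j≢i
... | no _ = refl

Within : ∀ {t} → ℕ → Tapes t → Set
Within B c = ∀ i → pos (c i) ≤ B

-- Only act moves a head, so bounding its result bounds all intermediate configurations.
data Exec {t : ℕ} (B : ℕ) : Prog t → Tapes t → Tapes t → Set where
  e-act     : ∀ {i f c} → let c′ = c [ i ≔ write (f (scan (c i))) (c i) ] in
              Within B c′ → Exec B (act i f) c c′
  e-skip    : ∀ {i c} → Exec B (skip i) c c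
  e-seq     : ∀ {p q c c₁ c₂} → Exec B p c c₁ → Exec B q c₁ c₂ → Exec B (p ▹ q) c c₂
  e-then    : ∀ {i f p q c c₁} → f (scan (c i)) ≡ true → Exec B p c c₁ → Exec B (cond i f p q) c c₁
  e-else    : ∀ {i f p q c c₁} → f (scan (c i)) ≡ false → Exec B q c c₁ → Exec B (cond i f p q) c c₁
  e-exit    : ∀ {i f p c} → f (scan (c i)) ≡ false → Exec B (while i f p) c c
  e-iterate : ∀ {i f p c c₁ c₂} → f (scan (c i)) ≡ true → Exec B p c c₁ →
              Exec B (while i f p) c₁ c₂ → Exec B (while i f p) c c₂

-- The states of the later machine, kept structural so that the transition table is a recursion on
-- the program; `encode` numbers them afterwards. The first summand for `cond` and `while` is the
-- point where the test is made.
Control : ∀ {t} → Prog t → Set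
Control (act _ _)      = ⊤
Control (skip _)       = ⊤
Control (p ▹ q)        = Control p ⊎ Control q
Control (cond _ _ p q) = ⊤ ⊎ (Control p ⊎ Control q)
Control (while _ _ p)  = ⊤ ⊎ Control p

entry : ∀ {t} (p : Prog t) → Control p
entry (act _ _)      = tt
entry (skip _)       = tt
entry (p ▹ q)        = inj₁ (entry p)
entry (cond _ _ p q) = inj₁ tt
entry (while _ _ p)  = inj₁ tt

tapeOf : ∀ {t} (p : Prog t) → Control p → Fin t
tapeOf (act i _)      _               = i
tapeOf (skip i)       _               = i
tapeOf (p ▹ q)        (inj₁ s)        = tapeOf p s
tapeOf (p ▹ q)        (inj₂ s)        = tapeOf q s
tapeOf (cond i _ p q) (inj₁ _)        = i
tapeOf (cond i _ p q) (inj₂ (inj₁ s)) = tapeOf p s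
tapeOf (cond i _ p q) (inj₂ (inj₂ s)) = tapeOf q s
tapeOf (while i _ p)  (inj₁ _)        = i
tapeOf (while i _ p)  (inj₂ s)        = tapeOf p s

Effect : Set
Effect = Maybe (Cell × Move)

-- A missing next point means that the subprogram is left. `after` redirects this exit to a given
-- point, `inside` keeps it as an exit of the whole.
after : {X Y : Set} → Y → (X → Y) → Maybe X × Effect → Maybe Y × Effect
after y f (nothing , e) = just y , e
after y f (just x  , e) = just (f x) , e

inside : {X Y : Set} → (X → Y) → Maybe X × Effect → Maybe Y × Effect
inside f (nothing , e) = nothing , e
inside f (just x  , e) = just (f x) , e

table : ∀ {t} (p : Prog t) → Control p → Cell → Maybe (Control p) × Effect
table (act _ f)      _               x = nothing , just (f x)
table (skip _)       _               x = nothing , nothing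
table (p ▹ q)        (inj₁ s)        x = after (inj₂ (entry q)) inj₁ (table p s x)
table (p ▹ q)        (inj₂ s)        x = inside inj₂ (table q s x)
table (cond _ f p q) (inj₁ _)        x =
  just (inj₂ (if f x then inj₁ (entry p) else inj₂ (entry q))) , nothing
table (cond _ f p q) (inj₂ (inj₁ s)) x = inside (inj₂ ∘ inj₁) (table p s x)
table (cond _ f p q) (inj₂ (inj₂ s)) x = inside (inj₂ ∘ inj₂) (table q s x)
table (while _ f p)  (inj₁ _)        x =
  (if f x then just (inj₂ (entry p)) else nothing) , nothing
table (while _ f p)  (inj₂ s)        x = after (inj₁ tt) inj₂ (table p s x)

effect : ∀ {t} → Fin t → Effect → Tapes t → Tapes t
effect i nothing  c = c
effect i (just e) c = c [ i ≔ write e (c i) ]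

-- The small-step counterpart of `Exec`: one constructor per transition, up to and including the one
-- that leaves the program.
data Reach {t : ℕ} (B : ℕ) (p : Prog t) : Control p → Tapes t → Tapes t → Set where
  last : ∀ {s c e} → table p s (scan (c (tapeOf p s))) ≡ (nothing , e) →
         Within B (effect (tapeOf p s) e c) → Reach B p s c (effect (tapeOf p s) e c)
  more : ∀ {s s′ c c′ e} → table p s (scan (c (tapeOf p s))) ≡ (just s′ , e) →
         Within B (effect (tapeOf p s) e c) →
         Reach B p s′ (effect (tapeOf p s) e c) c′ → Reach B p s c c′

module _ {t B : ℕ} where

  reach-seqʳ : ∀ {p q : Prog t} {s c c′} → Reach B q s c c′ → Reach B (p ▹ q) (inj₂ s) c c′
  reach-seqʳ (last eq w)   = last (cong (inside inj₂) eq) w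
  reach-seqʳ (more eq w r) = more (cong (inside inj₂) eq) w (reach-seqʳ r)

  reach-seqˡ : ∀ {p q : Prog t} {s c c₁ c₂} → Reach B p s c c₁ → Reach B q (entry q) c₁ c₂ →
               Reach B (p ▹ q) (inj₁ s) c c₂
  reach-seqˡ (last eq w)    r′ = more (cong (after _ inj₁) eq) w (reach-seqʳ r′)
  reach-seqˡ (more eq w r)  r′ = more (cong (after _ inj₁) eq) w (reach-seqˡ r r′)

  reach-then : ∀ {i f} {p q : Prog t} {s c c′} → Reach B p s c c′ →
               Reach B (cond i f p q) (inj₂ (inj₁ s)) c c′
  reach-then (last eq w)   = last (cong (inside _) eq) w
  reach-then (more eq w r) = more (cong (inside _) eq) w (reach-then r)

  reach-else : ∀ {i f} {p q : Prog t} {s c c′} → Reach B q s c c′ →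
               Reach B (cond i f p q) (inj₂ (inj₂ s)) c c′
  reach-else (last eq w)   = last (cong (inside _) eq) w
  reach-else (more eq w r) = more (cong (inside _) eq) w (reach-else r)

  reach-body : ∀ {i f} {p : Prog t} {s c c₁ c₂} → Reach B p s c c₁ →
               Reach B (while i f p) (inj₁ tt) c₁ c₂ → Reach B (while i f p) (inj₂ s) c c₂
  reach-body (last eq w)   r′ = more (cong (after _ inj₂) eq) w r′
  reach-body (more eq w r) r′ = more (cong (after _ inj₂) eq) w (reach-body r r′)

  exec-within : ∀ {p : Prog t} {c c′} → Within B c → Exec B p c c′ → Within B c′
  exec-within w (e-act w′)          = w′
  exec-within w e-skip              = w
  exec-within w (e-seq x y)         = exec-within (exec-within w x) y
  exec-within w (e-then _ x)        = exec-within w x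
  exec-within w (e-else _ x)        = exec-within w x
  exec-within w (e-exit _)          = w
  exec-within w (e-iterate _ x y)   = exec-within (exec-within w x) y

  exec⇒reach : ∀ {p : Prog t} {c c′} → Within B c → Exec B p c c′ → Reach B p (entry p) c c′
  exec⇒reach w (e-act w′)        = last refl w′
  exec⇒reach w e-skip            = last refl w
  exec⇒reach w (e-seq x y)       =
    reach-seqˡ (exec⇒reach w x) (exec⇒reach (exec-within w x) y)
  exec⇒reach w (e-then eq x)     =
    more (cong (λ b → just (inj₂ (if b then _ else _)) , nothing) eq) w (reach-then (exec⇒reach w x))
  exec⇒reach w (e-else eq x)     =
    more (cong (λ b → just (inj₂ (if b then _ else _)) , nothing) eq) w (reach-else (exec⇒reach w x))
  exec⇒reach w (e-exit eq)       = last (cong (λ b → (if b then _ else _) , nothing) eq) w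
  exec⇒reach w (e-iterate eq x y) =
    more (cong (λ b → (if b then _ else _) , nothing) eq) w
         (reach-body (exec⇒reach w x) (exec⇒reach (exec-within w x) y))

size : ∀ {t} → Prog t → ℕ
size (act _ _)      = 1
size (skip _)       = 1
size (p ▹ q)        = size p + size q
size (cond _ _ p q) = 1 + (size p + size q)
size (while _ _ p)  = 1 + size p

encode : ∀ {t} (p : Prog t) → Control p → Fin (size p)
encode (act _ _)      _ = Fin.zero
encode (skip _)       _ = Fin.zero
encode (p ▹ q)        s = join (size p) (size q) (Sum.map (encode p) (encode q) s)
encode (cond _ _ p q) (inj₁ _) = Fin.zero
encode (cond _ _ p q) (inj₂ s) = Fin.suc (join (size p) (size q) (Sum.map (encode p) (encode q) s))
encode (while _ _ p)  (inj₁ _) = Fin.zero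
encode (while _ _ p)  (inj₂ s) = Fin.suc (encode p s)

decode : ∀ {t} (p : Prog t) → Fin (size p) → Control p
decode (act _ _)      _ = tt
decode (skip _)       _ = tt
decode (p ▹ q)        x = Sum.map (decode p) (decode q) (splitAt (size p) x)
decode (cond _ _ p q) Fin.zero    = inj₁ tt
decode (cond _ _ p q) (Fin.suc x) = inj₂ (Sum.map (decode p) (decode q) (splitAt (size p) x))
decode (while _ _ p)  Fin.zero    = inj₁ tt
decode (while _ _ p)  (Fin.suc x) = inj₂ (decode p x)

decode-encode : ∀ {t} (p : Prog t) s → decode p (encode p s) ≡ s
decode-encode-⊎ : ∀ {t} (p q : Prog t) s →
  Sum.map (decode p) (decode q) (splitAt (size p) (join (size p) (size q) (Sum.map (encode p) (encode q) s))) ≡ s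
decode-encode-⊎ p q s rewrite Finₚ.splitAt-join (size p) (size q) (Sum.map (encode p) (encode q) s) with s
... | inj₁ x = cong inj₁ (decode-encode p x)
... | inj₂ y = cong inj₂ (decode-encode q y)
decode-encode (act _ _)      _ = refl
decode-encode (skip _)       _ = refl
decode-encode (p ▹ q)        s = decode-encode-⊎ p q s
decode-encode (cond _ _ p q) (inj₁ _) = refl
decode-encode (cond _ _ p q) (inj₂ s) = cong inj₂ (decode-encode-⊎ p q s)
decode-encode (while _ _ p)  (inj₁ _) = refl
decode-encode (while _ _ p)  (inj₂ s) = cong inj₂ (decode-encode p s)

module Compile (m work : ℕ) (p : Prog (suc (m + work))) where

  Tp : Set
  Tp = Fin (suc (m + work))

  writes : Tp → Effect → (Tp → Cell) → Tp → Cell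
  writes i nothing        r j = r j
  writes i (just (a , _)) r j = if does (j Finₚ.≟ i) then a else r j

  moves : Tp → Effect → Tp → Move
  moves i nothing        j = stay
  moves i (just (_ , d)) j = if does (j Finₚ.≟ i) then d else stay

  -- State 0 is a second copy of the entry point, state 1 is the halting state.
  target : Maybe (Control p) → Fin (2 + size p)
  target nothing  = Fin.suc Fin.zero
  target (just s) = Fin.suc (Fin.suc (encode p s))

  fire : Control p → (Tp → Cell) → Fin (2 + size p) × (Tp → Cell) × (Tp → Move)
  fire s r = let (n , e) = table p s (r (tapeOf p s)) in
             target n , writes (tapeOf p s) e r , moves (tapeOf p s) e

  machine : TM m
  machine = record
    { extra = 0 ; work = work ; states = suc (size p)
    ; δ = λ { Fin.zero r → just (fire (entry p) r)
            ; (Fin.suc Fin.zero) r → nothing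
            ; (Fin.suc (Fin.suc x)) r → just (fire (decode p x) r) } }

  -- Pointwise, because the machine rewrites every scanned cell and the program only those of one
  -- tape; without function extensionality the resulting tapes are not provably equal as functions.
  record _∼_ (C : Config machine) (c : Tapes (suc (m + work))) : Set where
    constructor matches
    field
      ∼tape : ∀ j q → tape C j q ≡ cells (c j) q
      ∼head : ∀ j → head C j ≡ pos (c j)
  open _∼_ public

  data At (C : Config machine) (s : Control p) : Set where
    at-entry : state C ≡ Fin.zero → s ≡ entry p → At C s
    at-state : state C ≡ Fin.suc (Fin.suc (encode p s)) → At C s

  fired : Config machine → Control p → Config machine
  fired C s = let (q , wr , mv) = fire s (λ j → tape C j (head C j)) in record
    { state = q
    ; tape  = λ j x → if does (x ≟ head C j) then wr j else tape C j x
    ; head  = λ j → move machine (mv j) (head C j) }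

  step-fired : ∀ {C s} → At C s → step machine C ≡ just (fired C s)
  step-fired {C} (at-entry eq refl) rewrite eq = refl
  step-fired {C} {s} (at-state eq) rewrite eq | decode-encode p s = refl

  move≡shift : ∀ d h → move machine d h ≡ shift d h
  move≡shift left zero = refl
  move≡shift left (suc h) = refl
  move≡shift right h = refl
  move≡shift stay h = refl

  -- A machine writes on all tapes in every step; on those that the program does not address it
  -- writes back what it reads.
  rewrite-same : ∀ (f : ℕ → Cell) h x → (if does (x ≟ h) then f h else f x) ≡ f x
  rewrite-same f h x with x ≡ᵇ h | ≡ᵇ⇒≡ x h
  ... | true  | eq = cong f (sym (eq tt))
  ... | false | _  = refl

  fired-∼ : ∀ {C s c n e} → C ∼ c → table p s (scan (c (tapeOf p s))) ≡ (n , e) →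
            (state (fired C s) ≡ target n) × (fired C s ∼ effect (tapeOf p s) e c)
  fired-∼ {C} {s} {c} {n} {e} (matches tp hd) eq
    = cong (target ∘ proj₁) fires ,
      subst (λ e → fired C s ∼ effect i e c) (cong proj₂ fires) (matches (cell e′) (hdd e′))
    where
    i = tapeOf p s
    e′ = proj₂ (table p s (tape C i (head C i)))
    fires : table p s (tape C i (head C i)) ≡ (n , e)
    fires = trans (cong (table p s) (trans (tp i (head C i)) (cong (cells (c i)) (hd i)))) eq
    cell : ∀ e j q → (if does (q ≟ head C j) then writes i e (λ j → tape C j (head C j)) j else tape C j q)
           ≡ cells (effect i e c j) q
    cell nothing j q = trans (rewrite-same (tape C j) (head C j) q) (tp j q)
    cell (just (a , d)) j q with j Finₚ.≟ i
    ... | no _ = trans (rewrite-same (tape C j) (head C j) q) (tp j q)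
    ... | yes refl rewrite hd j | tp j q = refl
    hdd : ∀ e j → move machine (moves i e j) (head C j) ≡ pos (effect i e c j)
    hdd nothing j = hd j
    hdd (just (a , d)) j with j Finₚ.≟ i
    ... | no _ = hd j
    ... | yes refl rewrite hd j = move≡shift d (pos (c j))

  run-step : ∀ {C C′} n → step machine C ≡ just C′ → run machine (suc n) C ≡ run machine n C′
  run-step n eq rewrite eq = refl

  Halts : ℕ → Config machine → Tapes (suc (m + work)) → Set
  Halts B C c′ = Σ ℕ λ n → (step machine (run machine n C) ≡ nothing) × (run machine n C ∼ c′)
                 × (∀ n′ → n′ ≤ n → ∀ j → head (run machine n′ C) j ≤ B)

  halted : ∀ {C} → state C ≡ Fin.suc Fin.zero → step machine C ≡ nothing
  halted eq rewrite eq = refl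

  one-more : ∀ {B C C′ c′} → step machine C ≡ just C′ → (∀ j → head C j ≤ B) →
             Halts B C′ c′ → Halts B C c′
  one-more {B} {C} eq hb (n , st , mt , bd) = suc n ,
    trans (cong (step machine) (run-step n eq)) st ,
    subst (_∼ _) (sym (run-step n eq)) mt ,
    λ { zero _ j → hb j
      ; (suc n′) (s≤s le) j → subst (λ D → head D j ≤ B) (sym (run-step n′ eq)) (bd n′ le j) }

  heads≤ : ∀ {B C c} → C ∼ c → Within B c → ∀ j → head C j ≤ B
  heads≤ mt w j = subst (_≤ _) (sym (∼head mt j)) (w j)

  reach⇒halts : ∀ {B C s c c′} → At C s → C ∼ c → Within B c → Reach B p s c c′ → Halts B C c′
  reach⇒halts {B} {C} {s} a mt w (last eq w′) with fired-∼ {C} {s} mt eq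
  ... | st , mt′ = one-more (step-fired a) (heads≤ mt w)
    (0 , halted st , mt′ , λ { zero z≤n → heads≤ mt′ w′ })
  reach⇒halts {B} {C} {s} a mt w (more eq w′ r) with fired-∼ {C} {s} mt eq
  ... | st , mt′ = one-more (step-fired a) (heads≤ mt w) (reach⇒halts (at-state st) mt′ w′ r)

  initial : Vec Word m → Tapes (suc (m + work))
  initial ws j = initTape machine ws j at 0

  exec⇒halts : ∀ {B ws c′} → Exec B p (initial ws) c′ → Halts B (init machine ws) c′
  exec⇒halts x = reach⇒halts (at-entry refl refl) (matches (λ _ _ → refl) (λ _ → refl)) (λ _ → z≤n)
                             (exec⇒reach (λ _ → z≤n) x)

-- Tapes and binary registers

2^-mono-< : ∀ {m n} → m < n → 2 ^ m < 2 ^ n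
2^-mono-< = ^-monoʳ-< 2 (s≤s (s≤s z≤n))

nth : List Cell → ℕ → Cell
nth []       _       = blank
nth (x ∷ xs) zero    = x
nth (x ∷ xs) (suc i) = nth xs i

LeftOf : (ℕ → Cell) → ℕ → List Cell → Set
LeftOf f zero    []       = ⊤
LeftOf f zero    (_ ∷ _)  = ⊥
LeftOf f (suc h) []       = ⊥
LeftOf f (suc h) (x ∷ ls) = f h ≡ x × LeftOf f h ls

-- The cells left of the head are listed nearest first, so the length of `ls` is the head position.
-- Since `nth` defaults to `blank`, the tape is blank beyond `rs`.
record Zip (ls rs : List Cell) (τ : Tape) : Set where
  constructor zipped
  field
    leftOf  : LeftOf (cells τ) (pos τ) ls
    rightOf : ∀ i → cells τ (i + pos τ) ≡ nth rs i
open Zip public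

overwrite : Cell → (ℕ → Cell) → ℕ → ℕ → Cell
overwrite a f h p = if does (p ≟ h) then a else f p

overwrite-same : ∀ a f h → overwrite a f h h ≡ a
overwrite-same a f zero = refl
overwrite-same a f (suc h) = overwrite-same a (f ∘ suc) h

overwrite-other : ∀ a f {h p} → p ≢ h → overwrite a f h p ≡ f p
overwrite-other a f {h} {p} p≢h with p ≡ᵇ h | ≡ᵇ⇒≡ p h
... | true  | eq = contradiction (eq tt) p≢h
... | false | _  = refl

left-overwrite : ∀ a f {h} h′ ls → h′ ≤ h → LeftOf f h′ ls → LeftOf (overwrite a f h) h′ ls
left-overwrite a f zero [] le l = tt
left-overwrite a f (suc h′) (x ∷ ls) le (eq , l) =
  trans (overwrite-other a f (<⇒≢ le)) eq , left-overwrite a f h′ ls (<⇒≤ le) l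

right-overwrite : ∀ a f {h x rs} → (∀ i → f (i + h) ≡ nth (x ∷ rs) i) →
                  ∀ i → overwrite a f h (i + h) ≡ nth (a ∷ rs) i
right-overwrite a f {h} r zero = overwrite-same a f h
right-overwrite a f {h} r (suc i) =
  trans (overwrite-other a f {h} (λ eq → m≢1+n+m h (sym eq))) (r (suc i))

zip-pos : ∀ {ls rs τ} → Zip ls rs τ → pos τ ≡ length ls
zip-pos {ls} {τ = f at h} z = go h ls (leftOf z)
  where
  go : ∀ h ls → LeftOf f h ls → h ≡ length ls
  go zero [] _ = refl
  go (suc h) (x ∷ ls) (_ , l) = cong suc (go h ls l)

zip-scan : ∀ {ls x rs τ} → Zip ls (x ∷ rs) τ → scan τ ≡ x
zip-scan z = rightOf z 0

zip-pad : ∀ {ls τ} → Zip ls [] τ → Zip ls (blank ∷ []) τ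
zip-pad (zipped l r) = zipped l λ { zero → r 0 ; (suc i) → r (suc i) }

zip-unpad : ∀ {ls} xs {τ} → Zip ls (xs ++ blank ∷ []) τ → Zip ls xs τ
zip-unpad xs (zipped l r) = zipped l λ i → trans (r i) (go xs i)
  where
  go : ∀ xs i → nth (xs ++ blank ∷ []) i ≡ nth xs i
  go [] zero = refl
  go [] (suc i) = refl
  go (x ∷ xs) zero = refl
  go (x ∷ xs) (suc i) = go xs i

zip-stay : ∀ {a ls x rs τ} → Zip ls (x ∷ rs) τ → Zip ls (a ∷ rs) (write (a , stay) τ)
zip-stay {a} {ls} {τ = f at h} (zipped l r) =
  zipped (left-overwrite a f h ls ≤-refl l) (right-overwrite a f {h} r)

zip-right : ∀ {a ls x rs τ} → Zip ls (x ∷ rs) τ → Zip (a ∷ ls) rs (write (a , right) τ)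
zip-right {a} {ls} {τ = f at h} (zipped l r) =
  zipped (overwrite-same a f h , left-overwrite a f h ls ≤-refl l)
         (λ i → trans (cong (overwrite a f h) (+-suc i h)) (right-overwrite a f {h} r (suc i)))

zip-left : ∀ {a l ls x rs τ} → Zip (l ∷ ls) (x ∷ rs) τ → Zip ls (l ∷ a ∷ rs) (write (a , left) τ)
zip-left {a} {l₀} {ls} {rs = rs} {τ = f at suc h} (zipped (eq , l) r) =
  zipped (left-overwrite a f h ls (n≤1+n h) l) go
  where
  go : ∀ i → overwrite a f (suc h) (i + h) ≡ nth (l₀ ∷ a ∷ rs) i
  go zero    = trans (overwrite-other a f (<⇒≢ ≤-refl)) eq
  go (suc i) = trans (cong (overwrite a f (suc h)) (sym (+-suc i h)))
                     (right-overwrite a f {suc h} r i)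

-- A total-correctness triple for a program that changes tape `i` alone. The frame clause is what
-- later carries it over to whole stores.
record Does {t : ℕ} (B : ℕ) (i : Fin t) (p : Prog t) (P Q : Tape → Set) : Set where
  constructor does-by
  field
    perform : ∀ c → Within B c → P (c i) → Σ (Tapes t) λ c′ →
      Exec B p c c′ × Within B c′ × (∀ j → j ≢ i → c′ j ≡ c j) × Q (c′ i)
open Does public

module _ {t B : ℕ} {i : Fin t} where

  does-act : ∀ {f P Q} → (∀ {τ} → P τ → Q (write (f (scan τ)) τ)) → (∀ {τ} → Q τ → pos τ ≤ B) →
             Does B i (act i f) P Q
  does-act {f} {P} {Q} pq bound = does-by go
    where
    go : ∀ c → Within B c → P (c i) → Σ (Tapes t) λ c′ →
         Exec B (act i f) c c′ × Within B c′ × (∀ j → j ≢ i → c′ j ≡ c j) × Q (c′ i)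
    go c w p = _ , e-act w′ , w′ , (λ j j≢i → ≔-other c j≢i) , subst Q (sym (≔-same c i)) q
      where
      q = pq p
      w′ : Within B (c [ i ≔ write (f (scan (c i))) (c i) ])
      w′ j with j Finₚ.≟ i
      ... | yes _ = bound q
      ... | no _ = w j

  does-seq : ∀ {p q P Q S} → Does B i p P Q → Does B i q Q S → Does B i (p ▹ q) P S
  does-seq dp dq = does-by λ c w x →
    let (c₁ , e₁ , w₁ , f₁ , y) = perform dp c w x
        (c₂ , e₂ , w₂ , f₂ , z) = perform dq c₁ w₁ y
    in c₂ , e-seq e₁ e₂ , w₂ , (λ j n → trans (f₂ j n) (f₁ j n)) , z

  does-exit : ∀ {f p P} → (∀ {τ} → P τ → f (scan τ) ≡ false) → Does B i (while i f p) P P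
  does-exit f≡ = does-by λ c w x → c , e-exit (f≡ x) , w , (λ _ _ → refl) , x

  does-iterate : ∀ {f p P Q S} → (∀ {τ} → P τ → f (scan τ) ≡ true) → Does B i p P Q →
                 Does B i (while i f p) Q S → Does B i (while i f p) P S
  does-iterate f≡ dp dq = does-by λ c w x →
    let (c₁ , e₁ , w₁ , f₁ , y) = perform dp c w x
        (c₂ , e₂ , w₂ , f₂ , z) = perform dq c₁ w₁ y
    in c₂ , e-iterate (f≡ x) e₁ e₂ , w₂ , (λ j n → trans (f₂ j n) (f₁ j n)) , z

  does-exit▹ : ∀ {f p q P Q} → (∀ {τ} → P τ → f (scan τ) ≡ false) → Does B i q P Q →
               Does B i (while i f p ▹ q) P Q
  does-exit▹ f≡ dq = does-seq (does-exit f≡) dq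

  does-assoc : ∀ {p q r P Q} → Does B i ((p ▹ q) ▹ r) P Q → Does B i (p ▹ q ▹ r) P Q
  does-assoc {p} {q} {r} {P} {Q} d = does-by λ c w x → let (c₁ , e , rest) = perform d c w x in c₁ , go e , rest
    where
    go : ∀ {c c₁} → Exec B ((p ▹ q) ▹ r) c c₁ → Exec B (p ▹ q ▹ r) c c₁
    go (e-seq (e-seq e₁ e₂) e₃) = e-seq e₁ (e-seq e₂ e₃)

  -- The loop is treated together with its continuation: what the continuation has to do depends on
  -- where the loop stops, and so one induction on the digits can prove both.
  does-iterate▹ : ∀ {f p q P Q S} → (∀ {τ} → P τ → f (scan τ) ≡ true) → Does B i p P Q →
                  Does B i (while i f p ▹ q) Q S → Does B i (while i f p ▹ q) P S
  does-iterate▹ {f} {p} {q} f≡ dp dq = does-by λ c w x →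
    let (c₁ , e₁ , w₁ , f₁ , y) = perform dp c w x
        (c₂ , e₂ , w₂ , f₂ , z) = perform dq c₁ w₁ y
    in c₂ , go (f≡ x) e₁ e₂ , w₂ , (λ j n → trans (f₂ j n) (f₁ j n)) , z
    where
    go : ∀ {c c₁ c₂} → f (scan (c i)) ≡ true → Exec B p c c₁ → Exec B (while i f p ▹ q) c₁ c₂ →
         Exec B (while i f p ▹ q) c c₂
    go eq e₁ (e-seq e₂ e₃) = e-seq (e-iterate eq e₁ e₂) e₃

  does-then : ∀ {f p q P Q} → (∀ {τ} → P τ → f (scan τ) ≡ true) → Does B i p P Q →
              Does B i (cond i f p q) P Q
  does-then f≡ dp = does-by λ c w x → let (c₁ , e , r) = perform dp c w x in c₁ , e-then (f≡ x) e , r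

  does-else : ∀ {f p q P Q} → (∀ {τ} → P τ → f (scan τ) ≡ false) → Does B i q P Q →
              Does B i (cond i f p q) P Q
  does-else f≡ dq = does-by λ c w x → let (c₁ , e , r) = perform dq c w x in c₁ , e-else (f≡ x) e , r

  does-weaken : ∀ {p P P′ Q Q′} → (∀ {τ} → P′ τ → P τ) → (∀ {τ} → Q τ → Q′ τ) →
                Does B i p P Q → Does B i p P′ Q′
  does-weaken f g dp = does-by λ c w x →
    let (c₁ , e , w₁ , f₁ , y) = perform dp c w (f x) in c₁ , e , w₁ , f₁ , g y

isInp : (Sym → Bool) → Cell → Bool
isInp f (inp x) = f x
isInp f _       = false

is0 is1 isDigit : Sym → Bool
is0 s0 = true
is0 _  = false
is1 s1 = true
is1 _  = false
isDigit s0 = true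
isDigit s1 = true
isDigit _  = false

isBot : Sym → Bool
isBot sBot = true
isBot _    = false

dig : Bool → Cell
dig false = inp s0
dig true  = inp s1

-- A register is kept in binary on its tape, least significant digit in cell 1.
-- Cell 0 holds a non-digit: the flag left there by the last zero test.

fromDigits : List Bool → ℕ
fromDigits []          = 0
fromDigits (false ∷ d) = 2 * fromDigits d
fromDigits (true ∷ d)  = suc (2 * fromDigits d)

incr decr : List Bool → List Bool
incr []          = true ∷ []
incr (false ∷ d) = true ∷ d
incr (true ∷ d)  = false ∷ incr d
decr []          = []
decr (false ∷ d) = true ∷ decr d
decr (true ∷ d)  = false ∷ d

fromDigits-incr : ∀ d → fromDigits (incr d) ≡ suc (fromDigits d)
fromDigits-incr []          = refl
fromDigits-incr (false ∷ d) = refl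
fromDigits-incr (true ∷ d)  = trans (cong (2 *_) (fromDigits-incr d)) (*-suc 2 (fromDigits d))

fromDigits-decr : ∀ d {v} → fromDigits d ≡ suc v → fromDigits (decr d) ≡ v
fromDigits-decr (true ∷ d) refl = refl
fromDigits-decr (false ∷ d) eq with fromDigits d in e
... | suc u = trans (cong (λ z → suc (2 * z)) (fromDigits-decr d e))
                    (suc-injective (trans (sym (*-suc 2 u)) eq))

length-decr : ∀ d → length (decr d) ≡ length d
length-decr []          = refl
length-decr (false ∷ d) = cong suc (length-decr d)
length-decr (true ∷ d)  = refl

-- The carry lengthens `d` only if all its digits are 1, and then the new value is 2 to the power
-- `length d`.
length-incr : ∀ b d → length d ≤ b → suc (fromDigits d) < 2 ^ b → length (incr d) ≤ b
length-incr zero    [] le (s≤s ())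
length-incr (suc b) [] le lt = s≤s z≤n
length-incr b (false ∷ d) le lt = le
length-incr (suc b) (true ∷ d) (s≤s le) lt =
  s≤s (length-incr b d le (*-cancelˡ-< 2 _ _ (≤-trans (≤-reflexive (cong suc (*-suc 2 _))) lt)))

Register : ℕ → ℕ → Tape → Set
Register b v τ = Σ Cell λ x → Σ (List Bool) λ d →
  isInp isDigit x ≡ false × Zip [] (x ∷ map dig d) τ × fromDigits d ≡ v × length d ≤ b

module _ {t : ℕ} (i : Fin t) where

  -- The non-digit in cell 0 is what stops `rewind`. Because of leading zeros no single cell shows
  -- whether the value is zero; `ZT` searches for a digit 1 and leaves the verdict in cell 0, where
  -- the head ends up and one `cond` can read it.
  rewind INC DEC ZT : Prog t
  rewind = while i (isInp isDigit) (act i λ x → x , left)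
  INC = act i (λ x → x , right) ▹
        while i (isInp is1) (act i λ _ → inp s0 , right) ▹
        act i (λ _ → inp s1 , left) ▹ rewind
  DEC = act i (λ x → x , right) ▹
        while i (isInp is0) (act i λ _ → inp s1 , right) ▹
        act i (λ _ → inp s0 , left) ▹ rewind
  ZT  = act i (λ x → x , right) ▹
        while i (isInp is0) (act i λ x → x , right) ▹
        cond i (isInp is1) (act i (λ x → x , left) ▹ rewind ▹ act i (λ _ → inp sBot , stay))
                           (act i (λ x → x , left) ▹ rewind ▹ act i (λ _ → blank , stay))

digits-of : ∀ {x} us d {τ} → Zip [] (x ∷ (map dig us ʳ++ map dig d)) τ →
            Zip [] (x ∷ map dig (us ʳ++ d)) τ
digits-of {x} us d {τ} = subst (λ e → Zip [] (x ∷ e) τ) (sym (Listₚ.map-ʳ++ dig us))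

isDigit-dig : ∀ u → isInp isDigit (dig u) ≡ true
isDigit-dig false = refl
isDigit-dig true  = refl

behind : Cell → List Bool → List Cell
behind x₀ us = map dig us ++ x₀ ∷ []

length-behind : ∀ x₀ us → length (behind x₀ us) ≡ suc (length us)
length-behind x₀ []       = refl
length-behind x₀ (u ∷ us) = cong suc (length-behind x₀ us)

scan-is : ∀ (f : Sym → Bool) {v ls y rs} → isInp f y ≡ v → ∀ {τ} → Zip ls (y ∷ rs) τ → isInp f (scan τ) ≡ v
scan-is f eq z = trans (cong (isInp f) (zip-scan z)) eq

zip-over : ∀ {x ls rs τ} → Zip ls (x ∷ rs) τ → Zip (x ∷ ls) rs (write (scan τ , right) τ)
zip-over {rs = rs} {τ} z = subst (λ y → Zip (y ∷ _) rs (write (scan τ , right) τ)) (zip-scan z) (zip-right z)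

flag : ℕ → Cell
flag zero    = blank
flag (suc _) = inp sBot

flag-double : ∀ v → flag v ≡ flag (2 * v)
flag-double zero    = refl
flag-double (suc v) = refl

nondigit-flag : ∀ v → isInp isDigit (flag v) ≡ false
nondigit-flag zero    = refl
nondigit-flag (suc v) = refl

module _ {t B : ℕ} {i : Fin t} (x₀ : Cell) (nondigit : isInp isDigit x₀ ≡ false) where

  Rewinding : List Bool → List Cell → Tape → Set
  Rewinding []       rs = Zip [] (x₀ ∷ rs)
  Rewinding (u ∷ us) rs = Zip (behind x₀ us) (dig u ∷ rs)

  zip-left-behind : ∀ {a x rs τ} us → Zip (behind x₀ us) (x ∷ rs) τ →
                    Rewinding us (a ∷ rs) (write (a , left) τ)
  zip-left-behind []       z = zip-left z
  zip-left-behind (u ∷ us) z = zip-left z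

  rewinding-pos : ∀ us {rs τ} → Rewinding us rs τ → pos τ ≡ length us
  rewinding-pos []       z = zip-pos z
  rewinding-pos (u ∷ us) z = trans (zip-pos z) (length-behind x₀ us)

  does-rewind : ∀ us rs → length us ≤ B →
    Does B i (rewind i) (Rewinding us rs) (Zip [] (x₀ ∷ (map dig us ʳ++ rs)))
  does-rewind [] rs le = does-exit (scan-is isDigit nondigit)
  does-rewind (u ∷ us) rs le = does-iterate (scan-is isDigit (isDigit-dig u))
    (does-act (λ {τ} z → subst (λ y → Rewinding us (y ∷ rs) (write (scan τ , left) τ)) (zip-scan z) (zip-left-behind us z))
              (λ r → ≤-trans (≤-reflexive (rewinding-pos us r)) (<⇒≤ le)))
    (does-rewind us (dig u ∷ rs) (<⇒≤ le))

  behind-pos : ∀ us {rs τ} → length us < B → Zip (behind x₀ us) rs τ → pos τ ≤ B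
  behind-pos us lt z = ≤-trans (≤-reflexive (trans (zip-pos z) (length-behind x₀ us))) lt

  does-return : ∀ {g a} us {y rs} → length us < B → g y ≡ (a , left) →
    Does B i (act i g ▹ rewind i) (Zip (behind x₀ us) (y ∷ rs)) (Zip [] (x₀ ∷ (map dig us ʳ++ (a ∷ rs))))
  does-return {g} {a} us {y} {rs} lt eq = does-seq
    (does-act (λ {τ} z → subst (λ e → Rewinding us (a ∷ rs) (write e τ))
                          (sym (trans (cong g (zip-scan z)) eq)) (zip-left-behind us z))
              (λ r → ≤-trans (≤-reflexive (rewinding-pos us r)) (<⇒≤ lt)))
    (does-rewind us (a ∷ rs) (<⇒≤ lt))

  does-start : 1 ≤ B → ∀ {rs} → Does B i (act i λ x → x , right) (Zip [] (x₀ ∷ rs)) (Zip (behind x₀ []) rs)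
  does-start 1≤B = does-act zip-over (behind-pos [] 1≤B)

  shorter : ∀ (us d : List Bool) u → length us + suc (length d) < B → length (u ∷ us) + length d < B
  shorter us d u = subst (_< B) (+-suc (length us) (length d))

  from-left : ∀ (us : List Bool) n → length us + n < B → length us < B
  from-left us n lt = ≤-trans (s≤s (m≤m+n (length us) n)) lt

  -- The digits `us` already passed, nearest first, are in their final form; `d` is what the carry
  -- still has to reach.
  does-carry : ∀ us d → length us + length d < B →
    Does B i (while i (isInp is1) (act i λ _ → inp s0 , right) ▹ act i (λ _ → inp s1 , left) ▹ rewind i)
         (Zip (behind x₀ us) (map dig d)) (Zip [] (x₀ ∷ map dig (us ʳ++ incr d)))
  does-carry us [] lt = does-weaken zip-pad (digits-of us (true ∷ []))
    (does-exit▹ (scan-is is1 refl) (does-return us (from-left us _ lt) refl))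
  does-carry us (false ∷ d) lt = does-weaken id (digits-of us (true ∷ d))
    (does-exit▹ (scan-is is1 {y = inp s0} refl) (does-return us (from-left us _ lt) refl))
  does-carry us (true ∷ d) lt = does-iterate▹ (scan-is is1 refl)
    (does-act zip-right (behind-pos (false ∷ us) (from-left (false ∷ us) _ (shorter us d false lt))))
    (does-carry (false ∷ us) d (shorter us d false lt))

  -- A positive value has a digit 1, so the scan over zeros stops before the blank behind the
  -- digits.
  does-borrow : ∀ us d → 0 < fromDigits d → length us + length d < B →
    Does B i (while i (isInp is0) (act i λ _ → inp s1 , right) ▹ act i (λ _ → inp s0 , left) ▹ rewind i)
         (Zip (behind x₀ us) (map dig d)) (Zip [] (x₀ ∷ map dig (us ʳ++ decr d)))
  does-borrow us (true ∷ d) _ lt = does-weaken id (digits-of us (false ∷ d))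
    (does-exit▹ (scan-is is0 {y = inp s1} refl) (does-return us (from-left us _ lt) refl))
  does-borrow us (false ∷ d) pos lt = does-iterate▹ (scan-is is0 refl)
    (does-act zip-right (behind-pos (true ∷ us) (from-left (true ∷ us) _ (shorter us d true lt))))
    (does-borrow (true ∷ us) d (*-cancelˡ-< 2 _ _ pos) (shorter us d true lt))

  private
    mark : Cell → Prog t
    mark a = act i (λ x → x , left) ▹ rewind i ▹ act i (λ _ → a , stay)

  does-mark : ∀ {a} us {y rs} → length us < B →
    Does B i (mark a) (Zip (behind x₀ us) (y ∷ rs)) (Zip [] (a ∷ (map dig us ʳ++ (y ∷ rs))))
  does-mark {a} us lt = does-assoc (does-seq (does-return us lt refl)
    (does-act zip-stay (λ z → subst (_≤ B) (sym (zip-pos z)) z≤n)))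

  does-test : ∀ us d → length us + length d < B →
    Does B i (while i (isInp is0) (act i λ x → x , right) ▹ cond i (isInp is1) (mark (inp sBot)) (mark blank))
         (Zip (behind x₀ us) (map dig d)) (Zip [] (flag (fromDigits d) ∷ map dig (us ʳ++ d)))
  does-test us [] lt = does-weaken zip-pad
    -- The head has turned back at the blank behind the last digit; this explicit blank is dropped
    -- again.
    (λ {τ} z → digits-of us [] (zip-unpad (blank ∷ (map dig us ʳ++ []))
      (subst (λ e → Zip [] (blank ∷ e) τ) (Listₚ.ʳ++-defn (map dig us)) z)))
    (does-exit▹ (scan-is is0 refl) (does-else (scan-is is1 refl) (does-mark us (from-left us _ lt))))
  does-test us (true ∷ d) lt = does-weaken id (digits-of us (true ∷ d))
    (does-exit▹ (scan-is is0 {y = inp s1} refl)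
      (does-then (scan-is is1 refl) (does-mark us (from-left us _ lt))))
  does-test us (false ∷ d) lt = does-weaken id
    (λ {τ} → subst (λ x → Zip [] (x ∷ map dig (us ʳ++ (false ∷ d))) τ) (flag-double (fromDigits d)))
    (does-iterate▹ (scan-is is0 refl)
      (does-act zip-over (behind-pos (false ∷ us) (from-left (false ∷ us) _ (shorter us d false lt))))
      (does-test (false ∷ us) d (shorter us d false lt)))

Flagged : ℕ → ℕ → Tape → Set
Flagged b v τ = Register b v τ × scan τ ≡ flag v

does-inc : ∀ {t B b v} {i : Fin t} → b < B → suc v < 2 ^ b →
           Does B i (INC i) (Register b v) (Register b (suc v))
does-inc {b = b} b<B v<2^b = does-by λ { c w (x₀ , d , nd , z , refl , le) →
  let 1≤B = ≤-trans (s≤s z≤n) b<B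
      (c′ , e , w′ , fr , z′) =
        perform (does-seq (does-start x₀ nd 1≤B) (does-carry x₀ nd [] d (≤-trans (s≤s le) b<B))) c w z
  in c′ , e , w′ , fr , x₀ , incr d , nd , z′ , fromDigits-incr d , length-incr b d le v<2^b }

does-dec : ∀ {t B b v} {i : Fin t} → b < B →
           Does B i (DEC i) (Register b (suc v)) (Register b v)
does-dec {b = b} b<B = does-by λ { c w (x₀ , d , nd , z , eq , le) →
  let 1≤B = ≤-trans (s≤s z≤n) b<B
      (c′ , e , w′ , fr , z′) = perform (does-seq (does-start x₀ nd 1≤B)
        (does-borrow x₀ nd [] d (subst (0 <_) (sym eq) (s≤s z≤n)) (≤-trans (s≤s le) b<B))) c w z
  in c′ , e , w′ , fr , x₀ , decr d , nd , z′ , fromDigits-decr d eq , subst (_≤ b) (sym (length-decr d)) le }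

does-zt : ∀ {t B b v} {i : Fin t} → b < B → Does B i (ZT i) (Register b v) (Flagged b v)
does-zt {b = b} {v} b<B = does-by λ { c w (x₀ , d , nd , z , refl , le) →
  let 1≤B = ≤-trans (s≤s z≤n) b<B
      (c′ , e , w′ , fr , z′) =
        perform (does-seq (does-start x₀ nd 1≤B) (does-test x₀ nd [] d (≤-trans (s≤s le) b<B))) c w z
  in c′ , e , w′ , fr , (flag v , d , nondigit-flag v , z′ , refl , le) , zip-scan z′ }

-- Unlike vectors, these tuples have η, so that updates at distinct literal positions commute definitionally.
Tuple : Set → ℕ → Set
Tuple A zero    = ⊤
Tuple A (suc n) = A × Tuple A n

pick : ∀ {A n} → Fin n → Tuple A n → A
pick Fin.zero    (x , _)  = x
pick (Fin.suc i) (_ , xs) = pick i xs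

put : ∀ {A n} → Fin n → A → Tuple A n → Tuple A n
put Fin.zero    a (_ , xs) = a , xs
put (Fin.suc i) a (x , xs) = x , put i a xs

pick-put : ∀ {A n} (i : Fin n) (a : A) xs → pick i (put i a xs) ≡ a
pick-put Fin.zero    a xs = refl
pick-put (Fin.suc i) a xs = pick-put i a (proj₂ xs)

pick-put-other : ∀ {A n} {i j : Fin n} (a : A) xs → i ≢ j → pick i (put j a xs) ≡ pick i xs
pick-put-other {i = Fin.zero}  {Fin.zero}  a xs ne = contradiction refl ne
pick-put-other {i = Fin.zero}  {Fin.suc j} a xs ne = refl
pick-put-other {i = Fin.suc i} {Fin.zero}  a xs ne = refl
pick-put-other {i = Fin.suc i} {Fin.suc j} a xs ne = pick-put-other a (proj₂ xs) (ne ∘ cong Fin.suc)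

put-put : ∀ {A n} (i : Fin n) {a a′ : A} {xs} → put i a′ (put i a xs) ≡ put i a′ xs
put-put Fin.zero    = refl
put-put (Fin.suc i) = cong (_ ,_) (put-put i)

put-pick : ∀ {A n} (i : Fin n) {a : A} {xs} → pick i xs ≡ a → put i a xs ≡ xs
put-pick Fin.zero    refl = refl
put-pick (Fin.suc i) eq   = cong (_ ,_) (put-pick i eq)

-- Stores of numbers and words, and their simulation on tapes

module Store (m r : ℕ) where

  -- file true is the ordinal register file, file false a second one for a copy of it;
  -- the output is stored in reverse.
  record Store : Set where
    constructor store
    field
      scalars : Tuple ℕ 7
      filesOf : Tuple (Vec ℕ r) 2
      inputs  : Tuple Word m
      rout    : Word
  open Store public

  data Reg : Set where
    sc  : Fin 7 → Reg
    fil : Bool → Fin r → Reg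

  copy : Bool → Fin 2
  copy true  = 0F
  copy false = 1F

  file : Bool → Store → Vec ℕ r
  file k σ = pick (copy k) (filesOf σ)

  setFile : Bool → Vec ℕ r → Store → Store
  setFile k v σ = record σ { filesOf = put (copy k) v (filesOf σ) }

  get : Reg → Store → ℕ
  get (sc i)    σ = pick i (scalars σ)
  get (fil k t) σ = lookup (file k σ) t

  set : Reg → ℕ → Store → Store
  set (sc i)    v σ = record σ { scalars = put i v (scalars σ) }
  set (fil k t) v σ = setFile k (file k σ [ t ]≔ v) σ

  input : Fin m → Store → Word
  input j σ = pick j (inputs σ)

  setInput : Fin m → Word → Store → Store
  setInput j w σ = record σ { inputs = put j w (inputs σ) }

  emitted : Word → Store → Store
  emitted w σ = record σ { rout = w ʳ++ rout σ }

  get-set : ∀ x v σ → get x (set x v σ) ≡ v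
  get-set (sc i)        v σ = pick-put i v (scalars σ)
  get-set (fil true t)  v σ = Vecₚ.lookup∘update t (file true σ) v
  get-set (fil false t) v σ = Vecₚ.lookup∘update t (file false σ) v

  get-set-other : ∀ {x y} v σ → x ≢ y → get x (set y v σ) ≡ get x σ
  get-set-other {sc i}    {sc j}    v σ ne = pick-put-other v (scalars σ) (ne ∘ cong sc)
  get-set-other {sc i}    {fil _ _} v σ ne = refl
  get-set-other {fil _ _} {sc _}    v σ ne = refl
  get-set-other {fil true s}  {fil true t}  v σ ne = Vecₚ.lookup∘update′ (ne ∘ cong (fil true)) (file true σ) v
  get-set-other {fil true s}  {fil false t} v σ ne = refl
  get-set-other {fil false s} {fil true t}  v σ ne = refl
  get-set-other {fil false s} {fil false t} v σ ne = Vecₚ.lookup∘update′ (ne ∘ cong (fil false)) (file false σ) v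

  work′ : ℕ
  work′ = 7 + (r + r)

  number : Reg → Fin work′
  number (sc i)        = join 7 (r + r) (inj₁ i)
  number (fil true t)  = join 7 (r + r) (inj₂ (join r r (inj₁ t)))
  number (fil false t) = join 7 (r + r) (inj₂ (join r r (inj₂ t)))

  register-file : Fin r ⊎ Fin r → Reg
  register-file (inj₁ t) = fil true t
  register-file (inj₂ t) = fil false t

  register′ : Fin 7 ⊎ Fin (r + r) → Reg
  register′ (inj₁ i) = sc i
  register′ (inj₂ f) = register-file (splitAt r f)

  register : Fin work′ → Reg
  register w = register′ (splitAt 7 w)

  register-number : ∀ x → register (number x) ≡ x
  register-number (sc i) = cong register′ (Finₚ.splitAt-join 7 (r + r) (inj₁ i))
  register-number (fil true t) = trans (cong register′ (Finₚ.splitAt-join 7 (r + r) (inj₂ _)))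
                                       (cong register-file (Finₚ.splitAt-join r r (inj₁ t)))
  register-number (fil false t) = trans (cong register′ (Finₚ.splitAt-join 7 (r + r) (inj₂ _)))
                                        (cong register-file (Finₚ.splitAt-join r r (inj₂ t)))

  number-register : ∀ w → number (register w) ≡ w
  number-register w = trans (go (splitAt 7 w)) (Finₚ.join-splitAt 7 (r + r) w)
    where
    go′ : ∀ x → number (register-file x) ≡ join 7 (r + r) (inj₂ (join r r x))
    go′ (inj₁ t) = refl
    go′ (inj₂ t) = refl
    go : ∀ x → number (register′ x) ≡ join 7 (r + r) x
    go (inj₁ i) = refl
    go (inj₂ f) = trans (go′ (splitAt r f)) (cong (λ z → join 7 (r + r) (inj₂ z)) (Finₚ.join-splitAt r r f))

  Tp : Set
  Tp = Fin (suc (m + work′))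

  outT : Tp
  outT = Fin.zero

  inT : Fin m → Tp
  inT j = Fin.suc (join m work′ (inj₁ j))

  regT : Reg → Tp
  regT x = Fin.suc (join m work′ (inj₂ (number x)))

  Program : Set
  Program = Prog (suc (m + work′))

  pass : Program
  pass = skip outT

  inc dec : Reg → Program
  inc x = INC (regT x)
  dec x = DEC (regT x)

  ifPositive : Reg → Program → Program → Program
  ifPositive x p q = ZT (regT x) ▹ cond (regT x) (isInp isBot) p q

  whilePositive : Reg → Program → Program
  whilePositive x p = ZT (regT x) ▹ while (regT x) (isInp isBot) (p ▹ ZT (regT x))

  advance : Fin m → Program
  advance j = act (inT j) λ x → x , right

  emit : Sym → Program
  emit s = act outT λ _ → inp s , right

  ifInput : Fin m → (Cell → Bool) → Program → Program → Program
  ifInput j = cond (inT j)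

  whileInput : Fin m → (Cell → Bool) → Program → Program
  whileInput j = while (inT j)

  module Sim (b B : ℕ) (b<B : b < B) where

    -- Only the part not yet read is recorded. Advancing keeps the sum of the position and the
    -- remaining length, so the one bound covers all later head positions.
    InputTape : Word → Tape → Set
    InputTape w τ = (∀ i → cells τ (i + pos τ) ≡ nth (map inp w) i) × pos τ + length w ≤ B

    repʷ : Store → Fin m ⊎ Fin work′ → Tape → Set
    repʷ σ (inj₁ j) = InputTape (input j σ)
    repʷ σ (inj₂ w) = Register b (get (register w) σ)

    rep : Store → Tp → Tape → Set
    rep σ Fin.zero    = Zip (map inp (rout σ)) []
    rep σ (Fin.suc j) = repʷ σ (splitAt m j)

    record _~_ (σ : Store) (c : Tapes (suc (m + work′))) : Set where
      constructor represents
      field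
        ~within : Within B c
        ~tape   : ∀ j → rep σ j (c j)
    open _~_ public

    record Sim (p : Program) (σ σ′ : Store) : Set where
      constructor sim-by
      field
        simulate : ∀ c → σ ~ c → Σ (Tapes (suc (m + work′))) λ c′ → Exec B p c c′ × σ′ ~ c′
    open Sim public

    lift : ∀ {i p P Q σ σ′} → Does B i p P Q → (∀ {τ} → rep σ i τ → P τ) → (∀ {τ} → Q τ → rep σ′ i τ) →
           (∀ j → j ≢ i → ∀ {τ} → rep σ j τ → rep σ′ j τ) → Sim p σ σ′
    lift {i} {σ = σ} {σ′} d f g h = sim-by λ { c (represents w t) →
      let (c′ , e , w′ , fr , q) = perform d c w (f (t i))
      in c′ , e , represents w′ (tapes c c′ t fr q) }
      where
      tapes : ∀ c c′ → (∀ j → rep σ j (c j)) → (∀ j → j ≢ i → c′ j ≡ c j) → _ → ∀ j → rep σ′ j (c′ j)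
      tapes c c′ t fr q j with j Finₚ.≟ i
      ... | yes refl = g q
      ... | no ne = subst (rep σ′ j) (sym (fr j ne)) (h j ne (t j))

    rep-reg : ∀ x σ → rep σ (regT x) ≡ Register b (get x σ)
    rep-reg x σ = trans (cong (repʷ σ) (Finₚ.splitAt-join m work′ (inj₂ (number x))))
                        (cong (λ y → Register b (get y σ)) (register-number x))

    rep-in : ∀ j σ → rep σ (inT j) ≡ InputTape (input j σ)
    rep-in j σ = cong (repʷ σ) (Finₚ.splitAt-join m work′ (inj₁ j))

    other-reg : ∀ x v σ j → j ≢ regT x → rep σ j ≡ rep (set x v σ) j
    other-reg (sc i)    v σ Fin.zero ne = refl
    other-reg (fil k t) v σ Fin.zero ne = refl
    other-reg x v σ (Fin.suc j) ne with splitAt m j in eq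
    other-reg (sc _)    v σ (Fin.suc j) ne | inj₁ i = refl
    other-reg (fil _ _) v σ (Fin.suc j) ne | inj₁ i = refl
    ... | inj₂ w = cong (Register b) (sym (get-set-other {register w} {x} v σ λ rw → ne (cong Fin.suc
            (trans (sym (Finₚ.join-splitAt m work′ j))
            (trans (cong (join m work′) eq) (cong (λ z → join m work′ (inj₂ z))
                   (trans (sym (number-register w)) (cong number rw))))))))

    other-in : ∀ i w σ j → j ≢ inT i → rep σ j ≡ rep (setInput i w σ) j
    other-in i w σ Fin.zero ne = refl
    other-in i w σ (Fin.suc j) ne with splitAt m j in eq
    ... | inj₂ w′ = cong (Register b) (get-setInput (register w′))
      where
      get-setInput : ∀ x → get x σ ≡ get x (setInput i w σ)
      get-setInput (sc _)    = refl
      get-setInput (fil _ _) = refl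
    ... | inj₁ i′ = cong InputTape (sym (pick-put-other w (inputs σ) λ i′≡i → ne (cong Fin.suc
            (trans (sym (Finₚ.join-splitAt m work′ j))
            (trans (cong (join m work′) eq) (cong (λ z → join m work′ (inj₁ z)) i′≡i))))))

    cast : ∀ {P Q : Tape → Set} → P ≡ Q → ∀ {τ} → P τ → Q τ
    cast refl x = x

    sim-inc : ∀ x {σ v} → get x σ ≡ v → suc v < 2 ^ b → Sim (inc x) σ (set x (suc v) σ)
    sim-inc x {σ} {v} refl lt = lift (does-inc b<B lt) (cast (rep-reg x σ))
      (cast (sym (trans (rep-reg x _) (cong (Register b) (get-set x (suc v) σ)))))
      (λ j ne → cast (other-reg x (suc v) σ j ne))

    sim-dec : ∀ x {σ v} → get x σ ≡ suc v → Sim (dec x) σ (set x v σ)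
    sim-dec x {σ} {v} eq = lift (does-dec b<B) (cast (trans (rep-reg x σ) (cong (Register b) eq)))
      (cast (sym (trans (rep-reg x _) (cong (Register b) (get-set x v σ)))))
      (λ j ne → cast (other-reg x v σ j ne))

    sim-advance : ∀ j {σ s w} → input j σ ≡ s ∷ w → Sim (advance j) σ (setInput j w σ)
    sim-advance j {σ} {s} {w} eq = lift {P = InputTape (s ∷ w)} {Q = InputTape w}
      (does-act (λ {τ} (z , le) →
           (λ i → trans (cong (overwrite (scan τ) (cells τ) (pos τ)) (+-suc i (pos τ)))
                        (right-overwrite (scan τ) (cells τ) {pos τ} z (suc i))) ,
           subst (_≤ B) (+-suc (pos τ) (length w)) le)
         (λ {τ} (z , le) → ≤-trans (m≤m+n (pos τ) (length w)) le))
      (cast (trans (rep-in j σ) (cong InputTape eq)))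
      (cast (sym (trans (rep-in j _) (cong InputTape (pick-put j w (inputs σ))))))
      (λ j′ ne → cast (other-in j w σ j′ ne))

    sim-emit : ∀ s {σ} → length (rout σ) < B → Sim (emit s) σ (emitted (s ∷ []) σ)
    sim-emit s {σ} lt = lift {P = Zip (map inp (rout σ)) []} {Q = Zip (inp s ∷ map inp (rout σ)) []}
      (does-act (λ z → zip-right (zip-pad z))
                (λ z → subst (_≤ B) (sym (trans (zip-pos z) (cong suc (Listₚ.length-map inp (rout σ))))) lt))
      id id other
      where
      other : ∀ j → j ≢ outT → ∀ {τ} → rep σ j τ → rep (emitted (s ∷ []) σ) j τ
      other Fin.zero ne z = contradiction refl ne
      other (Fin.suc j) ne z with splitAt m j
      ... | inj₁ _ = z
      ... | inj₂ w = cast (cong (Register b) (get-emitted (register w))) z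
        where
        get-emitted : ∀ x → get x σ ≡ get x (emitted (s ∷ []) σ)
        get-emitted (sc _)    = refl
        get-emitted (fil _ _) = refl

    sim-pass : ∀ {σ} → Sim pass σ σ
    sim-pass = sim-by λ c r → c , e-skip , r

    infixr 4 _⟫_
    _⟫_ : ∀ {p q σ σ₁ σ₂} → Sim p σ σ₁ → Sim q σ₁ σ₂ → Sim (p ▹ q) σ σ₂
    x ⟫ y = sim-by λ c r → let (c₁ , e₁ , r₁) = simulate x c r ; (c₂ , e₂ , r₂) = simulate y c₁ r₁
                           in c₂ , e-seq e₁ e₂ , r₂

    sim-test : ∀ x σ c → σ ~ c → Σ (Tapes (suc (m + work′))) λ c′ →
      Exec B (ZT (regT x)) c c′ × σ ~ c′ × scan (c′ (regT x)) ≡ flag (get x σ)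
    sim-test x σ c (represents w t) =
      let (c′ , e , w′ , fr , (z , s)) = perform (does-zt b<B) c w (cast (rep-reg x σ) (t (regT x)))
      in c′ , e , represents w′ (tapes c′ fr z) , s
      where
      tapes : ∀ c′ → (∀ j → j ≢ regT x → c′ j ≡ c j) → Register b (get x σ) (c′ (regT x)) → ∀ j → rep σ j (c′ j)
      tapes c′ fr z j with j Finₚ.≟ regT x
      ... | yes refl = cast (sym (rep-reg x σ)) z
      ... | no ne = subst (rep σ j) (sym (fr j ne)) (t j)

    sim-positive : ∀ x {p q σ σ′ v} → get x σ ≡ suc v → Sim p σ σ′ → Sim (ifPositive x p q) σ σ′
    sim-positive x {σ = σ} eq y = sim-by λ c r →
      let (c₁ , e₁ , r₁ , f₁) = sim-test x σ c r ; (c₂ , e₂ , r₂) = simulate y c₁ r₁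
      in c₂ , e-seq e₁ (e-then (cong (isInp isBot) (trans f₁ (cong flag eq))) e₂) , r₂

    sim-zero : ∀ x {p q σ σ′} → get x σ ≡ 0 → Sim q σ σ′ → Sim (ifPositive x p q) σ σ′
    sim-zero x {σ = σ} eq y = sim-by λ c r →
      let (c₁ , e₁ , r₁ , f₁) = sim-test x σ c r ; (c₂ , e₂ , r₂) = simulate y c₁ r₁
      in c₂ , e-seq e₁ (e-else (cong (isInp isBot) (trans f₁ (cong flag eq))) e₂) , r₂

    sim-done : ∀ x {p σ} → get x σ ≡ 0 → Sim (whilePositive x p) σ σ
    sim-done x {σ = σ} eq = sim-by λ c r → let (c₁ , e₁ , r₁ , f₁) = sim-test x σ c r
      in c₁ , e-seq e₁ (e-exit (cong (isInp isBot) (trans f₁ (cong flag eq)))) , r₁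

    sim-loop : ∀ x {p σ σ₁ σ₂ v} → get x σ ≡ suc v → Sim p σ σ₁ → Sim (whilePositive x p) σ₁ σ₂ →
               Sim (whilePositive x p) σ σ₂
    sim-loop x {p} {σ = σ} eq y z = sim-by λ c r →
      let (c₁ , e₁ , r₁ , f₁) = sim-test x σ c r ; (c₂ , e₂ , r₂) = simulate y c₁ r₁
          (c₃ , e₃ , r₃) = simulate z c₂ r₂
      in c₃ , join-loop e₁ (cong (isInp isBot) (trans f₁ (cong flag eq))) e₂ e₃ , r₃
      where
      -- The zero test that opens the remaining loop is the same as the one that closes the body.
      join-loop : ∀ {c c₁ c₂ c₃} → Exec B (ZT (regT x)) c c₁ → isInp isBot (scan (c₁ (regT x))) ≡ true →
             Exec B p c₁ c₂ → Exec B (whilePositive x p) c₂ c₃ → Exec B (whilePositive x p) c c₃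
      join-loop e₁ t e₂ (e-seq e₃ e₄) = e-seq e₁ (e-iterate t (e-seq e₂ e₃) e₄)

    current : Word → Cell
    current []      = blank
    current (s ∷ _) = inp s

    scan-input : ∀ j {σ c} → σ ~ c → scan (c (inT j)) ≡ current (input j σ)
    scan-input j {σ} {c} r with cast (rep-in j σ) (~tape r (inT j))
    ... | z , _ with input j σ
    ... | []    = z 0
    ... | _ ∷ _ = z 0

    sim-in-then : ∀ j {f p q σ σ′} → f (current (input j σ)) ≡ true → Sim p σ σ′ → Sim (ifInput j f p q) σ σ′
    sim-in-then j {f} eq y = sim-by λ c r → let (c₁ , e , r₁) = simulate y c r
      in c₁ , e-then (trans (cong f (scan-input j r)) eq) e , r₁

    sim-in-else : ∀ j {f p q σ σ′} → f (current (input j σ)) ≡ false → Sim q σ σ′ → Sim (ifInput j f p q) σ σ′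
    sim-in-else j {f} eq y = sim-by λ c r → let (c₁ , e , r₁) = simulate y c r
      in c₁ , e-else (trans (cong f (scan-input j r)) eq) e , r₁

    sim-in-done : ∀ j {f p σ} → f (current (input j σ)) ≡ false → Sim (whileInput j f p) σ σ
    sim-in-done j {f} eq = sim-by λ c r → c , e-exit (trans (cong f (scan-input j r)) eq) , r

    sim-in-loop : ∀ j {f p σ σ₁ σ₂} → f (current (input j σ)) ≡ true → Sim p σ σ₁ →
                  Sim (whileInput j f p) σ₁ σ₂ → Sim (whileInput j f p) σ σ₂
    sim-in-loop j {f} eq y z = sim-by λ c r →
      let (c₁ , e₁ , r₁) = simulate y c r ; (c₂ , e₂ , r₂) = simulate z c₁ r₁
      in c₂ , e-iterate (trans (cong f (scan-input j r)) eq) e₁ e₂ , r₂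

-- Ordinals

≈-refl : ∀ {α} → α ≈ α
≈-refl {𝟎}     = ≈𝟎
≈-refl {α ⁺}   = ≈⁺ ≈-refl
≈-refl {lim f} = ≈lim λ i → ≈-refl

≈-reflexive : ∀ {α β} → α ≡ β → α ≈ β
≈-reflexive refl = ≈-refl

≈-sym : ∀ {α β} → α ≈ β → β ≈ α
≈-sym ≈𝟎       = ≈𝟎
≈-sym (≈⁺ p)   = ≈⁺ (≈-sym p)
≈-sym (≈lim p) = ≈lim λ i → ≈-sym (p i)

≈-trans : ∀ {α β γ} → α ≈ β → β ≈ γ → α ≈ γ
≈-trans ≈𝟎       ≈𝟎       = ≈𝟎
≈-trans (≈⁺ p)   (≈⁺ q)   = ≈⁺ (≈-trans p q)
≈-trans (≈lim p) (≈lim q) = ≈lim λ i → ≈-trans (p i) (q i)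

⊕-cong : ∀ {α α′ β β′} → α ≈ α′ → β ≈ β′ → α ⊕ β ≈ α′ ⊕ β′
⊕-cong p ≈𝟎       = p
⊕-cong p (≈⁺ q)   = ≈⁺ (⊕-cong p q)
⊕-cong p (≈lim q) = ≈lim λ i → ⊕-cong p (q i)

⊕-assoc : ∀ α β γ → (α ⊕ β) ⊕ γ ≈ α ⊕ (β ⊕ γ)
⊕-assoc α β 𝟎       = ≈-refl
⊕-assoc α β (γ ⁺)   = ≈⁺ (⊕-assoc α β γ)
⊕-assoc α β (lim f) = ≈lim λ i → ⊕-assoc α β (f i)

⊕-identityˡ : ∀ α → 𝟎 ⊕ α ≈ α
⊕-identityˡ 𝟎       = ≈𝟎
⊕-identityˡ (α ⁺)   = ≈⁺ (⊕-identityˡ α)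
⊕-identityˡ (lim f) = ≈lim λ i → ⊕-identityˡ (f i)

pred-cong : ∀ {α β} n → α ≈ β → pred α n ≈ pred β n
pred-cong n ≈𝟎       = ≈𝟎
pred-cong n (≈⁺ p)   = p
pred-cong n (≈lim p) = p n

Rb-cong : ∀ i {α β} n → α ≈ β → Rb i α n ≈ Rb i β n
Rb-cong zero    n p = p
Rb-cong (suc i) n p = pred-cong n (Rb-cong i n p)

Rb-suc : ∀ i α n → Rb (suc i) α n ≡ Rb i (pred α n) n
Rb-suc zero    α n = refl
Rb-suc (suc i) α n = cong (λ β → pred β n) (Rb-suc i α n)

L-cong : ∀ {α β} n → α ≈ β → L α n ≡ L β n
L-cong n ≈𝟎       = refl
L-cong n (≈⁺ p)   = cong suc (L-cong n p)
L-cong n (≈lim p) = cong suc (L-cong n (p n))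

G-cong : ∀ {α β} n → α ≈ β → G α n ≡ G β n
G-cong n ≈𝟎       = refl
G-cong n (≈⁺ p)   = cong suc (G-cong n p)
G-cong n (≈lim p) = G-cong n (p n)

L-⊕ : ∀ α β n → L (α ⊕ β) n ≡ L β n + L α n
L-⊕ α 𝟎       n = refl
L-⊕ α (β ⁺)   n = cong suc (L-⊕ α β n)
L-⊕ α (lim f) n = cong suc (L-⊕ α (f n) n)

G≤L : ∀ α n → G α n ≤ L α n
G≤L 𝟎       n = z≤n
G≤L (α ⁺)   n = s≤s (G≤L α n)
G≤L (lim f) n = ≤-trans (G≤L (f n) n) (n≤1+n _)

ω^ : ℕ → Ω
ω^ p = ω ^Ω o p

-- Up to a 0 added on the left, member 0 of the limit α + ω^(p+1) is α + ω^p. So the exponents go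
-- down together until a successor appears on both sides; a successor is never a limit.
⊕-ω^-injective : ∀ p q {α β} → α ⊕ ω^ p ≈ β ⊕ ω^ q → p ≡ q × α ≈ β
⊕-ω^-injective zero    zero    (≈⁺ e)   = refl , e
⊕-ω^-injective (suc p) (suc q) {α} {β} (≈lim e) =
  let (p≡q , α≈β) = ⊕-ω^-injective p q (≈-trans (⊕-cong (≈-refl {α}) (≈-sym (⊕-identityˡ (ω^ p))))
                      (≈-trans (e 0) (⊕-cong (≈-refl {β}) (⊕-identityˡ (ω^ q)))))
  in cong suc p≡q , α≈β

ω^-nonzero : ∀ p {α} → ¬ (𝟎 ≈ α ⊕ ω^ p)
ω^-nonzero zero    ()
ω^-nonzero (suc p) ()

ωpow-+ : ∀ p a b → ωpow p a ⊕ ωpow p b ≈ ωpow p (b + a)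
ωpow-+ p a zero    = ≈-refl
ωpow-+ p a (suc b) = ≈-trans (≈-sym (⊕-assoc (ωpow p a) (ωpow p b) (ω^ p))) (⊕-cong (ωpow-+ p a b) ≈-refl)

Terms : Set
Terms = List (ℕ × ℕ)

sumTerms : Ω → Terms → Ω
sumTerms α []             = α
sumTerms α ((p , c) ∷ r) = sumTerms (α ⊕ ωpow p c) r

sumTerms-cong : ∀ {α β} r → α ≈ β → sumTerms α r ≈ sumTerms β r
sumTerms-cong []            e = e
sumTerms-cong ((p , c) ∷ r) e = sumTerms-cong r (⊕-cong e ≈-refl)

sumTerms-⊕ : ∀ α β r → sumTerms (α ⊕ β) r ≈ α ⊕ sumTerms β r
sumTerms-⊕ α β []            = ≈-refl
sumTerms-⊕ α β ((p , c) ∷ r) = ≈-trans (sumTerms-cong r (⊕-assoc α β _)) (sumTerms-⊕ α _ r)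

sumTerms-++ : ∀ α r s → sumTerms α (r ++ s) ≡ sumTerms (sumTerms α r) s
sumTerms-++ α []            s = refl
sumTerms-++ α ((p , c) ∷ r) s = sumTerms-++ (α ⊕ ωpow p c) r s

-- The accumulator loop inside evalNF is not in scope by name; the underscore stands for it.
mutual
  evalNF-loop : ∀ pc nf₀ acc nf → _ ≡ sumTerms acc nf
  evalNF-loop pc nf₀ acc []       = refl
  evalNF-loop pc nf₀ acc (qd ∷ r) = evalNF-loop pc nf₀ _ r

  evalNF-sumTerms : ∀ pc nf → evalNF (pc ∷ nf) ≡ sumTerms (ωpow (proj₁ pc) (proj₂ pc)) nf
  evalNF-sumTerms pc [] = refl
  -- Abstracting the list and the accumulator makes them variables. The loop is then applied to
  -- distinct variables, which lets unification solve the underscore.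
  evalNF-sumTerms pc (x ∷ r) with x ∷ r | ωpow (proj₁ pc) (proj₂ pc) ⊕ ωpow (proj₁ x) (proj₂ x)
  ... | nf₀ | acc = evalNF-loop pc nf₀ acc r

evalNF≈ : ∀ nf → evalNF nf ≈ sumTerms 𝟎 nf
evalNF≈ []       = ≈𝟎
evalNF≈ (x ∷ nf) = ≈-trans (≈-reflexive (evalNF-sumTerms x nf)) (sumTerms-cong nf (≈-sym (⊕-identityˡ _)))

-- Uniqueness of normal forms

-- Coefficients in unary. On plain lists of exponents the sum is injective without further
-- conditions; the conditions on normal forms only serve to recover the coefficients as lengths of
-- runs.
flat : Terms → List ℕ
flat []            = []
flat ((p , c) ∷ r) = replicate c p ++ flat r

sumFlat : Ω → List ℕ → Ω
sumFlat = foldl (λ α p → α ⊕ ω^ p)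

sumFlat-replicate : ∀ p c α → sumFlat α (replicate c p) ≈ α ⊕ ωpow p c
sumFlat-replicate p zero    α = ≈-refl
sumFlat-replicate p (suc c) α = ≈-trans (sumFlat-replicate p c (α ⊕ ω^ p)) (≈-trans (⊕-assoc α (ω^ p) (ωpow p c))
  (⊕-cong (≈-refl {α}) (≈-trans (⊕-cong (≈-sym (⊕-identityˡ (ω^ p))) (≈-refl {ωpow p c}))
    (≈-trans (ωpow-+ p 1 c) (≈-reflexive (cong (ωpow p) (+-comm c 1)))))))

sumFlat-flat : ∀ r α → sumFlat α (flat r) ≈ sumTerms α r
sumFlat-flat []            α = ≈-refl
sumFlat-flat ((p , c) ∷ r) α = ≈-trans
  (≈-reflexive (Listₚ.foldl-++ (λ α p → α ⊕ ω^ p) α (replicate c p) (flat r)))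
  (≈-trans (sumFlat-flat r _) (sumTerms-cong r (sumFlat-replicate p c α)))

-- Last exponent first, because `⊕-ω^-injective` takes off the last summand.
sumRev : List ℕ → Ω
sumRev = foldr (λ p α → α ⊕ ω^ p) 𝟎

sumRev-injective : ∀ ps qs → sumRev ps ≈ sumRev qs → ps ≡ qs
sumRev-injective []       []       e = refl
sumRev-injective []       (q ∷ qs) e = contradiction e (ω^-nonzero q)
sumRev-injective (p ∷ ps) []       e = contradiction (≈-sym e) (ω^-nonzero p)
sumRev-injective (p ∷ ps) (q ∷ qs) e =
  let (p≡q , e′) = ⊕-ω^-injective p q e in cong₂ _∷_ p≡q (sumRev-injective ps qs e′)

sumFlat-injective : ∀ ps qs → sumFlat 𝟎 ps ≈ sumFlat 𝟎 qs → ps ≡ qs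
sumFlat-injective ps qs e = Listₚ.reverse-injective (sumRev-injective (reverse ps) (reverse qs)
  (≈-trans (rev ps) (≈-trans e (≈-sym (rev qs)))))
  where
  rev : ∀ ps → sumRev (reverse ps) ≈ sumFlat 𝟎 ps
  rev ps = ≈-reflexive (Listₚ.reverse-foldr (λ p α → α ⊕ ω^ p) 𝟎 ps)

Apart : ℕ × ℕ → ℕ × ℕ → Set
Apart a b = proj₁ a ≢ proj₁ b

Positive : ℕ × ℕ → Set
Positive pc = 1 ≤ proj₂ pc

Apart-coefficient : ∀ {p c c′ r} → Linked Apart ((p , c) ∷ r) → Linked Apart ((p , c′) ∷ r)
Apart-coefficient [-]     = [-]
Apart-coefficient (x ∷ l) = x ∷ l

flat-injective : ∀ r s → All Positive r → Linked Apart r → All Positive s → Linked Apart s →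
                 flat r ≡ flat s → r ≡ s
-- If one run of `p` ended earlier, its successor term would have to begin with `p`, against
-- `Apart`. That condition ignores coefficients, so `c` and `d` can be counted down to 0 without
-- losing it.
compare-runs : ∀ p c r d s → All Positive r → Linked Apart ((p , c) ∷ r) → All Positive s →
               Linked Apart ((p , d) ∷ s) → replicate c p ++ flat r ≡ replicate d p ++ flat s → c ≡ d × r ≡ s
flat-injective [] [] _ _ _ _ e = refl
flat-injective [] ((q , suc d) ∷ s) _ _ (s≤s z≤n ∷ _) _ ()
flat-injective ((p , suc c) ∷ r) [] (s≤s z≤n ∷ _) _ _ _ ()
flat-injective ((p , suc c) ∷ r) ((q , suc d) ∷ s) (_ ∷ ar) lr (_ ∷ as) ls e with Listₚ.∷-injectiveˡ e
... | refl = let (c≡d , r≡s) = compare-runs p c r d s ar (Apart-coefficient lr) as (Apart-coefficient ls) (Listₚ.∷-injectiveʳ e)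
             in cong₂ _∷_ (cong (λ z → p , suc z) c≡d) r≡s
compare-runs p zero    r zero    s ar lr as ls e =
  refl , flat-injective r s ar (Linked.tail lr) as (Linked.tail ls) e
compare-runs p (suc c) r (suc d) s ar lr as ls e =
  let (c≡d , r≡s) = compare-runs p c r d s ar (Apart-coefficient lr) as (Apart-coefficient ls) (Listₚ.∷-injectiveʳ e)
  in cong suc c≡d , r≡s
compare-runs p zero ((q , suc c) ∷ r) (suc d) s ar (ne ∷ _) as ls e = contradiction (sym (Listₚ.∷-injectiveˡ e)) ne
compare-runs p zero ((q , zero) ∷ r) (suc d) s (() ∷ _) lr as ls e
compare-runs p (suc c) r zero ((q , suc d) ∷ s) ar lr as (ne ∷ _) e = contradiction (Listₚ.∷-injectiveˡ e) ne
compare-runs p (suc c) r zero ((q , zero) ∷ s) ar lr (() ∷ _) ls e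

sumTerms-injective : ∀ r s → All Positive r → Linked Apart r → All Positive s → Linked Apart s →
                     sumTerms 𝟎 r ≈ sumTerms 𝟎 s → r ≡ s
sumTerms-injective r s ar lr as ls e = flat-injective r s ar lr as ls (sumFlat-injective (flat r) (flat s)
  (≈-trans (sumFlat-flat r 𝟎) (≈-trans e (≈-sym (sumFlat-flat s 𝟎)))))

-- Normalisation of a sum of terms

-- `(p , q)` is the pending term: it may still absorb later terms of its exponent, and is output
-- when another exponent or the end is met. The printing program follows the same recursion.
normFrom : ℕ → ℕ → Terms → Terms
normFrom p q []                 = (p , q) ∷ []
normFrom p q ((e , zero) ∷ r)   = normFrom p q r
normFrom p q ((e , suc c) ∷ r) with e ≟ p
... | yes _ = normFrom p (suc c + q) r
... | no _  = (p , q) ∷ normFrom e (suc c) r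

norm : Terms → Terms
norm []                = []
norm ((e , zero) ∷ r)  = norm r
norm ((e , suc c) ∷ r) = normFrom e (suc c) r

normFrom-sum : ∀ α p q r → sumTerms α (normFrom p q r) ≈ sumTerms (α ⊕ ωpow p q) r
normFrom-sum α p q [] = ≈-refl
normFrom-sum α p q ((e , zero) ∷ r) = normFrom-sum α p q r
normFrom-sum α p q ((e , suc c) ∷ r) with e ≟ p
... | yes refl = ≈-trans (normFrom-sum α p (suc c + q) r)
  (sumTerms-cong r (≈-trans (⊕-cong (≈-refl {α}) (≈-sym (ωpow-+ p q (suc c)))) (≈-sym (⊕-assoc α (ωpow p q) (ωpow p (suc c))))))
... | no _ = normFrom-sum (α ⊕ ωpow p q) e (suc c) r

norm-sum : ∀ α r → sumTerms α (norm r) ≈ sumTerms α r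
norm-sum α []                = ≈-refl
norm-sum α ((e , zero) ∷ r)  = norm-sum α r
norm-sum α ((e , suc c) ∷ r) = normFrom-sum α e (suc c) r

normFrom-positive : ∀ p q r → 1 ≤ q → All Positive (normFrom p q r)
normFrom-positive p q [] 1≤q = 1≤q ∷ []
normFrom-positive p q ((e , zero) ∷ r) 1≤q = normFrom-positive p q r 1≤q
normFrom-positive p q ((e , suc c) ∷ r) 1≤q with e ≟ p
... | yes _ = normFrom-positive p (suc c + q) r (s≤s z≤n)
... | no _  = 1≤q ∷ normFrom-positive e (suc c) r (s≤s z≤n)

norm-positive : ∀ r → All Positive (norm r)
norm-positive []                = []
norm-positive ((e , zero) ∷ r)  = norm-positive r
norm-positive ((e , suc c) ∷ r) = normFrom-positive e (suc c) r (s≤s z≤n)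

normFrom-linked : ∀ x p q r → proj₁ x ≢ p → Linked Apart (x ∷ normFrom p q r)
normFrom-linked x p q [] ne = ne ∷ [-]
normFrom-linked x p q ((e , zero) ∷ r) ne = normFrom-linked x p q r ne
normFrom-linked x p q ((e , suc c) ∷ r) ne with e ≟ p
... | yes _  = normFrom-linked x p (suc c + q) r ne
... | no e≢p = ne ∷ normFrom-linked (p , q) e (suc c) r (e≢p ∘ sym)

norm-linked : ∀ r → Linked Apart (norm r)
norm-linked []                = []
norm-linked ((e , zero) ∷ r)  = norm-linked r
-- A fictitious preceding term of exponent `suc e`, which differs from `e`, provides the required
-- head and is removed again.
norm-linked ((e , suc c) ∷ r) = Linked.tail (normFrom-linked (suc e , 0) e (suc c) r λ ())

-- The shape of the normal forms of the elements of Ψ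

exponents : Terms → List ℕ
exponents = map proj₁

Below : ℕ → List ℕ → Set
Below k []      = ⊤
Below k (p ∷ r) = p < k × Below p r

Shape : ℕ → ℕ → List ℕ → Set
Shape k zero    r       = Below k r
Shape k (suc m) []      = ⊤
Shape k (suc m) (p ∷ r) = p < k × Shape k m r

Shape-[] : ∀ {k} m → Shape k m []
Shape-[] zero    = tt
Shape-[] (suc m) = tt

Below-weaken : ∀ {k k′} r → k ≤ k′ → Below k r → Below k′ r
Below-weaken []      le b        = tt
Below-weaken (p ∷ r) le (lt , b) = ≤-trans lt le , b

Below-tail : ∀ {k} x r → Below k (x ∷ r) → Below k r
Below-tail x r (lt , b) = Below-weaken r (<⇒≤ lt) b

Shape-suc : ∀ {k} m r → Shape k m r → Shape k (suc m) r
Shape-suc zero    []      s        = tt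
Shape-suc zero    (p ∷ r) s        = proj₁ s , Below-tail p r s
Shape-suc (suc m) []      s        = tt
Shape-suc (suc m) (p ∷ r) (lt , s) = lt , Shape-suc m r s

normFrom-below : ∀ {k} p q r → p < k → Below p (exponents r) → Below k (exponents (normFrom p q r))
normFrom-below p q [] lt b = lt , tt
normFrom-below p q ((e , zero) ∷ r) lt b = normFrom-below p q r lt (Below-tail e (exponents r) b)
normFrom-below p q ((e , suc c) ∷ r) lt (e<p , b) with e ≟ p
... | yes e≡p = contradiction e≡p (<⇒≢ e<p)
... | no _    = lt , normFrom-below e (suc c) r e<p b

-- The pending term takes the single free position. If it merges with the first nonzero term of `r`,
-- the outcome descends from its first term on, which is more than needed.
normFrom-shape₁ : ∀ {k} p q r → p < k → Below k (exponents r) → Shape k 1 (exponents (normFrom p q r))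
normFrom-shape₁ p q [] lt b = lt , tt
normFrom-shape₁ p q ((e , zero) ∷ r) lt b = normFrom-shape₁ p q r lt (Below-tail e (exponents r) b)
normFrom-shape₁ p q ((e , suc c) ∷ r) lt (e<k , b) with e ≟ p
... | yes refl = Shape-suc 0 _ (normFrom-below p (suc c + q) r lt b)
... | no _     = lt , normFrom-below e (suc c) r e<k b

norm-below : ∀ {k} r → Below k (exponents r) → Below k (exponents (norm r))
norm-below []                b         = tt
norm-below ((e , zero) ∷ r)  b         = norm-below r (Below-tail e (exponents r) b)
norm-below ((e , suc c) ∷ r) (lt , b) = normFrom-below e (suc c) r lt b

normFrom-shape : ∀ {k} p q xs r → p < k → All (λ x → proj₁ x < k) xs → Below k (exponents r) →
                 Shape k (suc (length xs)) (exponents (normFrom p q (xs ++ r)))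
normFrom-shape p q [] r lt a b = normFrom-shape₁ p q r lt b
normFrom-shape {k} p q ((e , zero) ∷ xs) r lt (_ ∷ a) b =
  Shape-suc {k} (suc (length xs)) (exponents (normFrom p q (xs ++ r))) (normFrom-shape p q xs r lt a b)
normFrom-shape {k} p q ((e , suc c) ∷ xs) r lt (e<k ∷ a) b with e ≟ p
... | yes _ = Shape-suc {k} (suc (length xs)) (exponents (normFrom p (suc c + q) (xs ++ r)))
                (normFrom-shape p (suc c + q) xs r lt a b)
... | no _  = lt , normFrom-shape e (suc c) xs r e<k a b

norm-shape : ∀ {k} xs r → All (λ x → proj₁ x < k) xs → Below k (exponents r) →
             Shape k (length xs) (exponents (norm (xs ++ r)))
norm-shape [] r a b = norm-below r b
norm-shape {k} ((e , zero) ∷ xs) r (_ ∷ a) b =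
  Shape-suc {k} (length xs) (exponents (norm (xs ++ r))) (norm-shape xs r a b)
norm-shape ((e , suc c) ∷ xs) r (e<k ∷ a) b = normFrom-shape e (suc c) xs r e<k a b

terms : ∀ {k m} → Vec (Fin k) m → Vec ℕ m → Terms
terms []       []       = []
terms (p ∷ ps) (c ∷ cs) = (toℕ p , c) ∷ terms ps cs

descending : ∀ {k} → Vec ℕ k → Terms
descending []             = []
descending {suc k} (d ∷ ds) = (k , d) ∷ descending ds

length-terms : ∀ {k m} (ps : Vec (Fin k) m) cs → length (terms ps cs) ≡ m
length-terms []       []       = refl
length-terms (p ∷ ps) (c ∷ cs) = cong suc (length-terms ps cs)

terms-< : ∀ {k m} (ps : Vec (Fin k) m) cs → All (λ x → proj₁ x < k) (terms ps cs)
terms-< []       []       = []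
terms-< (p ∷ ps) (c ∷ cs) = Finₚ.toℕ<n p ∷ terms-< ps cs

descending-below : ∀ {k} (ds : Vec ℕ k) → Below k (exponents (descending ds))
descending-below []       = tt
descending-below (d ∷ ds) = ≤-refl , descending-below ds

foldl-terms : ∀ {k m} α (ps : Vec (Fin k) m) cs →
  Vec.foldl (λ _ → Ω) _⊕_ α (Vec.zipWith (λ p c → ωpow (toℕ p) c) ps cs) ≡ sumTerms α (terms ps cs)
foldl-terms α []       []       = refl
foldl-terms α (p ∷ ps) (c ∷ cs) = foldl-terms _ ps cs

foldl-descending : ∀ {k} α (ds : Vec ℕ k) →
  Vec.foldl (λ _ → Ω) _⊕_ α (Vec.tabulate (λ j → ωpow (k ∸ 1 ∸ toℕ j) (lookup ds j))) ≡ sumTerms α (descending ds)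
foldl-descending α [] = refl
foldl-descending {suc k} α (d ∷ ds) = trans
  (cong (Vec.foldl (λ _ → Ω) _⊕_ (α ⊕ ωpow k d))
    (Vecₚ.tabulate-cong λ j → cong (λ e → ωpow e (lookup ds j)) (sym (∸-+-assoc k 1 (toℕ j)))))
  (foldl-descending _ ds)

Ψ-sum : ∀ {k m} (ps : Vec (Fin k) m) cs (ds : Vec ℕ k) →
  sumΩ (Vec.zipWith (λ p c → ωpow (toℕ p) c) ps cs)
    ⊕ sumΩ (Vec.tabulate (λ j → ωpow (k ∸ 1 ∸ toℕ j) (lookup ds j)))
  ≈ sumTerms 𝟎 (terms ps cs ++ descending ds)
Ψ-sum ps cs ds rewrite foldl-terms 𝟎 ps cs | foldl-descending 𝟎 ds | sumTerms-++ 𝟎 (terms ps cs) (descending ds) =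
  ≈-sym (sumTerms-⊕ _ 𝟎 (descending ds))

fill-descending : ∀ k r → Below k (exponents r) → Σ (Vec ℕ k) λ ds → ∀ α → sumTerms α r ≈ sumTerms α (descending ds)
fill-descending zero    [] b = [] , λ α → ≈-refl
fill-descending (suc k) [] b = let (ds , e) = fill-descending k [] tt in 0 ∷ ds , e
fill-descending (suc k) ((p , c) ∷ r) (lt , b) with p ≟ k
... | yes refl = let (ds , e) = fill-descending k r b in c ∷ ds , λ α → e _
... | no p≢k   = let (ds , e) = fill-descending k ((p , c) ∷ r) (≤∧≢⇒< (≤-pred lt) p≢k , b) in 0 ∷ ds , e

-- The `Fin k` argument is the exponent of the terms with coefficient 0 that fill the free positions
-- when `r` is too short; it exists since k is positive.
fill-terms : ∀ {k} → Fin k → ∀ m r → Shape k m (exponents r) →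
             Σ (Vec (Fin k) m) λ ps → Σ (Vec ℕ m) λ cs → Σ (Vec ℕ k) λ ds →
             ∀ α → sumTerms α r ≈ sumTerms α (terms ps cs ++ descending ds)
fill-terms {k} z zero r s = let (ds , e) = fill-descending k r s in [] , [] , ds , e
fill-terms {k} z (suc m) [] s with fill-terms z m [] (Shape-[] m)
... | ps , cs , ds , e = z ∷ ps , 0 ∷ cs , ds , e
fill-terms {k} z (suc m) ((p , c) ∷ r) (lt , s) with fill-terms z m r s
... | ps , cs , ds , e = Fin.fromℕ< lt ∷ ps , c ∷ cs , ds ,
  λ α → ≈-trans (e _) (≈-reflexive (cong (λ q → sumTerms (α ⊕ ωpow q c) (terms ps cs ++ descending ds))
                                         (sym (Finₚ.toℕ-fromℕ< lt))))

shape⇒InΨ : ∀ {k} → Fin k → ∀ m {α} r → Shape k m (exponents r) → α ≈ sumTerms 𝟎 r → InΨ k m α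
shape⇒InΨ z m r s e = let (ps , cs , ds , e′) = fill-terms z m r s in
  inj₂ (ps , cs , ds , ≈-trans e (≈-trans (e′ 𝟎) (≈-sym (Ψ-sum ps cs ds))))

-- By uniqueness `r` is `norm` of the sum that witnesses membership, and dropping and merging terms
-- of such a sum preserves the shape.
InΨ⇒shape : ∀ {k m α} r → All Positive r → Linked Apart r → α ≈ sumTerms 𝟎 r → InΨ k m α →
            Shape k m (exponents r)
InΨ⇒shape {k} {m} r ar lr e (inj₁ z) with sumTerms-injective r [] ar lr [] [] (≈-trans (≈-sym e) z)
... | refl = Shape-[] m
InΨ⇒shape {k} {m} r ar lr e (inj₂ (ps , cs , ds , e′)) = subst (Shape k m ∘ exponents) (sym r≡)
  (subst (λ l → Shape k l (exponents (norm xs))) (length-terms ps cs)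
    (norm-shape (terms ps cs) (descending ds) (terms-< ps cs) (descending-below ds)))
  where
  xs = terms ps cs ++ descending ds
  r≡ : r ≡ norm xs
  r≡ = sumTerms-injective r (norm xs) ar lr (norm-positive xs) (norm-linked xs)
         (≈-trans (≈-sym e) (≈-trans e′ (≈-trans (Ψ-sum ps cs ds) (≈-sym (norm-sum 𝟎 xs)))))

-- Ordinal register files; entry 0 belongs to the last term

value : ∀ {r} → Vec ℕ r → Vec ℕ r → Ω
value []       []       = 𝟎
value (e ∷ es) (c ∷ cs) = value es cs ⊕ ωpow e c

above : ∀ {r} → Fin r → Vec ℕ r → Vec ℕ r → Ω
above Fin.zero    (e ∷ es) (c ∷ cs) = value es cs
above (Fin.suc t) (e ∷ es) (c ∷ cs) = above t es cs

ZeroBelow : ∀ {r} → Fin r → Vec ℕ r → Set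
ZeroBelow t cs = ∀ j → j Fin.< t → lookup cs j ≡ 0

value-update : ∀ {r} (t : Fin r) es cs c → ZeroBelow t cs →
               value es (cs [ t ]≔ c) ≡ above t es cs ⊕ ωpow (lookup es t) c
value-update Fin.zero    (e ∷ es) (c₀ ∷ cs) c z = refl
value-update (Fin.suc t) (e ∷ es) (c₀ ∷ cs) c z rewrite z Fin.zero (s≤s z≤n) =
  value-update t es cs c (λ j lt → z (Fin.suc j) (s≤s lt))

value-update₂ : ∀ {r} (t g : Fin r) es cs c d → g Fin.< t → ZeroBelow t cs →
  value es ((cs [ t ]≔ c) [ g ]≔ d) ≡ (above t es cs ⊕ ωpow (lookup es t) c) ⊕ ωpow (lookup es g) d
value-update₂ (Fin.suc t) Fin.zero    (e ∷ es) (c₀ ∷ cs) c d lt z =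
  cong (_⊕ ωpow e d) (value-update t es cs c (λ j lt → z (Fin.suc j) (s≤s lt)))
value-update₂ (Fin.suc t) (Fin.suc g) (e ∷ es) (c₀ ∷ cs) c d (s≤s lt) z rewrite z Fin.zero (s≤s z≤n) =
  value-update₂ t g es cs c d lt (λ j lt → z (Fin.suc j) (s≤s lt))

value-at : ∀ {r} (t : Fin r) es cs → ZeroBelow t cs →
           value es cs ≡ above t es cs ⊕ ωpow (lookup es t) (lookup cs t)
value-at t es cs z = trans (cong (value es) (sym (Vecₚ.[]≔-lookup cs t))) (value-update t es cs (lookup cs t) z)

value-zero : ∀ {r} es (cs : Vec ℕ r) → (∀ j → lookup cs j ≡ 0) → value es cs ≡ 𝟎
value-zero []       []       z = refl
value-zero (e ∷ es) (c ∷ cs) z rewrite z Fin.zero = value-zero es cs (z ∘ Fin.suc)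

value-succ : ∀ {r} (t : Fin r) es cs c → ZeroBelow t cs → lookup cs t ≡ suc c → lookup es t ≡ 0 →
             value es cs ≡ value es (cs [ t ]≔ c) ⁺
value-succ t es cs c z eq e0 = trans (value-at t es cs z)
  (trans (cong₂ (λ e d → above t es cs ⊕ ωpow e d) e0 eq)
  (cong _⁺ (trans (cong (λ e → above t es cs ⊕ ωpow e c) (sym e0)) (sym (value-update t es cs c z)))))

-- ω^(e+1) (c+1) is ω^(e+1) c + ω^(e+1), and member n of the last summand is ω^e (n+1). Entry `g`
-- can take it, as it is zero and comes after `t` in the sum.
value-lim : ∀ {r} (t g : Fin r) es cs c → g Fin.< t → ZeroBelow t cs → lookup cs t ≡ suc c →
            lookup es t ≡ suc (lookup es g) →
            Σ (ℕ → Ω) λ f → value es cs ≡ lim f × ∀ n → f n ≈ value es ((cs [ t ]≔ c) [ g ]≔ suc n)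
value-lim t g es cs c lt z eq e+ = _ ,
  trans (value-at t es cs z) (cong₂ (λ e d → above t es cs ⊕ ωpow e d) e+ eq) ,
  λ n → ≈-trans (≈-sym (⊕-assoc (above t es cs) (ωpow (suc (lookup es g)) c) (ωpow (lookup es g) (suc n))))
    (≈-reflexive (trans (cong (λ e → (above t es cs ⊕ ωpow e c) ⊕ ωpow (lookup es g) (suc n)) (sym e+))
                        (sym (value-update₂ t g es cs c (suc n) lt z))))

-- Binary notation

digitOf : ℕ → Sym
digitOf zero    = s0
digitOf (suc _) = s1

bits-suc : ∀ f n → bits (suc f) (suc n) ≡ bits f (suc n / 2) ++ [ digitOf (suc n % 2) ]
bits-suc f n with suc n % 2
... | zero  = refl
... | suc _ = refl

half≤ : ∀ n → suc n / 2 ≤ n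
half≤ n = ≤-pred (m/n<m (suc n) 2 (s≤s (s≤s z≤n)))

bits-fuel : ∀ f f′ n → n ≤ f → n ≤ f′ → bits f n ≡ bits f′ n
bits-fuel zero    zero     zero    _ _ = refl
bits-fuel zero    (suc f′) zero    _ _ = refl
bits-fuel (suc f) zero     zero    _ _ = refl
bits-fuel (suc f) (suc f′) zero    _ _ = refl
bits-fuel (suc f) (suc f′) (suc n) (s≤s p) (s≤s q) = trans (bits-suc f n)
  (trans (cong (_++ _) (bits-fuel f f′ (suc n / 2) (≤-trans (half≤ n) p) (≤-trans (half≤ n) q)))
         (sym (bits-suc f′ n)))

IsDigit : Sym → Set
IsDigit s = isDigit s ≡ true

bits-digits : ∀ f n → All IsDigit (bits f n)
bits-digits zero    n       = []
bits-digits (suc f) zero    = []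
bits-digits (suc f) (suc n) rewrite bits-suc f n =
  Allₚ.++⁺ (bits-digits f (suc n / 2)) (digit (suc n % 2) ∷ [])
  where
  digit : ∀ d → IsDigit (digitOf d)
  digit zero    = refl
  digit (suc _) = refl

-- Appends a binary digit, in the form in which division with remainder by 2 returns a number.
double : ℕ → ℕ → ℕ
double b v = b + v * 2

half-double : ∀ {b} → b < 2 → ∀ v → double b v / 2 ≡ v
half-double {b} b<2 v = trans (+-distrib-/-∣ʳ b (divides v refl)) (trans (cong (_+ v * 2 / 2) (b/2 b<2)) (m*n/n≡m v 2))
  where
  b/2 : ∀ {b} → b < 2 → b / 2 ≡ 0
  b/2 (s≤s z≤n) = refl
  b/2 (s≤s (s≤s z≤n)) = refl

odd-double : ∀ {b} → b < 2 → ∀ v → double b v % 2 ≡ b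
odd-double {b} b<2 v = trans ([m+kn]%n≡m%n b v 2) (b%2 b<2)
  where
  b%2 : ∀ {b} → b < 2 → b % 2 ≡ b
  b%2 (s≤s z≤n) = refl
  b%2 (s≤s (s≤s z≤n)) = refl

bin-double : ∀ {b} → b < 2 → ∀ v → bin (double b (suc v)) ≡ bin (suc v) ++ [ digitOf b ]
bin-double {b} b<2 v with double b (suc v) in eq
... | zero  = contradiction (trans (sym (m+n∸m≡n b (suc v * 2))) (trans (cong (_∸ b) eq) (0∸n≡0 b))) λ ()
... | suc u = trans (bits-suc u u) (cong₂ (λ h d → h ++ [ digitOf d ])
    (trans (cong (bits u) h≡) (bits-fuel u (suc v) (suc v) (subst (_≤ u) h≡ (half≤ u)) ≤-refl))
    (trans (cong (_% 2) (sym eq)) (odd-double b<2 (suc v))))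
  where
  h≡ : suc u / 2 ≡ suc v
  h≡ = trans (cong (_/ 2) (sym eq)) (half-double b<2 (suc v))

readDigits : ℕ → Word → ℕ × Word
readDigits v (s0 ∷ w) = readDigits (double 0 v) w
readDigits v (s1 ∷ w) = readDigits (double 1 v) w
readDigits v w        = v , w

readNum : Word → Maybe (ℕ × Word)
readNum (s0 ∷ w) = just (0 , w)
readNum (s1 ∷ w) = just (readDigits 1 w)
readNum _        = nothing

NoDigit : Word → Set
NoDigit []      = ⊤
NoDigit (s ∷ _) = isDigit s ≡ false

data Leading : Word → Set where
  leading-0 : ∀ w → Leading (s0 ∷ w)
  leading-1 : ∀ w → Leading (s1 ∷ w)
  no-digit  : ∀ {w} → NoDigit w → Leading w

leading : ∀ w → Leading w
leading []           = no-digit tt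
leading (s0 ∷ w)     = leading-0 w
leading (s1 ∷ w)     = leading-1 w
leading (sOpen ∷ w)  = no-digit refl
leading (sClose ∷ w) = no-digit refl
leading (sSemi ∷ w)  = no-digit refl
leading (sBot ∷ w)   = no-digit refl

readDigits-stop : ∀ v w → NoDigit w → readDigits v w ≡ (v , w)
readDigits-stop v []           nd = refl
readDigits-stop v (sOpen ∷ w)  nd = refl
readDigits-stop v (sClose ∷ w) nd = refl
readDigits-stop v (sSemi ∷ w)  nd = refl
readDigits-stop v (sBot ∷ w)   nd = refl

-- Stated for a positive number read so far, because appending a digit to the numeral of 0 does not
-- give a numeral.
readDigits-sound : ∀ v w → bin (suc v) ++ w ≡ bin (proj₁ (readDigits (suc v) w)) ++ proj₂ (readDigits (suc v) w)
readDigits-sound v w with leading w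
... | leading-0 u = trans (sym (Listₚ.++-assoc (bin (suc v)) [ s0 ] u))
  (trans (cong (_++ u) (sym (bin-double {0} (s≤s z≤n) v))) (readDigits-sound _ u))
... | leading-1 u = trans (sym (Listₚ.++-assoc (bin (suc v)) [ s1 ] u))
  (trans (cong (_++ u) (sym (bin-double {1} (s≤s (s≤s z≤n)) v))) (readDigits-sound _ u))
... | no-digit nd rewrite readDigits-stop (suc v) w nd = refl

readNum-sound : ∀ w {v w′} → readNum w ≡ just (v , w′) → w ≡ bin v ++ w′
readNum-sound (s0 ∷ w) refl = refl
readNum-sound (s1 ∷ w) refl = readDigits-sound 0 w

halved : ∀ v → Σ ℕ λ b → Σ ℕ λ h → b < 2 × suc (suc v) ≡ double b (suc h) × h < suc v
halved v with suc (suc v) / 2 in eq | m≡m%n+[m/n]*n (suc (suc v)) 2 | m%n<n (suc (suc v)) 2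
... | zero  | e | b<2 = contradiction (subst (_< 2) (sym (trans e (+-identityʳ _))) b<2) λ { (s≤s (s≤s ())) }
... | suc h | e | b<2 = suc (suc v) % 2 , h , b<2 , e , ≤-trans (≤-reflexive (sym eq)) (half≤ (suc v))

bin-digits : ∀ v → Σ Word λ u → bin (suc v) ≡ s1 ∷ u × ∀ w → readDigits 1 (u ++ w) ≡ readDigits (suc v) w
bin-digits v = go (suc v) v ≤-refl
  where
  readOne : ∀ h d → d < 2 → ∀ w → readDigits (suc h) (digitOf d ∷ w) ≡ readDigits (double d (suc h)) w
  readOne h zero lt w = refl
  readOne h (suc zero) lt w = refl
  readOne h (suc (suc d)) (s≤s (s≤s ())) w
  go : ∀ f v → v < f → Σ Word λ u → bin (suc v) ≡ s1 ∷ u × ∀ w → readDigits 1 (u ++ w) ≡ readDigits (suc v) w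
  go (suc f) zero    lt = [] , refl , λ w → refl
  go (suc f) (suc v) (s≤s lt) =
    let (d , h , b<2 , e , h<) = halved v
        (u , e₁ , rd) = go f h (≤-trans h< lt)
    in u ++ [ digitOf d ] ,
       trans (cong bin e) (trans (bin-double b<2 h) (cong (_++ [ digitOf d ]) e₁)) ,
       λ w → trans (cong (readDigits 1) (Listₚ.++-assoc u _ w)) (trans (rd (digitOf d ∷ w))
         (trans (readOne h d b<2 w) (cong (λ z → readDigits z w) (sym e))))

readNum-complete : ∀ n w → NoDigit w → readNum (bin n ++ w) ≡ just (n , w)
readNum-complete zero    w nd = refl
readNum-complete (suc v) w nd with bin-digits v
... | u , e , rd rewrite e = cong just (trans (rd w) (readDigits-stop (suc v) w nd))

readDigits-bound : ∀ v w → suc (proj₁ (readDigits v w)) ≤ suc v * 2 ^ length w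
readDigits-bound v w with leading w
... | leading-0 u = ≤-trans (readDigits-bound _ u)
  (≤-trans (*-monoˡ-≤ (2 ^ length u) (n≤1+n (suc (v * 2)))) (≤-reflexive (*-assoc (suc v) 2 (2 ^ length u))))
... | leading-1 u = ≤-trans (readDigits-bound _ u) (≤-reflexive (*-assoc (suc v) 2 (2 ^ length u)))
... | no-digit nd rewrite readDigits-stop v w nd = m≤m*n (suc v) (2 ^ length w) ⦃ m^n≢0 2 (length w) ⦄

readDigits-shorter : ∀ v w → length (proj₂ (readDigits v w)) ≤ length w
readDigits-shorter v w with leading w
... | leading-0 u = ≤-trans (readDigits-shorter _ u) (n≤1+n _)
... | leading-1 u = ≤-trans (readDigits-shorter _ u) (n≤1+n _)
... | no-digit nd rewrite readDigits-stop v w nd = ≤-refl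

readNum-bound : ∀ w {v w′} → readNum w ≡ just (v , w′) → v < 2 ^ length w × length w′ < length w
readNum-bound (s0 ∷ w) refl = m^n>0 2 (suc (length w)) , ≤-refl
readNum-bound (s1 ∷ w) refl = readDigits-bound 1 w , s≤s (readDigits-shorter 1 w)

bits-length : ∀ f n b → n < 2 ^ b → length (bits f n) ≤ b
bits-length zero    n       b lt = z≤n
bits-length (suc f) zero    b lt = z≤n
bits-length (suc f) (suc n) zero (s≤s ())
bits-length (suc f) (suc n) (suc b) lt rewrite bits-suc f n
  | Listₚ.length-++ (bits f (suc n / 2)) {[ digitOf (suc n % 2) ]} | +-comm (length (bits f (suc n / 2))) 1 =
  s≤s (bits-length f (suc n / 2) b (*-cancelʳ-< _ _ _
    (≤-trans (s≤s (≤-trans (m≤n+m _ (suc n % 2)) (≤-reflexive (sym (m≡m%n+[m/n]*n (suc n) 2)))))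
             (≤-trans lt (≤-reflexive (*-comm 2 (2 ^ b)))))))

bin-length : ∀ n b → n < 2 ^ b → length (bin n) ≤ suc b
bin-length zero    b lt = s≤s z≤n
bin-length (suc n) b lt = ≤-trans (bits-length (suc n) (suc n) b lt) (n≤1+n b)

-- A word of digits as a number in bijective base 2, first digit last in, hence first out.
stack : Word → ℕ
stack (s0 ∷ w) = suc (double 0 (stack w))
stack (s1 ∷ w) = suc (double 1 (stack w))
stack _        = 0

stack-stop : ∀ w → NoDigit w → stack w ≡ 0
stack-stop []           nd = refl
stack-stop (sOpen ∷ w)  nd = refl
stack-stop (sClose ∷ w) nd = refl
stack-stop (sSemi ∷ w)  nd = refl
stack-stop (sBot ∷ w)   nd = refl

stack-bound : ∀ w → suc (stack w) < 2 ^ suc (length w)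
stack-bound w with leading w
... | leading-0 u = ≤-trans (s≤s (n≤1+n _))
  (≤-trans (*-monoˡ-≤ 2 (stack-bound u)) (≤-reflexive (*-comm (2 ^ suc (length u)) 2)))
... | leading-1 u = ≤-trans (*-monoˡ-≤ 2 (stack-bound u)) (≤-reflexive (*-comm (2 ^ suc (length u)) 2))
... | no-digit nd rewrite stack-stop w nd = ^-monoʳ-≤ 2 (s≤s (z≤n {length w}))

-- Recognising codes

Below? : ∀ k r → Dec (Below k r)
Below? k []      = yes tt
Below? k (p ∷ r) = (p <? k) ×-dec Below? p r

Shape? : ∀ k m r → Dec (Shape k m r)
Shape? k zero    r       = Below? k r
Shape? k (suc m) []      = yes tt
Shape? k (suc m) (p ∷ r) = (p <? k) ×-dec Shape? k m r

Below-length : ∀ {k} r → Below k r → length r ≤ k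
Below-length []      b        = z≤n
Below-length (p ∷ r) (lt , b) = ≤-trans (s≤s (Below-length r b)) lt

Shape-length : ∀ {k} m r → Shape k m r → length r ≤ m + k
Shape-length zero    r       s       = Below-length r s
Shape-length (suc m) []      s       = z≤n
Shape-length (suc m) (p ∷ r) (_ , s) = s≤s (Shape-length m r s)

Below-all : ∀ {k} r → Below k r → All (_< k) r
Below-all []      b        = []
Below-all (p ∷ r) (lt , b) = lt ∷ Below-all r (Below-weaken r (<⇒≤ lt) b)

Shape-all : ∀ {k} m r → Shape k m r → All (_< k) r
Shape-all zero    r       s        = Below-all r s
Shape-all (suc m) []      s        = []
Shape-all (suc m) (p ∷ r) (lt , s) = lt ∷ Shape-all m r s

afterTerm : Terms → Word
termWord  : ℕ × ℕ → Terms → Word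
afterTerm []      = sClose ∷ []
afterTerm (x ∷ r) = sSemi ∷ termWord x r
termWord (p , c) r = bin p ++ sSemi ∷ (bin c ++ afterTerm r)

afterTerm-noDigit : ∀ r → NoDigit (afterTerm r)
afterTerm-noDigit []      = refl
afterTerm-noDigit (_ ∷ _) = refl

encNF-termWord : ∀ x r → encNF (x ∷ r) ≡ sOpen ∷ termWord x r
encNF-termWord x r = cong (sOpen ∷_) (go x r)
  where
  go : ∀ x r → concat (intersperse (sSemi ∷ []) (concatMap (λ pc → bin (proj₁ pc) ∷ bin (proj₂ pc) ∷ []) (x ∷ r)))
               ++ (sClose ∷ []) ≡ termWord x r
  go (p , c) [] = trans (Listₚ.++-assoc (bin p) (sSemi ∷ (bin c ++ [])) _)
    (cong (λ w → bin p ++ sSemi ∷ w) (trans (Listₚ.++-assoc (bin c) [] _) refl))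
  go (p , c) (y ∷ r) = trans (Listₚ.++-assoc (bin p) _ _)
    (cong (λ w → bin p ++ sSemi ∷ w) (trans (Listₚ.++-assoc (bin c) _ _)
      (cong (λ w → bin c ++ sSemi ∷ w) (go y r))))

verdict : {P A : Set} → Dec P → A → Maybe A
verdict (yes _) x = just x
verdict (no _)  x = nothing

verdict-yes : {P A : Set} (d : Dec P) {x : A} → P → verdict d x ≡ just x
verdict-yes (yes _) p = refl
verdict-yes (no ¬p) p = contradiction p ¬p

verdict-just : {P A : Set} (d : Dec P) {x y : A} → verdict d x ≡ just y → P × x ≡ y
verdict-just (yes p) refl = p , refl

module Accept (k m : ℕ) where

  Good : List ℕ → Set
  Good es = Shape k m es × Linked _≢_ es

  Good? : ∀ es → Dec (Good es)
  Good? es = Shape? k m es ×-dec Linked.linked? (λ a b → ¬? (a ≟ b)) es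

  -- acc lists the exponents read so far; at most f more terms are read.
  accept   : ℕ → List ℕ → Word → Maybe Terms
  accept-p : ℕ → List ℕ → Maybe (ℕ × Word) → Maybe Terms
  accept-c : ℕ → List ℕ → ℕ → Maybe (ℕ × Word) → Maybe Terms
  accept-r : ℕ → List ℕ → ℕ × ℕ → Word → Maybe Terms
  accept zero    acc w = nothing
  accept (suc f) acc w = accept-p f acc (readNum w)
  -- Tested as soon as the exponent is read, because the machine only has branches for exponents
  -- below k.
  accept-p f acc (just (p , sSemi ∷ w)) with p <? k
  ... | yes _ = accept-c f (acc ++ [ p ]) p (readNum w)
  ... | no _  = nothing
  accept-p f acc _ = nothing
  accept-c f acc p (just (suc c , w)) = accept-r f acc (p , suc c) w
  accept-c f acc p _                  = nothing
  accept-r f acc x (sClose ∷ []) = verdict (Good? acc) (x ∷ [])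
  accept-r f acc x (sSemi ∷ w) = Maybe.map (x ∷_) (accept f acc w)
  accept-r f acc x _           = nothing

  acceptCode : Word → Maybe Terms
  acceptCode (sOpen ∷ sClose ∷ []) = just []
  -- By `Shape-length` a list of exponents of the right shape has at most m + k members.
  acceptCode (sOpen ∷ w)           = accept (m + k) [] w
  acceptCode _                     = nothing

  record Accepted (acc : List ℕ) (w : Word) (nf : Terms) : Set where
    constructor accepted
    field
      nf-head  : ℕ × ℕ
      nf-tail  : Terms
      nf-≡     : nf ≡ nf-head ∷ nf-tail
      nf-word  : w ≡ termWord nf-head nf-tail
      nf-pos   : All Positive nf
      nf-good  : Good (acc ++ exponents nf)

  accept-sound   : ∀ f acc w {nf} → accept f acc w ≡ just nf → Accepted acc w nf
  accept-p-sound : ∀ f acc w {x nf} → readNum w ≡ x → accept-p f acc x ≡ just nf → Accepted acc w nf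
  accept-c-sound : ∀ f acc p w {x nf} → readNum w ≡ x → accept-c f (acc ++ [ p ]) p x ≡ just nf →
                   Accepted acc (bin p ++ sSemi ∷ w) nf
  accept-r-sound : ∀ f acc p c w {nf} → accept-r f (acc ++ [ p ]) (p , suc c) w ≡ just nf →
                   Accepted acc (bin p ++ sSemi ∷ (bin (suc c) ++ w)) nf
  accept-sound (suc f) acc w eq = accept-p-sound f acc w refl eq
  accept-p-sound f acc w {just (p , sSemi ∷ w′)} rd eq with p <? k
  ... | yes _ = subst (λ v → Accepted acc v _) (sym (readNum-sound w rd)) (accept-c-sound f acc p w′ refl eq)
  accept-c-sound f acc p w {just (suc c , w′)} rd eq =
    subst (λ v → Accepted acc (bin p ++ sSemi ∷ v) _) (sym (readNum-sound w rd)) (accept-r-sound f acc p c w′ eq)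
  accept-r-sound f acc p c (sClose ∷ []) eq with verdict-just (Good? (acc ++ [ p ])) eq
  ... | g , refl = accepted (p , suc c) [] refl refl (s≤s z≤n ∷ []) g
  accept-r-sound f acc p c (sSemi ∷ w) eq with accept f (acc ++ [ p ]) w in e
  accept-r-sound f acc p c (sSemi ∷ w) refl | just nf with accept-sound f (acc ++ [ p ]) w e
  ... | accepted x r refl w≡ pos good = accepted (p , suc c) (x ∷ r) refl
    (cong (λ v → bin p ++ sSemi ∷ (bin (suc c) ++ sSemi ∷ v)) w≡) (s≤s z≤n ∷ pos)
    (subst Good (Listₚ.++-assoc acc [ p ] _) good)

  accept-complete   : ∀ f acc x r → length (x ∷ r) ≤ f → All Positive (x ∷ r) → All (_< k) (exponents (x ∷ r)) →
                      Good (acc ++ exponents (x ∷ r)) → accept f acc (termWord x r) ≡ just (x ∷ r)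
  accept-r-complete : ∀ f acc x r → length r ≤ f → All Positive r → All (_< k) (exponents r) →
                      Good (acc ++ exponents r) → accept-r f acc x (afterTerm r) ≡ just (x ∷ r)
  accept-complete (suc f) acc (p , suc c) r (s≤s le) (_ ∷ pos) (lt ∷ lts) good
    rewrite readNum-complete p (sSemi ∷ (bin (suc c) ++ afterTerm r)) refl
    with p <? k
  ... | no ¬lt = contradiction lt ¬lt
  ... | yes _ rewrite readNum-complete (suc c) (afterTerm r) (afterTerm-noDigit r) =
    accept-r-complete f (acc ++ [ p ]) (p , suc c) r le pos lts (subst Good (sym (Listₚ.++-assoc acc [ p ] _)) good)
  accept-r-complete f acc x [] le pos lts good =
    verdict-yes (Good? acc) (subst Good (Listₚ.++-identityʳ acc) good)
  accept-r-complete f acc x (y ∷ r) le pos lts good = cong (Maybe.map (x ∷_)) (accept-complete f acc y r le pos lts good)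

  Decoded : Word → Terms → Set
  Decoded w nf = w ≡ encNF nf × All Positive nf × Shape k m (exponents nf) × Linked Apart nf

  acceptCode-sound : ∀ w {nf} → acceptCode w ≡ just nf → Decoded w nf
  acceptCode-sound w eq = go w eq
    where
    long : ∀ w {nf} → accept (m + k) [] w ≡ just nf → Decoded (sOpen ∷ w) nf
    long w eq with accept-sound (m + k) [] w eq
    ... | accepted x r refl w≡ pos (s , l) =
      trans (cong (sOpen ∷_) w≡) (sym (encNF-termWord x r)) , pos , s , Linkedₚ.map⁻ l
    go : ∀ w {nf} → acceptCode w ≡ just nf → Decoded w nf
    go (sOpen ∷ sClose ∷ []) refl = refl , [] , Shape-[] m , []
    go (sOpen ∷ [])              eq = long [] eq
    go (sOpen ∷ sClose ∷ s ∷ w)  eq = long (sClose ∷ s ∷ w) eq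
    go (sOpen ∷ s0 ∷ w)          eq = long (s0 ∷ w) eq
    go (sOpen ∷ s1 ∷ w)          eq = long (s1 ∷ w) eq
    go (sOpen ∷ sOpen ∷ w)       eq = long (sOpen ∷ w) eq
    go (sOpen ∷ sSemi ∷ w)       eq = long (sSemi ∷ w) eq
    go (sOpen ∷ sBot ∷ w)        eq = long (sBot ∷ w) eq

  acceptCode-complete : ∀ nf → All Positive nf → Shape k m (exponents nf) → Linked Apart nf →
                        acceptCode (encNF nf) ≡ just nf
  acceptCode-complete [] pos s l = refl
  acceptCode-complete (x ∷ r) pos s l rewrite encNF-termWord x r =
    trans (open-accept (termWord x r) (starts x r))
          (accept-complete (m + k) [] x r
            (≤-trans (≤-reflexive (sym (Listₚ.length-map proj₁ (x ∷ r)))) (Shape-length m (exponents (x ∷ r)) s))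
            pos (Shape-all m (exponents (x ∷ r)) s) (s , Linkedₚ.map⁺ l))
    where
    starts : ∀ x r → Σ Word λ u → termWord x r ≡ s0 ∷ u ⊎ termWord x r ≡ s1 ∷ u
    starts (zero , c)  r = _ , inj₁ refl
    starts (suc p , c) r with bin-digits p
    ... | u , e , _ = _ , inj₂ (cong (_++ _) e)
    open-accept : ∀ w → (Σ Word λ u → w ≡ s0 ∷ u ⊎ w ≡ s1 ∷ u) → acceptCode (sOpen ∷ w) ≡ accept (m + k) [] w
    open-accept _ (u , inj₁ refl) = refl
    open-accept _ (u , inj₂ refl) = refl

-- Register programs

module Programs (ar r : ℕ) where
  open Store ar r public

  X Y Z N K I F : Reg
  X = sc 0F
  Y = sc 1F
  Z = sc 2F
  N = sc 3F
  K = sc 4F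
  I = sc 5F
  F = sc 6F

  mk : (x y z n κ i f : ℕ) → Vec ℕ r → Vec ℕ r → Tuple Word ar → Word → Store
  mk x y z n κ i f a a′ ins out = store (x , y , z , n , κ , i , f , tt) (a , a′ , tt) ins out

  -- Registers can only be stepped and tested, so every copy empties its source; a value that is to
  -- be kept goes to two targets and is moved back.
  transfer fan₂ halving : Reg → Reg → Reg → Program
  transfer x y z = whilePositive x (dec x ▹ inc y)
  fan₂ x y z     = whilePositive x (dec x ▹ inc y ▹ inc z)
  halving x y z  = whilePositive x (dec x ▹ ifPositive x (dec x ▹ inc y) (inc z))

  doubleP halveP : Reg → Program
  doubleP x = whilePositive x (dec x ▹ inc Y ▹ inc Y) ▹ transfer Y x F
  halveP x  = halving x Y F ▹ transfer Y x F

  -- Halving yields the least significant digit first, but the numeral is output from the other end.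
  -- So the digits are stacked in `Z`, in bijective base 2 in order that zeros count as well, and
  -- output while the stack is emptied. Zero is treated apart because `bits` gives it no digits.
  pushP popP printP : Program
  pushP  = whilePositive X (halveP X ▹ doubleP Z ▹ inc Z ▹ ifPositive F (dec F ▹ inc Z) pass)
  popP   = whilePositive Z (dec Z ▹ halveP Z ▹ ifPositive F (dec F ▹ emit s1) (emit s0))
  printP = ifPositive X (pushP ▹ popP) (emit s0)

  failP : Program
  failP = emit sBot

  digitsP : Fin ar → Program
  digitsP j = whileInput j (isInp isDigit)
    (ifInput j (isInp is1) (advance j ▹ doubleP X ▹ inc X) (advance j ▹ doubleP X))

  -- The continuation is an argument, so that after a failure has emitted its symbol nothing else is
  -- run.
  readP : Fin ar → Program → Program
  readP j p = ifInput j (isInp is0) (advance j ▹ p)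
    (ifInput j (isInp is1) (advance j ▹ inc X ▹ digitsP j ▹ p) failP)

  module Proofs (b B : ℕ) (b<B : b < B) where
    open Sim b B b<B public

    Runs : Program → Store → (Store → Set) → Set
    Runs p σ Q = Σ Store λ σ′ → Sim p σ σ′ × Q σ′

    infixr 4 _⟫ʳ_
    _⟫ʳ_ : ∀ {p q σ σ₁ Q} → Sim p σ σ₁ → Runs q σ₁ Q → Runs (p ▹ q) σ Q
    s ⟫ʳ (σ′ , s′ , q) = σ′ , (s ⟫ s′) , q

    via : ∀ {p σ σ₁ σ₂} → σ₁ ≡ σ₂ → Sim p σ σ₁ → Sim p σ σ₂
    via refl s = s

    -- A store seen as a function of three registers. It lets one loop lemma serve scalars, where
    -- all equations hold by `refl`, and entries of register files, where they are facts about
    -- vectors.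
    record Triple (x y z : Reg) (st : ℕ → ℕ → ℕ → Store) : Set where
      field
        gx : ∀ {u v w} → get x (st u v w) ≡ u
        gy : ∀ {u v w} → get y (st u v w) ≡ v
        gz : ∀ {u v w} → get z (st u v w) ≡ w
        sx : ∀ {u v w u′} → set x u′ (st u v w) ≡ st u′ v w
        sy : ∀ {u v w v′} → set y v′ (st u v w) ≡ st u v′ w
        sz : ∀ {u v w w′} → set z w′ (st u v w) ≡ st u v w′

    swap : ∀ {x y z st} → Triple x y z st → Triple y x z (λ u v w → st v u w)
    swap t = record { gx = gy ; gy = gx ; gz = gz ; sx = sy ; sy = sx ; sz = sz }
      where open Triple t

    module _ {x y z st} (t : Triple x y z st) where
      open Triple t

      dec-x : ∀ {u v w} → Sim (dec x) (st (suc u) v w) (st u v w)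
      dec-x = via sx (sim-dec x gx)

      inc-y : ∀ {u v w} → suc v < 2 ^ b → Sim (inc y) (st u v w) (st u (suc v) w)
      inc-y lt = via sy (sim-inc y gy lt)

      inc-z : ∀ {u v w} → suc w < 2 ^ b → Sim (inc z) (st u v w) (st u v (suc w))
      inc-z lt = via sz (sim-inc z gz lt)

      sim-transfer : ∀ u {v w} → u + v < 2 ^ b → Sim (transfer x y z) (st u v w) (st 0 (u + v) w)
      sim-transfer zero lt = sim-done x gx
      sim-transfer (suc u) {v} {w} lt = sim-loop x gx (dec-x ⟫ inc-y (≤-trans (s≤s (s≤s (m≤n+m v u))) lt))
        (via (cong (λ e → st 0 e w) (+-suc u v)) (sim-transfer u (subst (_< 2 ^ b) (sym (+-suc u v)) lt)))

      sim-fan₂ : ∀ u {v w} → u + v < 2 ^ b → u + w < 2 ^ b → Sim (fan₂ x y z) (st u v w) (st 0 (u + v) (u + w))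
      sim-fan₂ zero lt lt′ = sim-done x gx
      sim-fan₂ (suc u) {v} {w} lt lt′ = sim-loop x gx
        (dec-x ⟫ inc-y (≤-trans (s≤s (s≤s (m≤n+m v u))) lt) ⟫ inc-z (≤-trans (s≤s (s≤s (m≤n+m w u))) lt′))
        (via (cong₂ (st 0) (+-suc u v) (+-suc u w))
          (sim-fan₂ u (subst (_< 2 ^ b) (sym (+-suc u v)) lt) (subst (_< 2 ^ b) (sym (+-suc u w)) lt′)))

      sim-doubling : ∀ u {v w} → u * 2 + v < 2 ^ b →
                     Sim (whilePositive x (dec x ▹ inc y ▹ inc y)) (st u v w) (st 0 (u * 2 + v) w)
      sim-doubling zero lt = sim-done x gx
      sim-doubling (suc u) {v} {w} lt = sim-loop x gx
        (dec-x ⟫ inc-y (≤-trans (s≤s (<⇒≤ (s≤s (s≤s (m≤n+m v (u * 2)))))) lt)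
               ⟫ inc-y (≤-trans (s≤s (s≤s (s≤s (m≤n+m v (u * 2))))) lt))
        (via (cong (λ e → st 0 e w) eq) (sim-doubling u (subst (_< 2 ^ b) (sym eq) lt)))
        where
        eq : u * 2 + suc (suc v) ≡ suc (suc (u * 2 + v))
        eq = trans (+-suc (u * 2) (suc v)) (cong suc (+-suc (u * 2) v))

      sim-halving : ∀ d q {v} → d < 2 → suc (double d q + v) < 2 ^ b →
                    Sim (halving x y z) (st (double d q) v 0) (st 0 (q + v) d)
      sim-halving zero    zero    d<2 lt = sim-done x gx
      sim-halving (suc zero) zero {v} d<2 lt = sim-loop x gx
        (dec-x ⟫ sim-zero x gx (inc-z (≤-trans (s≤s (s≤s z≤n)) lt))) (sim-done x gx)
      sim-halving (suc (suc d)) q (s≤s (s≤s ())) lt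
      sim-halving zero (suc q) {v} d<2 lt = sim-loop x gx
        (dec-x ⟫ sim-positive x gx (dec-x ⟫ inc-y (≤-trans (s≤s (s≤s (≤-trans (m≤n+m v (q * 2)) (<⇒≤ (n≤1+n _))))) lt)))
        (via (cong (λ e → st 0 e 0) (+-suc q v))
          (sim-halving zero q d<2 (≤-trans (s≤s (s≤s (≤-trans (≤-reflexive (+-suc (q * 2) v)) (n≤1+n _)))) lt)))
      sim-halving (suc zero) (suc q) {v} d<2 lt = sim-loop x gx
        (dec-x ⟫ sim-positive x gx (dec-x ⟫ inc-y (≤-trans (s≤s (s≤s (≤-trans (m≤n+m v (suc (q * 2))) (<⇒≤ (n≤1+n _))))) lt)))
        (via (cong (λ e → st 0 e 1) (+-suc q v))
          (sim-halving (suc zero) q d<2 (≤-trans (s≤s (s≤s (s≤s (≤-trans (≤-reflexive (+-suc (q * 2) v)) (n≤1+n _))))) lt)))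

    module _ {x st} (t : Triple x Y F st) where

      sim-double : ∀ v {f} → v * 2 < 2 ^ b → Sim (doubleP x) (st v 0 f) (st (v * 2) 0 f)
      sim-double v {f} lt = sim-doubling t v (subst (_< 2 ^ b) (sym eq) lt) ⟫
        via (cong (λ e → st e 0 f) (trans (+-identityʳ _) eq))
            (sim-transfer (swap t) (v * 2 + 0) (subst (_< 2 ^ b) (sym (trans (+-identityʳ _) eq)) lt))
        where
        eq = +-identityʳ (v * 2)

      sim-halve : ∀ d q → d < 2 → suc (double d q) < 2 ^ b → Sim (halveP x) (st (double d q) 0 0) (st q 0 d)
      sim-halve d q d<2 lt = sim-halving t d q d<2 (subst (λ e → suc e < 2 ^ b) (sym (+-identityʳ (double d q))) lt) ⟫
        via (cong (λ e → st e 0 d) (trans (+-identityʳ _) (+-identityʳ q)))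
            (sim-transfer (swap t) (q + 0) (≤-trans (s≤s q≤) lt))
        where
        q≤ : q + 0 + 0 ≤ suc (double d q)
        q≤ = ≤-trans (≤-reflexive (trans (+-identityʳ _) (+-identityʳ q)))
               (≤-trans (m≤m*n q 2) (≤-trans (m≤n+m (q * 2) d) (n≤1+n _)))

    X-triple : ∀ {z n κ i a a′ ins out} → Triple X Y F (λ x y f → mk x y z n κ i f a a′ ins out)
    X-triple = record { gx = refl ; gy = refl ; gz = refl ; sx = refl ; sy = refl ; sz = refl }

    Z-triple : ∀ {x n κ i a a′ ins out} → Triple Z Y F (λ z y f → mk x y z n κ i f a a′ ins out)
    Z-triple = record { gx = refl ; gy = refl ; gz = refl ; sx = refl ; sy = refl ; sz = refl }

    module _ {n κ i : ℕ} {a a′ : Vec ℕ r} {ins : Tuple Word ar} where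

      private
        pst : ℕ → ℕ → ℕ → Word → Store
        pst x z f out = mk x 0 z n κ i f a a′ ins out

      sim-push : ∀ g x w {out} → x ≤ g → suc x < 2 ^ b → suc (length (bits g x ++ w)) ≤ b →
                 Sim pushP (pst x (stack w) 0 out) (pst 0 (stack (bits g x ++ w)) 0 out)
      sim-push zero    zero    w _ _ _ = sim-done X refl
      sim-push (suc g) zero    w _ _ _ = sim-done X refl
      sim-push (suc g) (suc x) w {out} (s≤s le) lt len = sim-loop X refl
        (via-from (halve X-triple) ⟫ sim-double Z-triple (stack w) (≤-trans (s≤s (≤-trans (m≤n+m _ d) (<⇒≤ (n≤1+n _)))) stk)
          ⟫ sim-inc Z refl (≤-trans (s≤s (s≤s (≤-trans (m≤n+m _ d) (n≤1+n _)))) stk) ⟫ add d d<2 stk)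
        (via (cong (λ e → pst 0 (stack e) 0 out) words)
          (sim-push g h (digitOf d ∷ w) (≤-trans (half≤ x) le)
            (≤-trans (s≤s (s≤s (≤-trans (half≤ x) (n≤1+n x)))) lt) (subst (λ e → suc (length e) ≤ b) (sym words) len)))
        where
        d = suc x % 2
        h = suc x / 2
        d<2 : d < 2
        d<2 = m%n<n (suc x) 2
        words : bits g h ++ digitOf d ∷ w ≡ bits (suc g) (suc x) ++ w
        words = sym (trans (cong (_++ w) (bits-suc g x)) (Listₚ.++-assoc (bits g h) _ w))
        via-from : ∀ {p σ} → Sim p (pst (double d h) (stack w) 0 out) σ → Sim p (pst (suc x) (stack w) 0 out) σ
        via-from {p} {σ} s = subst (λ e → Sim p (pst e (stack w) 0 out) σ) (sym (m≡m%n+[m/n]*n (suc x) 2)) s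
        halve : Triple X Y F (λ x y f → mk x y (stack w) n κ i f a a′ ins out) →
                Sim (halveP X) (pst (double d h) (stack w) 0 out) (pst h (stack w) d out)
        halve t = sim-halve t d h d<2 (subst (λ e → suc e < 2 ^ b) (m≡m%n+[m/n]*n (suc x) 2) lt)
        stack-digit : ∀ d → d < 2 → stack (digitOf d ∷ w) ≡ suc (double d (stack w))
        stack-digit zero _ = refl
        stack-digit (suc zero) _ = refl
        stack-digit (suc (suc d)) (s≤s (s≤s ()))
        short : suc (length (digitOf d ∷ w)) ≤ b
        short = ≤-trans (s≤s (≤-trans (m≤n+m _ (length (bits g h))) (≤-reflexive
                  (trans (sym (Listₚ.length-++ (bits g h))) (cong length words))))) len
        stk : suc (suc (double d (stack w))) < 2 ^ b
        stk = ≤-trans (s≤s (≤-reflexive (cong suc (sym (stack-digit d d<2)))))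
                (≤-trans (stack-bound (digitOf d ∷ w)) (^-monoʳ-≤ 2 short))
        add : ∀ d → d < 2 → suc (suc (double d (stack w))) < 2 ^ b →
              Sim (ifPositive F (dec F ▹ inc Z) pass) (pst h (suc (stack w * 2)) d out) (pst h (stack (digitOf d ∷ w)) 0 out)
        add zero       _ _  = sim-zero F refl sim-pass
        add (suc zero) _ lt = sim-positive F refl (sim-dec F refl ⟫ sim-inc Z refl (<⇒≤ lt))
        add (suc (suc d)) (s≤s (s≤s ())) _

      sim-pop : ∀ w {out} → All IsDigit w → suc (length w) ≤ b → length w + length out ≤ B →
                Sim popP (pst 0 (stack w) 0 out) (pst 0 0 0 (w ʳ++ out))
      sim-pop [] dg lt le = sim-done Z refl
      sim-pop (s0 ∷ w) {out} (_ ∷ dg) lt le = sim-loop Z refl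
        (sim-dec Z refl ⟫ sim-halve Z-triple 0 (stack w) (s≤s z≤n)
            (≤-trans (stack-bound (s0 ∷ w)) (^-monoʳ-≤ 2 lt) ∙ n≤1+n _)
         ⟫ sim-zero F refl (sim-emit s0 (≤-trans (s≤s (m≤n+m _ (length w))) le)))
        (sim-pop w dg (<⇒≤ lt) (subst (_≤ B) (sym (+-suc (length w) (length out))) le))
        where
        _∙_ : ∀ {x y z} → y ≤ z → x ≤ y → x ≤ z
        p ∙ q = ≤-trans q p
      sim-pop (s1 ∷ w) {out} (_ ∷ dg) lt le = sim-loop Z refl
        (sim-dec Z refl ⟫ sim-halve Z-triple 1 (stack w) (s≤s (s≤s z≤n))
            (<⇒≤ (≤-trans (stack-bound (s1 ∷ w)) (^-monoʳ-≤ 2 lt)))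
         ⟫ sim-positive F refl (sim-dec F refl ⟫ sim-emit s1 (≤-trans (s≤s (m≤n+m _ (length w))) le)))
        (sim-pop w dg (<⇒≤ lt) (subst (_≤ B) (sym (+-suc (length w) (length out))) le))

      sim-print : ∀ v {out} → suc v < 2 ^ b → suc (length (bin v)) ≤ b → length (bin v) + length out ≤ B →
                  Sim printP (pst v 0 0 out) (pst 0 0 0 (bin v ʳ++ out))
      sim-print zero    lt len le = sim-zero X refl (sim-emit s0 le)
      sim-print (suc v) {out} lt len le = sim-positive X refl
        (via (cong (λ e → pst 0 (stack e) 0 out) (Listₚ.++-identityʳ (bin (suc v))))
             (sim-push (suc v) (suc v) [] ≤-refl lt (subst (λ e → suc (length e) ≤ b) (sym (Listₚ.++-identityʳ (bin (suc v)))) len))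
         ⟫ sim-pop (bin (suc v)) (bits-digits (suc v) (suc v)) len le)

    module _ {z n κ i f : ℕ} {a a′ : Vec ℕ r} {out : Word} (j : Fin ar) where

      private
        rst : ℕ → Tuple Word ar → Store
        rst x ins = mk x 0 z n κ i f a a′ ins out

        stop : ∀ {w ins} v → pick j ins ≡ w → isInp isDigit (current w) ≡ false →
               Sim (digitsP j) (rst v ins) (rst v (put j w ins))
        stop v eq nd = via (cong (rst v) (sym (put-pick j eq)))
          (sim-in-done j (trans (cong (isInp isDigit ∘ current) eq) nd))

      -- The inequality is an invariant: a digit at most doubles `suc v` and takes one symbol off
      -- `w`. It allows for `w` consisting of digits only.
      sim-digits : ∀ w v {ins} → pick j ins ≡ w → suc v * 2 ^ length w ≤ 2 ^ b →
                   Sim (digitsP j) (rst v ins) (rst (proj₁ (readDigits v w)) (put j (proj₂ (readDigits v w)) ins))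
      sim-digits (s0 ∷ w) v {ins} eq lt = sim-in-loop j (cong (isInp isDigit ∘ current) eq)
        (sim-in-else j (cong (isInp is1 ∘ current) eq) (sim-advance j eq ⟫ sim-double X-triple v v2<))
        (via (cong (rst _) (put-put j)) (sim-digits w (v * 2) (pick-put j w ins) lt′))
        where
        lt′ : suc (v * 2) * 2 ^ length w ≤ 2 ^ b
        lt′ = ≤-trans (*-monoˡ-≤ (2 ^ length w) (n≤1+n (suc (v * 2)))) (≤-trans (≤-reflexive (*-assoc (suc v) 2 (2 ^ length w))) lt)
        v2< : v * 2 < 2 ^ b
        v2< = ≤-trans (m≤m*n _ (2 ^ length w) ⦃ m^n≢0 2 (length w) ⦄) lt′
      sim-digits (s1 ∷ w) v {ins} eq lt = sim-in-loop j (cong (isInp isDigit ∘ current) eq)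
        (sim-in-then j (cong (isInp is1 ∘ current) eq)
          (sim-advance j eq ⟫ sim-double X-triple v (<⇒≤ v2<) ⟫ sim-inc X refl v2<))
        (via (cong (rst _) (put-put j)) (sim-digits w (suc (v * 2)) (pick-put j w ins) lt′))
        where
        lt′ : suc (suc (v * 2)) * 2 ^ length w ≤ 2 ^ b
        lt′ = ≤-trans (≤-reflexive (*-assoc (suc v) 2 (2 ^ length w))) lt
        v2< : suc (v * 2) < 2 ^ b
        v2< = ≤-trans (m≤m*n _ (2 ^ length w) ⦃ m^n≢0 2 (length w) ⦄) lt′
      sim-digits []           v eq lt = stop v eq refl
      sim-digits (sOpen ∷ w)  v eq lt = stop v eq refl
      sim-digits (sClose ∷ w) v eq lt = stop v eq refl
      sim-digits (sSemi ∷ w)  v eq lt = stop v eq refl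
      sim-digits (sBot ∷ w)   v eq lt = stop v eq refl

-- Layouts: the exponents known to the control

isOpen isClose isSemi : Sym → Bool
isOpen sOpen = true
isOpen _     = false
isClose sClose = true
isClose _      = false
isSemi sSemi = true
isSemi _     = false

isBlank : Cell → Bool
isBlank blank = true
isBlank _     = false

above-update : ∀ {r} (t : Fin r) es cs p → above t (es [ t ]≔ p) cs ≡ above t es cs
above-update Fin.zero    (e ∷ es) (c ∷ cs) p = refl
above-update (Fin.suc t) (e ∷ es) (c ∷ cs) p = above-update t es cs p

value-place : ∀ {r} (t : Fin r) es cs p c → ZeroBelow t cs → lookup cs t ≡ 0 →
              value (es [ t ]≔ p) (cs [ t ]≔ c) ≡ value es cs ⊕ ωpow p c
value-place t es cs p c z z₀ = trans (value-update t (es [ t ]≔ p) cs c z)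
  (cong₂ (λ α q → α ⊕ ωpow q c)
    (trans (above-update t es cs p) (sym (trans (value-at t es cs z) (cong (λ d → above t es cs ⊕ ωpow (lookup es t) d) z₀))))
    (Vecₚ.lookup∘update t es p))

-- The first k entries of a register file are scratch space for the terms created by taking predecessors.
record Layout (k M : ℕ) : Set where
  constructor layout
  field
    expo     : Vec ℕ (k + M)
    expo-low : ∀ j → lookup expo (j ↑ˡ M) ≡ toℕ j
    expo-<   : ∀ t → lookup expo t < k
open Layout public

module _ {k M : ℕ} where

  ↑ˡ≢↑ʳ : ∀ {j : Fin k} {f : Fin M} → j ↑ˡ M ≢ k ↑ʳ f
  ↑ˡ≢↑ʳ {j} {f} eq with trans (sym (Finₚ.splitAt-↑ˡ k j M)) (trans (cong (splitAt k) eq) (Finₚ.splitAt-↑ʳ k M f))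
  ... | ()

  side : (t : Fin (k + M)) → (Σ (Fin k) λ j → t ≡ j ↑ˡ M) ⊎ (Σ (Fin M) λ f → t ≡ k ↑ʳ f)
  side t with splitAt k t | Finₚ.join-splitAt k M t
  ... | inj₁ j | eq = inj₁ (j , sym eq)
  ... | inj₂ f | eq = inj₂ (f , sym eq)

  baseLayout : 1 ≤ k → Layout k M
  -- Entries not yet assigned to a term get exponent 0, which is admissible as k is positive.
  baseLayout 1≤k = layout (Vec.tabulate {n = k} toℕ Vec.++ Vec.replicate M 0) low lt
    where
    low : ∀ j → lookup (Vec.tabulate {n = k} toℕ Vec.++ Vec.replicate M 0) (j ↑ˡ M) ≡ toℕ j
    low j = trans (Vecₚ.lookup-++ˡ (Vec.tabulate {n = k} toℕ) _ j) (Vecₚ.lookup∘tabulate toℕ j)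
    lt : ∀ t → lookup (Vec.tabulate {n = k} toℕ Vec.++ Vec.replicate M 0) t < k
    lt t with side t
    ... | inj₁ (j , refl) = subst (_< k) (sym (low j)) (Finₚ.toℕ<n j)
    ... | inj₂ (f , refl) = subst (_< k) (sym (trans (Vecₚ.lookup-++ʳ (Vec.tabulate {n = k} toℕ) _ f) (Vecₚ.lookup-replicate f 0))) 1≤k

  extend : Layout k M → Fin M → Fin k → Layout k M
  extend (layout es low lt) f p = layout (es [ k ↑ʳ f ]≔ toℕ p)
    (λ j → trans (Vecₚ.lookup∘update′ ↑ˡ≢↑ʳ es (toℕ p)) (low j)) lt′
    where
    lt′ : ∀ t → lookup (es [ k ↑ʳ f ]≔ toℕ p) t < k
    lt′ t with t Finₚ.≟ k ↑ʳ f
    ... | yes refl = subst (_< k) (sym (Vecₚ.lookup∘update t es (toℕ p))) (Finₚ.toℕ<n p)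
    ... | no ne    = subst (_< k) (sym (Vecₚ.lookup∘update′ ne es (toℕ p))) (lt t)

  -- Whether the predecessor at `t` is that of a successor or of a limit depends on the exponent
  -- alone, hence is settled while the program is built. `g` is the entry that receives the new
  -- term.
  data Kind (es : Vec ℕ (k + M)) (t : Fin (k + M)) : Set where
    succ-kind : lookup es t ≡ 0 → Kind es t
    lim-kind  : (g : Fin (k + M)) → g Fin.< t → lookup es t ≡ suc (lookup es g) → Kind es t

  -- `g` is the scratch entry of exponent `e`. It lies below `t`: either `t` is itself the scratch
  -- entry of exponent `suc e`, or `t` lies beyond the whole scratch space.
  kind : (lay : Layout k M) → ∀ t → Kind (expo lay) t
  kind (layout es low lt) t with lookup es t in eq
  ... | zero  = succ-kind eq
  ... | suc e = lim-kind g g<t (trans eq (cong suc (sym (trans (low (fromℕ< e<k)) (Finₚ.toℕ-fromℕ< e<k)))))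
    where
    e<k : e < k
    e<k = <⇒≤ (subst (_< k) eq (lt t))
    g = fromℕ< e<k ↑ˡ M
    g≡ : toℕ g ≡ e
    g≡ = trans (Finₚ.toℕ-↑ˡ (fromℕ< e<k) M) (Finₚ.toℕ-fromℕ< e<k)
    g<t : g Fin.< t
    g<t with side t
    ... | inj₁ (j , refl) = ≤-reflexive (trans (cong suc g≡) (trans (sym eq) (trans (low j) (sym (Finₚ.toℕ-↑ˡ j M)))))
    ... | inj₂ (f , refl) = ≤-trans (≤-reflexive (cong suc g≡))
      (≤-trans e<k (≤-trans (m≤m+n k (toℕ f)) (≤-reflexive (sym (Finₚ.toℕ-↑ʳ k f)))))

-- Parsing codes into register files

module Parsing (ar k m : ℕ) (1≤k : 1 ≤ k) (jc : Fin ar) where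

  private
    M : ℕ
    M = m + k

  open Programs ar (k + M)
  open Accept k m

  placeP : Fin (k + M) → Program
  placeP t = fan₂ X (fil true t) (fil false t)

  -- Moves the number in `X` into the control, by counting it down along d branches; a number that
  -- is too large fails.
  dispatchP : ∀ d → (Fin d → Program) → Program
  dispatchP zero    p = failP
  dispatchP (suc d) p = ifPositive X (dec X ▹ dispatchP d (p ∘ Fin.suc)) (p Fin.zero)

  -- The exponents of the current branch are known when the program is built, so the decision is
  -- taken then and costs the machine nothing.
  checkP : {P : Set} → Dec P → Program → Program
  checkP (yes _) p = p
  checkP (no _)  p = failP

  readAllP : Fin ar → Program → Program
  readAllP j p = readP j (ifInput j isBlank p failP)

  module _ (leafP : Layout k M → Program) where

    -- A tree of programs of depth at most M, branching over the exponents. Terms are placed from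
    -- the top entry downwards, so that later terms of the sum get lower entries; `f` is the number
    -- of entries still free.
    parseP : ∀ f → f ≤ M → Layout k M → List ℕ → Program
    afterP : ∀ f → f ≤ M → Layout k M → List ℕ → Program
    parseP zero    le lay acc = failP
    parseP (suc f) le lay acc = readP jc
      (ifInput jc (isInp isSemi)
        (advance jc ▹ dispatchP k λ p → readP jc
          (ifPositive X
            (placeP (k ↑ʳ fromℕ< le) ▹ afterP f (<⇒≤ le) (extend lay (fromℕ< le) p) (acc ++ [ toℕ p ]))
            failP))
        failP)
    afterP f le lay acc = ifInput jc (isInp isClose)
      (advance jc ▹ ifInput jc isBlank (checkP (Good? acc) (leafP lay)) failP)
      (ifInput jc (isInp isSemi) (advance jc ▹ parseP f le lay acc) failP)

    codeP : Program
    codeP = ifInput jc (isInp isOpen)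
      (advance jc ▹ ifInput jc (isInp isClose)
        (advance jc ▹ ifInput jc isBlank (leafP (baseLayout 1≤k)) failP)
        (parseP M ≤-refl (baseLayout 1≤k) []))
      failP

    module Correct (b B U : ℕ) (b<B : b < B) (U<b : U < b) (Q : Programs.Store ar (k + M) → Set) (n i : ℕ) where
      open Proofs b B b<B

      Bot : Set
      Bot = ∀ {τ} → rout τ ≡ sBot ∷ [] → Q τ

      parsed : ℕ → Vec ℕ (k + M) → Tuple Word ar → Store
      parsed x cs ins = mk x 0 0 n 0 i 0 cs cs ins []

      runs-fail : ∀ {x cs ins} → Bot → Runs failP (parsed x cs ins) Q
      runs-fail bot = _ , sim-emit sBot (≤-trans (s≤s z≤n) b<B) , bot refl

      then-runs : ∀ j {f p q σ} → f (current (input j σ)) ≡ true → Runs p σ Q → Runs (ifInput j f p q) σ Q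
      then-runs j eq (σ′ , s , q) = σ′ , sim-in-then j eq s , q

      else-runs : ∀ j {f p q σ} → f (current (input j σ)) ≡ false → Runs q σ Q → Runs (ifInput j f p q) σ Q
      else-runs j eq (σ′ , s , q) = σ′ , sim-in-else j eq s , q

      runs-neither : ∀ j {f g p q x cs ins w} → pick j ins ≡ w → f (current w) ≡ false → g (current w) ≡ false → Bot →
                     Runs (ifInput j f p (ifInput j g q failP)) (parsed x cs ins) Q
      runs-neither j {f} {g} eq ¬f ¬g post =
        else-runs j (trans (cong (f ∘ current) eq) ¬f) (else-runs j (trans (cong (g ∘ current) eq) ¬g) (runs-fail post))

      positive-runs : ∀ x {p q σ v} → get x σ ≡ suc v → Runs p σ Q → Runs (ifPositive x p q) σ Q
      positive-runs x eq (σ′ , s , q) = σ′ , sim-positive x eq s , q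

      zero-runs : ∀ x {p q σ} → get x σ ≡ 0 → Runs q σ Q → Runs (ifPositive x p q) σ Q
      zero-runs x eq (σ′ , s , q) = σ′ , sim-zero x eq s , q

      ReadPost : Program → (ℕ → Word → Store) → Maybe (ℕ × Word) → Set
      ReadPost p st nothing        = Bot
      ReadPost p st (just (v , w)) = Runs p (st v w) Q

      runs-read : ∀ j {p cs ins} w → pick j ins ≡ w → length w ≤ U →
                  ReadPost p (λ v w → parsed v cs (put j w ins)) (readNum w) → Runs (readP j p) (parsed 0 cs ins) Q
      runs-read j (s0 ∷ w) eq le post = then-runs j (cong (isInp is0 ∘ current) eq) (sim-advance j eq ⟫ʳ post)
      runs-read j {p} {cs} {ins} (s1 ∷ w) eq le post =
        else-runs j (cong (isInp is0 ∘ current) eq) (then-runs j (cong (isInp is1 ∘ current) eq)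
          (sim-advance j eq ⟫ʳ sim-inc X refl 2≤ ⟫ʳ
            via (cong (parsed _ cs) (put-put j)) (sim-digits j w 1 (pick-put j w ins) 2*) ⟫ʳ post))
        where
        2* : 2 * 2 ^ length w ≤ 2 ^ b
        2* = ^-monoʳ-≤ 2 (≤-trans le (<⇒≤ U<b))
        2≤ : 1 < 2 ^ b
        2≤ = ≤-trans (m≤m*n 2 (2 ^ length w) ⦃ m^n≢0 2 (length w) ⦄) 2*
      runs-read j []           eq le bot = runs-neither j eq refl refl bot
      runs-read j (sOpen ∷ w)  eq le bot = runs-neither j eq refl refl bot
      runs-read j (sClose ∷ w) eq le bot = runs-neither j eq refl refl bot
      runs-read j (sSemi ∷ w)  eq le bot = runs-neither j eq refl refl bot
      runs-read j (sBot ∷ w)   eq le bot = runs-neither j eq refl refl bot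

      runs-readAll : ∀ j {p cs ins} w → pick j ins ≡ w → length w ≤ U →
        ((∀ n → readNum w ≢ just (n , [])) → Bot) →
        (∀ n → readNum w ≡ just (n , []) → Runs p (parsed n cs (put j [] ins)) Q) → Runs (readAllP j p) (parsed 0 cs ins) Q
      runs-readAll j {p} {cs} {ins} w eq len bot run′ = runs-read j w eq len (ended (readNum w) refl)
        where
        ended : ∀ x → readNum w ≡ x → ReadPost (ifInput j isBlank p failP) (λ v w → parsed v cs (put j w ins)) x
        ended nothing rd {τ} = bot (λ n rd′ → contradiction (trans (sym rd) rd′) λ ()) {τ}
        ended (just (n , [])) rd = then-runs j (cong (isBlank ∘ current) (pick-put j [] ins)) (run′ n rd)
        ended (just (n , s ∷ u)) rd = else-runs j (cong (isBlank ∘ current) (pick-put j (s ∷ u) ins))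
          (runs-fail λ {τ} → bot (λ n′ rd′ → contradiction (trans (sym rd) rd′) λ ()) {τ})

      runs-dispatch : ∀ d {p : Fin d → Program} v {cs ins} (lt : v < d) → Runs (p (fromℕ< lt)) (parsed 0 cs ins) Q →
                      Runs (dispatchP d p) (parsed v cs ins) Q
      runs-dispatch (suc d) zero    lt       r = zero-runs X refl r
      runs-dispatch (suc d) (suc v) (s≤s lt) r = positive-runs X refl (sim-dec X refl ⟫ʳ runs-dispatch d v lt r)

      dispatch-fails : ∀ d {p : Fin d → Program} v {cs ins} → ¬ (v < d) → Bot → Runs (dispatchP d p) (parsed v cs ins) Q
      dispatch-fails zero    v       ge bot = runs-fail bot
      dispatch-fails (suc d) zero    ge bot = contradiction (s≤s z≤n) ge
      dispatch-fails (suc d) (suc v) ge bot = positive-runs X refl (sim-dec X refl ⟫ʳ dispatch-fails d v (ge ∘ s≤s) bot)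

      sim-place : ∀ t v {cs ins} → v < 2 ^ b → lookup cs t ≡ 0 → Sim (placeP t) (parsed v cs ins) (parsed 0 (cs [ t ]≔ v) ins)
      -- The triple speaks of files with one entry overwritten; the initial file is its own update
      -- by the 0 already there.
      sim-place t v {cs} {ins} lt z = subst₂ (Sim (placeP t))
        (cong (λ a → parsed v a ins) (trans (cong (cs [ t ]≔_) (sym z)) (Vecₚ.[]≔-lookup cs t)))
        (cong (λ a → parsed 0 (cs [ t ]≔ a) ins) (+-identityʳ v))
        (sim-fan₂ triple v (subst (_< 2 ^ b) (sym (+-identityʳ v)) lt) (subst (_< 2 ^ b) (sym (+-identityʳ v)) lt))
        where
        triple : Triple X (fil true t) (fil false t) (λ x u v → mk x 0 0 n 0 i 0 (cs [ t ]≔ u) (cs [ t ]≔ v) ins [])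
        triple = record
          { gx = refl ; gy = Vecₚ.lookup∘update t cs _ ; gz = Vecₚ.lookup∘update t cs _ ; sx = refl
          ; sy = λ {u} {v} {w} → cong (λ a → mk u 0 0 n 0 i 0 a (cs [ t ]≔ w) ins []) (Vecₚ.[]≔-idempotent cs t)
          ; sz = λ {u} {v} {w} → cong (λ a → mk u 0 0 n 0 i 0 (cs [ t ]≔ v) a ins []) (Vecₚ.[]≔-idempotent cs t) }

      -- What is left to show, according to the verdict of the acceptor: after a rejection the
      -- output ⊥ must be correct, after an acceptance the leaf program must succeed from the filled
      -- file. Indexing by the verdict lets the proof follow the recursion of `accept`.
      Post : Ω → Maybe Terms → Set
      Post α nothing   = Bot
      Post α (just nf) = ∀ lay cs ins → value (expo lay) cs ≡ sumTerms α nf → (∀ t → lookup cs t < 2 ^ U) →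
                         Runs (leafP lay) (parsed 0 cs ins) Q

      ZeroUpTo : ℕ → Vec ℕ (k + M) → Set
      ZeroUpTo f cs = ∀ j → toℕ j < k + f → lookup cs j ≡ 0

      runs-parse : ∀ f le lay acc w {cs ins} → pick jc ins ≡ w → length w ≤ U → (∀ t → lookup cs t < 2 ^ U) →
                   ZeroUpTo f cs → Post (value (expo lay) cs) (accept f acc w) → Runs (parseP f le lay acc) (parsed 0 cs ins) Q
      runs-after : ∀ f le lay acc x w {cs ins α} → pick jc ins ≡ w → length w ≤ U → (∀ t → lookup cs t < 2 ^ U) →
                   ZeroUpTo f cs → value (expo lay) cs ≡ sumTerms α (x ∷ []) →
                   Post α (accept-r f acc x w) → Runs (afterP f le lay acc) (parsed 0 cs ins) Q
      runs-parse zero    le lay acc w eq len bd z post = runs-fail post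
      runs-parse (suc f) le lay acc w {cs} {ins} eq len bd z post = runs-read jc w eq len (exponent (readNum w) refl post)
        where
        t = k ↑ʳ fromℕ< le
        t≡ : toℕ t ≡ k + f
        t≡ = trans (Finₚ.toℕ-↑ʳ k (fromℕ< le)) (cong (k +_) (Finₚ.toℕ-fromℕ< le))
        zt : lookup cs t ≡ 0
        zt = z t (≤-reflexive (trans (cong suc t≡) (sym (+-suc k f))))
        tail-after : (p : Fin k) → Program
        tail-after p = afterP f (<⇒≤ le) (extend lay (fromℕ< le) p) (acc ++ [ toℕ p ])
        coefficient : ∀ (p : ℕ) (lt : p < k) w {ins} x → readNum w ≡ x → length w ≤ U → pick jc ins ≡ w →
          Post (value (expo lay) cs) (accept-c f (acc ++ [ p ]) p x) →
          ReadPost (ifPositive X (placeP t ▹ tail-after (fromℕ< lt)) failP) (λ v w → parsed v cs (put jc w ins)) x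
        coefficient p lt w nothing rd len eq post = post
        coefficient p lt w (just (zero , w′)) rd len eq post = zero-runs X refl (runs-fail post)
        coefficient p lt w {ins} (just (suc c , w′)) rd len eq post = positive-runs X refl
          (sim-place t (suc c) (≤-trans c< (^-monoʳ-≤ 2 (<⇒≤ U<b))) zt ⟫ʳ
           runs-after f (<⇒≤ le) (extend lay (fromℕ< le) (fromℕ< lt)) (acc ++ [ toℕ (fromℕ< lt) ]) (p , suc c) w′
             (pick-put jc w′ ins) (≤-trans (<⇒≤ (proj₂ (readNum-bound w rd))) len) bd′ z′ val
             (subst (λ q → Post _ (accept-r f (acc ++ [ q ]) (p , suc c) w′)) (sym (Finₚ.toℕ-fromℕ< lt)) post))
          where
          c< : suc c < 2 ^ U
          c< = ≤-trans (proj₁ (readNum-bound w rd)) (^-monoʳ-≤ 2 len)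
          bd′ : ∀ s → lookup (cs [ t ]≔ suc c) s < 2 ^ U
          bd′ s with s Finₚ.≟ t
          ... | yes refl = subst (_< 2 ^ U) (sym (Vecₚ.lookup∘update s cs (suc c))) c<
          ... | no ne    = subst (_< 2 ^ U) (sym (Vecₚ.lookup∘update′ ne cs (suc c))) (bd s)
          z′ : ZeroUpTo f (cs [ t ]≔ suc c)
          z′ j j< = trans (Vecₚ.lookup∘update′ (λ j≡t → <-irrefl (trans (cong toℕ j≡t) t≡) j<) cs (suc c))
                          (z j (≤-trans j< (+-monoʳ-≤ k (n≤1+n f))))
          val : value (expo lay [ t ]≔ toℕ (fromℕ< lt)) (cs [ t ]≔ suc c) ≡ value (expo lay) cs ⊕ ωpow p (suc c)
          val = trans (value-place t (expo lay) cs (toℕ (fromℕ< lt)) (suc c)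
                        (λ j j<t → z j (≤-trans j<t (≤-trans (≤-reflexive t≡) (+-monoʳ-≤ k (n≤1+n f))))) zt)
                      (cong (λ q → value (expo lay) cs ⊕ ωpow q (suc c)) (Finₚ.toℕ-fromℕ< lt))
        no-semicolon : ∀ {p v w} → isInp isSemi (current w) ≡ false → Bot →
                       Runs (ifInput jc (isInp isSemi) p failP) (parsed v cs (put jc w ins)) Q
        no-semicolon eq post =
          else-runs jc (trans (cong (isInp isSemi ∘ current) (pick-put jc _ ins)) eq) (runs-fail post)
        exponent : ∀ x → readNum w ≡ x → Post (value (expo lay) cs) (accept-p f acc x) →
          ReadPost (ifInput jc (isInp isSemi)
            (advance jc ▹ dispatchP k λ p → readP jc (ifPositive X (placeP t ▹ tail-after p) failP)) failP)
            (λ v w → parsed v cs (put jc w ins)) x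
        exponent nothing rd post = post
        exponent (just (p , sSemi ∷ w′)) rd post with p <? k
        ... | no ge  = then-runs jc (cong (isInp isSemi ∘ current) (pick-put jc _ ins))
                         (sim-advance jc (pick-put jc _ ins) ⟫ʳ dispatch-fails k p ge post)
        ... | yes lt = then-runs jc (cong (isInp isSemi ∘ current) (pick-put jc _ ins))
                         (sim-advance jc (pick-put jc _ ins) ⟫ʳ runs-dispatch k p lt
                           (runs-read jc w′ (pick-put jc w′ _) len′ (coefficient p lt w′ (readNum w′) refl len′ (pick-put jc w′ _) post)))
          where
          len′ : length w′ ≤ U
          len′ = <⇒≤ (≤-trans (<⇒≤ (proj₂ (readNum-bound w rd))) len)
        exponent (just (p , []))         rd post = no-semicolon refl post
        exponent (just (p , s0 ∷ _))     rd post = no-semicolon refl post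
        exponent (just (p , s1 ∷ _))     rd post = no-semicolon refl post
        exponent (just (p , sOpen ∷ _))  rd post = no-semicolon refl post
        exponent (just (p , sClose ∷ _)) rd post = no-semicolon refl post
        exponent (just (p , sBot ∷ _))   rd post = no-semicolon refl post
      runs-after f le lay acc x (sClose ∷ []) {cs} {ins} {α} eq len bd z val post =
        then-runs jc (cong (isInp isClose ∘ current) eq) (sim-advance jc eq ⟫ʳ
          then-runs jc (cong (isBlank ∘ current) (pick-put jc _ ins)) (check (Good? acc) post))
        where
        check : ∀ {P : Set} (d : Dec P) → Post α (verdict d (x ∷ [])) → Runs (checkP d (leafP lay)) (parsed 0 cs (put jc [] ins)) Q
        check (yes _) post = post lay _ _ val bd
        check (no _)  post = runs-fail post
      runs-after f le lay acc x (sSemi ∷ w) {cs} {ins} {α} eq len bd z val post =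
        else-runs jc (cong (isInp isClose ∘ current) eq) (then-runs jc (cong (isInp isSemi ∘ current) eq)
          (sim-advance jc eq ⟫ʳ runs-parse f le lay acc w (pick-put jc w ins) (<⇒≤ len) bd z (shift-post (accept f acc w) post)))
        where
        shift-post : ∀ res → Post α (Maybe.map (x ∷_) res) → Post (value (expo lay) cs) res
        shift-post nothing   bot = bot
        shift-post (just nf) p lay′ cs′ ins′ e = p lay′ cs′ ins′ (trans e (cong (λ β → sumTerms β nf) val))
      runs-after f le lay acc x (sClose ∷ s ∷ w) {ins = ins} eq len bd z val post =
        then-runs jc (cong (isInp isClose ∘ current) eq) (sim-advance jc eq ⟫ʳ
          else-runs jc (cong (isBlank ∘ current) (pick-put jc _ ins)) (runs-fail post))
      runs-after f le lay acc x []          eq len bd z val post = runs-neither jc eq refl refl post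
      runs-after f le lay acc x (s0 ∷ _)    eq len bd z val post = runs-neither jc eq refl refl post
      runs-after f le lay acc x (s1 ∷ _)    eq len bd z val post = runs-neither jc eq refl refl post
      runs-after f le lay acc x (sOpen ∷ _) eq len bd z val post = runs-neither jc eq refl refl post
      runs-after f le lay acc x (sBot ∷ _)  eq len bd z val post = runs-neither jc eq refl refl post

      -- On `()` followed by more symbols the acceptor goes on to look for a term, whereas the
      -- program fails at once. They agree, since no term begins with a closing parenthesis.
      accept-close : ∀ f acc w → accept f acc (sClose ∷ w) ≡ nothing
      accept-close zero    acc w = refl
      accept-close (suc f) acc w = refl

      blankFile : Vec ℕ (k + M)
      blankFile = Vec.replicate (k + M) 0

      blank-zero : ∀ t → lookup blankFile t ≡ 0
      blank-zero t = Vecₚ.lookup-replicate t 0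

      blank-< : ∀ t → lookup blankFile t < 2 ^ U
      blank-< t = subst (_< 2 ^ U) (sym (blank-zero t)) (m^n>0 2 U)

      blank-value : value (expo (baseLayout {k} {M} 1≤k)) blankFile ≡ 𝟎
      blank-value = value-zero (expo (baseLayout {k} {M} 1≤k)) blankFile blank-zero

      not-opened : ∀ {p w ins} → pick jc ins ≡ w → isInp isOpen (current w) ≡ false → Bot →
                   Runs (ifInput jc (isInp isOpen) p failP) (parsed 0 blankFile ins) Q
      not-opened eq ¬o post = else-runs jc (trans (cong (isInp isOpen ∘ current) eq) ¬o) (runs-fail post)

      runs-code : ∀ w {ins} → pick jc ins ≡ w → length w ≤ U → Post 𝟎 (acceptCode w) → Runs codeP (parsed 0 blankFile ins) Q
      runs-code (sOpen ∷ w) {ins} eq len post =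
        then-runs jc (cong (isInp isOpen ∘ current) eq) (sim-advance jc eq ⟫ʳ go w (pick-put jc w ins) (<⇒≤ len) post)
        where
        terms-follow : ∀ w {ins} → pick jc ins ≡ w → length w ≤ U → Post 𝟎 (accept M [] w) →
                       Runs (parseP M ≤-refl (baseLayout 1≤k) []) (parsed 0 blankFile ins) Q
        terms-follow w eq len post = runs-parse M ≤-refl (baseLayout 1≤k) [] w eq len blank-< (λ j _ → blank-zero j)
          (subst (λ α → Post α (accept M [] w)) (sym blank-value) post)
        not-closed : ∀ {p w ins} → pick jc ins ≡ w → isInp isClose (current w) ≡ false → length w ≤ U →
                     Post 𝟎 (accept M [] w) →
                     Runs (ifInput jc (isInp isClose) p (parseP M ≤-refl (baseLayout 1≤k) [])) (parsed 0 blankFile ins) Q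
        not-closed eq ¬c len post =
          else-runs jc (trans (cong (isInp isClose ∘ current) eq) ¬c) (terms-follow _ eq len post)
        go : ∀ w {ins} → pick jc ins ≡ w → length w ≤ U → Post 𝟎 (acceptCode (sOpen ∷ w)) →
             Runs (ifInput jc (isInp isClose) (advance jc ▹ ifInput jc isBlank (leafP (baseLayout 1≤k)) failP)
                    (parseP M ≤-refl (baseLayout 1≤k) [])) (parsed 0 blankFile ins) Q
        go (sClose ∷ []) {ins} eq len post = then-runs jc (cong (isInp isClose ∘ current) eq) (sim-advance jc eq ⟫ʳ
          then-runs jc (cong (isBlank ∘ current) (pick-put jc _ ins)) (post (baseLayout 1≤k) _ _ blank-value blank-<))
        go (sClose ∷ s ∷ w) {ins} eq len post = then-runs jc (cong (isInp isClose ∘ current) eq) (sim-advance jc eq ⟫ʳ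
          else-runs jc (cong (isBlank ∘ current) (pick-put jc _ ins))
            (runs-fail (subst (Post 𝟎) (accept-close M [] (s ∷ w)) post)))
        go []          eq len post = not-closed eq refl len post
        go (s0 ∷ _)    eq len post = not-closed eq refl len post
        go (s1 ∷ _)    eq len post = not-closed eq refl len post
        go (sOpen ∷ _) eq len post = not-closed eq refl len post
        go (sSemi ∷ _) eq len post = not-closed eq refl len post
        go (sBot ∷ _)  eq len post = not-closed eq refl len post
      runs-code []           eq len post = not-opened eq refl post
      runs-code (s0 ∷ _)     eq len post = not-opened eq refl post
      runs-code (s1 ∷ _)     eq len post = not-opened eq refl post
      runs-code (sClose ∷ _) eq len post = not-opened eq refl post
      runs-code (sSemi ∷ _)  eq len post = not-opened eq refl post
      runs-code (sBot ∷ _)   eq len post = not-opened eq refl post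

-- Predecessors, counting and printing on register files

firstPositive : ∀ {r} (cs : Vec ℕ r) →
  (∀ j → lookup cs j ≡ 0) ⊎ (Σ (Fin r) λ t → Σ ℕ λ c → lookup cs t ≡ suc c × ZeroBelow t cs)
firstPositive [] = inj₁ λ ()
firstPositive (suc c ∷ cs) = inj₂ (Fin.zero , c , refl , λ j ())
firstPositive (zero ∷ cs) with firstPositive cs
... | inj₁ z = inj₁ λ { Fin.zero → refl ; (Fin.suc j) → z j }
... | inj₂ (t , c , eq , z) = inj₂ (Fin.suc t , c , eq , λ { Fin.zero _ → refl ; (Fin.suc j) (s≤s lt) → z j lt })

-- Reads the entries below q downwards, hence the terms from the most significant one on.
topTerms : ∀ {r} q → q ≤ r → Vec ℕ r → Vec ℕ r → Terms
topTerms zero    le es cs = []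
topTerms (suc q) le es cs = (lookup es (fromℕ< le) , lookup cs (fromℕ< le)) ∷ topTerms q (<⇒≤ le) es cs

topTerms-∷ : ∀ {r} q (le : suc q ≤ suc r) (le′ : q ≤ r) e es c cs →
             topTerms (suc q) le (e ∷ es) (c ∷ cs) ≡ topTerms q le′ es cs ++ (e , c) ∷ []
topTerms-∷ zero    le le′ e es c cs = refl
topTerms-∷ (suc q) le le′ e es c cs =
  cong (_ ∷_) (topTerms-∷ q (<⇒≤ le) (<⇒≤ le′) e es c cs)

topTerms-sum : ∀ {r} (le : r ≤ r) (es cs : Vec ℕ r) → sumTerms 𝟎 (topTerms r le es cs) ≡ value es cs
topTerms-sum le []       []       = refl
topTerms-sum {suc r} le (e ∷ es) (c ∷ cs) = trans (cong (sumTerms 𝟎) (topTerms-∷ r le ≤-refl e es c cs))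
  (trans (sumTerms-++ 𝟎 (topTerms r ≤-refl es cs) _) (cong (_⊕ ωpow e c) (topTerms-sum ≤-refl es cs)))

topTerms-update : ∀ {r} q (le : q ≤ r) es cs (t : Fin r) v → q ≤ toℕ t → topTerms q le es (cs [ t ]≔ v) ≡ topTerms q le es cs
topTerms-update zero    le es cs t v lt = refl
topTerms-update (suc q) le es cs t v lt = cong₂ (λ c r → (_ , c) ∷ r)
  (Vecₚ.lookup∘update′ (λ eq → <-irrefl (trans (sym (Finₚ.toℕ-fromℕ< le)) (cong toℕ eq)) lt) cs v)
  (topTerms-update q (<⇒≤ le) es cs t v (<⇒≤ lt))

-- Bounds every coefficient that can arise by merging, and is preserved by normalisation.
weight : Terms → ℕ
weight []            = 0
weight ((p , c) ∷ r) = c + weight r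

separator : Bool → Word
separator true  = []
separator false = sSemi ∷ []

oneTerm : Bool → ℕ → ℕ → Word
oneTerm first p x = separator first ++ bin p ++ sSemi ∷ bin x

remaining : Bool → Terms → Word
remaining first []      = sClose ∷ []
remaining first (x ∷ r) = separator first ++ termWord x r

remaining-∷ : ∀ first p x r → remaining first ((p , x) ∷ r) ≡ oneTerm first p x ++ remaining false r
remaining-∷ first p x r = trans (cong (separator first ++_) (sym (Listₚ.++-assoc (bin p) (sSemi ∷ bin x) _)))
  (trans (cong (λ w → separator first ++ ((bin p ++ sSemi ∷ bin x) ++ w)) (after≡ r)) (sym (Listₚ.++-assoc (separator first) _ _)))
  where
  after≡ : ∀ r → afterTerm r ≡ remaining false r
  after≡ []      = refl
  after≡ (x ∷ r) = refl

encNF-remaining : ∀ nf → encNF nf ≡ sOpen ∷ remaining true nf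
encNF-remaining []      = refl
encNF-remaining (x ∷ r) = encNF-termWord x r

length-remaining : ∀ nf → length (remaining true nf) ≤ length (afterTerm nf)
length-remaining []      = ≤-refl
length-remaining (x ∷ r) = n≤1+n _

length-step : ∀ (u v out : Word) → length (u ++ v) + length out ≡ length v + length (u ʳ++ out)
length-step u v w = trans (cong (_+ length w) (Listₚ.length-++ u)) (trans (cong (_+ length w) (+-comm (length u) (length v)))
  (trans (+-assoc (length v) (length u) (length w)) (cong (length v +_) (sym (Listₚ.length-ʳ++ u)))))

module Leaves (ar k m : ℕ) where

  private
    M : ℕ
    M = m + k
  open Programs ar (k + M)

  searchP : ∀ q → (Fin q → Reg) → (Fin q → Program) → Program → Program
  searchP zero    x hit miss = miss
  searchP (suc q) x hit miss = ifPositive (x Fin.zero) (hit Fin.zero) (searchP q (x ∘ Fin.suc) (hit ∘ Fin.suc) miss)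

  -- `N` holds n + 1, the coefficient of the term created at a limit. It passes through `Y`, from
  -- where `N` is restored.
  copyP : Bool → Fin (k + M) → Program
  copyP w g = fan₂ N Y (fil w g) ▹ transfer Y N F

  stepP : Bool → Program → Program → ∀ {es : Vec ℕ (k + M)} {t} → Kind {k} {M} es t → Program
  stepP w onSucc onLim (succ-kind _)    = onSucc
  stepP w onSucc onLim (lim-kind g _ _) = copyP w g ▹ onLim

  predP : Bool → Layout k M → Program → Program → Program → Program
  predP w lay onSucc onLim miss =
    searchP (k + M) (fil w) (λ t → dec (fil w t) ▹ stepP w onSucc onLim (kind lay t)) miss

  measure : Bool → Ω → ℕ → ℕ
  measure true  = L
  measure false = G

  atLim : Bool → Program
  atLim true  = inc K
  atLim false = pass

  -- Works on the second file, so that the first one is intact when the predecessors are taken for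
  -- R. `F` is set to 1 beforehand and keeps the loop going until the value is 0; L and G differ
  -- only in whether limits are counted.
  countP : Bool → Layout k M → Program
  countP h lay = whilePositive F (predP false lay (inc K) (atLim h) (dec F))

  subtractP : Program
  subtractP = whilePositive I (dec I ▹ ifPositive K (dec K) pass)

  iterateP : Layout k M → Program
  iterateP lay = whilePositive K (dec K ▹ predP true lay pass pass pass)

  emitP : Word → Program
  emitP []      = pass
  emitP (s ∷ w) = emit s ▹ emitP w

  termP : Bool → ℕ → Program
  termP first p = emitP (separator first) ▹ emitP (bin p) ▹ emit sSemi ▹ printP

  fetchP : Fin (k + M) → Program
  fetchP t = transfer (fil true t) X F

  -- `normFrom` as a program: the exponent of the pending term is in the control and its coefficient
  -- in `X`. Exponents are compared while the program is built, coefficients are tested at run time.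
  printFromP : Bool → ℕ → ∀ q → q ≤ k + M → Vec ℕ (k + M) → Program
  mergeP     : Bool → ∀ p e → Dec (e ≡ p) → ∀ q → q ≤ k + M → Vec ℕ (k + M) → Fin (k + M) → Program
  printFromP first p zero    le es = termP first p ▹ emit sClose
  printFromP first p (suc q) le es = ifPositive (fil true t)
      (mergeP first p e (e ≟ p) q le′ es t)
      (printFromP first p q le′ es)
    where
    t = fromℕ< le
    e = lookup es t
    le′ = <⇒≤ le
  mergeP first p e (yes _) q le es t = fetchP t ▹ printFromP first p q le es
  mergeP first p e (no _)  q le es t = termP first p ▹ fetchP t ▹ printFromP false e q le es

  printTermsP : ∀ q → q ≤ k + M → Vec ℕ (k + M) → Program
  printTermsP zero    le es = emit sClose
  printTermsP (suc q) le es = ifPositive (fil true (fromℕ< le))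
    (fetchP (fromℕ< le) ▹ printFromP true (lookup es (fromℕ< le)) q (<⇒≤ le) es)
    (printTermsP q (<⇒≤ le) es)

  module Correct (b B V : ℕ) (b<B : b < B) (V<b : V < b) where
    open Proofs b B b<B

    Small : Vec ℕ (k + M) → Set
    Small a = ∀ t → lookup a t < 2 ^ V

    2^V<2^b : 2 ^ V < 2 ^ b
    2^V<2^b = 2^-mono-< V<b

    small-update : ∀ a t {v} → Small a → v < 2 ^ V → Small (a [ t ]≔ v)
    small-update a t {v} sm lt s with s Finₚ.≟ t
    ... | yes refl = subst (_< 2 ^ V) (sym (Vecₚ.lookup∘update s a v)) lt
    ... | no ne    = subst (_< 2 ^ V) (sym (Vecₚ.lookup∘update′ ne a v)) (sm s)

    sim-found : ∀ q {x hit miss σ σ′ v} (t : Fin q) → (∀ j → j Fin.< t → get (x j) σ ≡ 0) → get (x t) σ ≡ suc v →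
                Sim (hit t) σ σ′ → Sim (searchP q x hit miss) σ σ′
    sim-found (suc q) {x} Fin.zero    z eq s = sim-positive (x Fin.zero) eq s
    sim-found (suc q) {x} (Fin.suc t) z eq s = sim-zero (x Fin.zero) (z Fin.zero (s≤s z≤n))
      (sim-found q t (λ j lt → z (Fin.suc j) (s≤s lt)) eq s)

    sim-missed : ∀ q {x hit miss σ σ′} → (∀ j → get (x j) σ ≡ 0) → Sim miss σ σ′ → Sim (searchP q x hit miss) σ σ′
    sim-missed zero    z s = s
    sim-missed (suc q) {x} z s = sim-zero (x Fin.zero) (z Fin.zero) (sim-missed q (z ∘ Fin.suc) s)

    record FileState (w : Bool) (st : Vec ℕ (k + M) → ℕ → ℕ → Store) : Set where
      field
        gA : ∀ {a n y t} → get (fil w t) (st a n y) ≡ lookup a t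
        gN : ∀ {a n y} → get N (st a n y) ≡ n
        gY : ∀ {a n y} → get Y (st a n y) ≡ y
        sA : ∀ {a n y t v} → set (fil w t) v (st a n y) ≡ st (a [ t ]≔ v) n y
        sN : ∀ {a n y v} → set N v (st a n y) ≡ st a v y
        sY : ∀ {a n y v} → set Y v (st a n y) ≡ st a n v

    module _ {w st} (fs : FileState w st) where
      open FileState fs

      sim-copy : ∀ a g n → lookup a g ≡ 0 → n < 2 ^ b → Sim (copyP w g) (st a n 0) (st (a [ g ]≔ n) n 0)
      sim-copy a g n z lt = subst₂ (Sim (copyP w g))
        (cong (λ e → st e n 0) (trans (cong (a [ g ]≔_) (sym z)) (Vecₚ.[]≔-lookup a g)))
        (cong₂ (λ e n′ → st (a [ g ]≔ e) n′ 0) eq (trans (+-identityʳ _) eq))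
        (sim-fan₂ triple n (subst (_< 2 ^ b) (sym eq) lt) (subst (_< 2 ^ b) (sym eq) lt) ⟫
         sim-transfer (swap triple) (n + 0) (subst (_< 2 ^ b) (sym (trans (+-identityʳ _) eq)) lt))
        where
        eq = +-identityʳ n
        triple : Triple N Y (fil w g) (λ u v e → st (a [ g ]≔ e) u v)
        triple = record { gx = gN ; gy = gY ; gz = trans gA (Vecₚ.lookup∘update g a _) ; sx = sN ; sy = sY
                        ; sz = trans sA (cong (λ a → st a _ _) (Vecₚ.[]≔-idempotent a g)) }

      -- Each case is stated for arbitrary branch programs and whatever they achieve, so that
      -- counting and iterating share one analysis of the predecessor.
      data PredCase (lay : Layout k M) (n : ℕ) (a : Vec ℕ (k + M)) : Set where
        at-zero : value (expo lay) a ≡ 𝟎 →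
                  (∀ {p q r σ} → Sim r (st a (suc n) 0) σ → Sim (predP w lay p q r) (st a (suc n) 0) σ) → PredCase lay n a
        at-succ : ∀ a′ → Small a′ → value (expo lay) a ≡ value (expo lay) a′ ⁺ →
                  (∀ {p q r σ} → Sim p (st a′ (suc n) 0) σ → Sim (predP w lay p q r) (st a (suc n) 0) σ) → PredCase lay n a
        at-lim  : ∀ a′ f → Small a′ → value (expo lay) a ≡ lim f → f n ≈ value (expo lay) a′ →
                  (∀ {p q r σ} → Sim q (st a′ (suc n) 0) σ → Sim (predP w lay p q r) (st a (suc n) 0) σ) → PredCase lay n a

      -- A step lowers one coefficient and at most sets another to n + 1, so all coefficients stay
      -- below 2^V however many steps follow.
      predCase : ∀ lay n a → Small a → suc n < 2 ^ V → PredCase lay n a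
      predCase lay n a sm n< with firstPositive a
      ... | inj₁ z = at-zero (value-zero (expo lay) a z) (sim-missed (k + M) (λ j → trans gA (z j)))
      ... | inj₂ (t , c , eq , z) = found (kind lay t) refl
        where
        c< : c < 2 ^ V
        c< = <⇒≤ (subst (_< 2 ^ V) eq (sm t))
        found : (κ : Kind (expo lay) t) → kind lay t ≡ κ → PredCase lay n a
        found (succ-kind e0) k≡ = at-succ (a [ t ]≔ c) (small-update a t sm c<) (value-succ t (expo lay) a c z eq e0)
          λ {p} {q} {r} {σ} s → sim-found (k + M) t (λ j lt → trans gA (z j lt)) (trans gA eq)
            (via sA (sim-dec (fil w t) (trans gA eq)) ⟫ subst (λ κ → Sim (stepP w p q κ) _ σ) (sym k≡) s)
        found (lim-kind g lt e+) k≡ with value-lim t g (expo lay) a c lt z eq e+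
        ... | f , v≡ , f≈ = at-lim ((a [ t ]≔ c) [ g ]≔ suc n) f (small-update (a [ t ]≔ c) g (small-update a t sm c<) n<) v≡ (f≈ n)
          λ {p} {q} {r} {σ} s → sim-found (k + M) t (λ j lt → trans gA (z j lt)) (trans gA eq)
            (via sA (sim-dec (fil w t) (trans gA eq)) ⟫ subst (λ κ → Sim (stepP w p q κ) _ σ) (sym k≡)
              (sim-copy (a [ t ]≔ c) g (suc n)
                (trans (Vecₚ.lookup∘update′ (λ g≡t → <-irrefl (cong toℕ g≡t) lt) a c) (z g lt)) (<-trans n< 2^V<2^b) ⟫ s))

    module _ {i : ℕ} {a₁ : Vec ℕ (k + M)} {ins : Tuple Word ar} {out : Word} where

      private
        counting : ℕ → ℕ → Vec ℕ (k + M) → ℕ → ℕ → Store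
        counting κ f a n y = mk 0 y 0 n κ i f a₁ a ins out

        fs : ∀ {κ f} → FileState false (counting κ f)
        fs = record { gA = refl ; gN = refl ; gY = refl ; sA = refl ; sN = refl ; sY = refl }

      -- Induction on the value of L, which each predecessor lowers by one; this also governs the
      -- loop that counts G. The sum of κ and ℓ bounds the counter `K` throughout.
      sim-count : ∀ h lay n → suc n < 2 ^ V → ∀ ℓ a κ → L (value (expo lay) a) n ≡ ℓ → Small a → κ + ℓ < 2 ^ b →
        Σ (Vec ℕ (k + M)) λ a′ → Sim (countP h lay) (counting κ 1 a (suc n) 0)
                                     (counting (κ + measure h (value (expo lay) a) n) 0 a′ (suc n) 0)
      sim-count h lay n n< ℓ a κ ℓ≡ sm lt with predCase (fs {κ} {1}) lay n a sm n<
      ... | at-zero v≡ s rewrite v≡ = a , sim-loop F refl (s (sim-dec F refl))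
              (via (cong (λ e → counting e 0 a (suc n) 0) (trans (sym (+-identityʳ κ)) (cong (κ +_) (sym (measure-zero h)))))
                   (sim-done F refl))
        where
        measure-zero : ∀ h → measure h 𝟎 n ≡ 0
        measure-zero true  = refl
        measure-zero false = refl
      sim-count h lay n n< zero a κ ℓ≡ sm lt | at-succ a′ sm′ v≡ s rewrite v≡ = contradiction ℓ≡ λ ()
      sim-count h lay n n< (suc ℓ) a κ ℓ≡ sm lt | at-succ a′ sm′ v≡ s rewrite v≡ =
        let lt′ = subst (_< 2 ^ b) (+-suc κ ℓ) lt
            (a″ , s′) = sim-count h lay n n< ℓ a′ (suc κ) (suc-injective ℓ≡) sm′ lt′
        in a″ , sim-loop F refl (s (sim-inc K refl (≤-trans (s≤s (s≤s (m≤m+n κ ℓ))) lt′)))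
                  (via (cong (λ e → counting e 0 a″ (suc n) 0) (trans (sym (+-suc κ _)) (cong (κ +_) (sym (measure-succ h _))))) s′)
        where
        measure-succ : ∀ h α → measure h (α ⁺) n ≡ suc (measure h α n)
        measure-succ true  α = refl
        measure-succ false α = refl
      sim-count h lay n n< zero a κ ℓ≡ sm lt | at-lim a′ f sm′ v≡ f≈ s rewrite v≡ = contradiction ℓ≡ λ ()
      sim-count true lay n n< (suc ℓ) a κ ℓ≡ sm lt | at-lim a′ f sm′ v≡ f≈ s rewrite v≡ =
        let lt′ = subst (_< 2 ^ b) (+-suc κ ℓ) lt
            (a″ , s′) = sim-count true lay n n< ℓ a′ (suc κ) (trans (sym (L-cong n f≈)) (suc-injective ℓ≡)) sm′ lt′
        in a″ , sim-loop F refl (s (sim-inc K refl (≤-trans (s≤s (s≤s (m≤m+n κ ℓ))) lt′)))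
                  (via (cong (λ e → counting e 0 a″ (suc n) 0) (trans (sym (+-suc κ _)) (cong (λ e → κ + suc e) (sym (L-cong n f≈))))) s′)
      sim-count false lay n n< (suc ℓ) a κ ℓ≡ sm lt | at-lim a′ f sm′ v≡ f≈ s rewrite v≡ =
        let (a″ , s′) = sim-count false lay n n< ℓ a′ κ (trans (sym (L-cong n f≈)) (suc-injective ℓ≡)) sm′
                          (≤-trans (s≤s (+-monoʳ-≤ κ (n≤1+n ℓ))) lt)
        in a″ , sim-loop F refl (s sim-pass)
                  (via (cong (λ e → counting (κ + e) 0 a″ (suc n) 0) (sym (G-cong n f≈))) s′)

    sim-subtract : ∀ {n f a a′ ins out} i κ → Sim subtractP (mk 0 0 0 n κ i f a a′ ins out) (mk 0 0 0 n (κ ∸ i) 0 f a a′ ins out)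
    sim-subtract zero    κ       = sim-done I refl
    sim-subtract {n} {f} {a} {a′} {ins} {out} (suc i) zero = sim-loop I refl (sim-dec I refl ⟫ sim-zero K refl sim-pass)
      (via (cong (λ e → mk 0 0 0 n e 0 f a a′ ins out) (0∸n≡0 i)) (sim-subtract i zero))
    sim-subtract (suc i) (suc κ) = sim-loop I refl (sim-dec I refl ⟫ sim-positive K refl (sim-dec K refl)) (sim-subtract i κ)

    module _ {i f : ℕ} {a₁ : Vec ℕ (k + M)} {ins : Tuple Word ar} {out : Word} where

      private
        iterating : ℕ → Vec ℕ (k + M) → ℕ → ℕ → Store
        iterating κ a n y = mk 0 y 0 n κ i f a a₁ ins out

        fs : ∀ {κ} → FileState true (iterating κ)
        fs = record { gA = refl ; gN = refl ; gY = refl ; sA = refl ; sN = refl ; sY = refl }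

      sim-iterate : ∀ lay n → suc n < 2 ^ V → ∀ κ a → Small a →
        Σ (Vec ℕ (k + M)) λ a′ → Small a′ × value (expo lay) a′ ≈ Rb κ (value (expo lay) a) n ×
          Sim (iterateP lay) (iterating κ a (suc n) 0) (iterating 0 a′ (suc n) 0)
      sim-iterate lay n n< zero    a sm = a , sm , ≈-refl , sim-done K refl
      sim-iterate lay n n< (suc κ) a sm with predCase (fs {κ}) lay n a sm n<
      ... | at-zero v≡ s =
        let (a″ , sm″ , e , s′) = sim-iterate lay n n< κ a sm
        in a″ , sm″ , ≈-trans e (≈-trans (Rb-cong κ n (≈-reflexive (trans v≡ (cong (λ β → pred β n) (sym v≡)))))
                                         (≈-reflexive (sym (Rb-suc κ _ n)))) ,
           sim-loop K refl (sim-dec K refl ⟫ s sim-pass) s′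
      ... | at-succ a′ sm′ v≡ s =
        let (a″ , sm″ , e , s′) = sim-iterate lay n n< κ a′ sm′
        in a″ , sm″ , ≈-trans e (≈-trans (Rb-cong κ n (≈-reflexive (cong (λ β → pred β n) (sym v≡))))
                                         (≈-reflexive (sym (Rb-suc κ _ n)))) ,
           sim-loop K refl (sim-dec K refl ⟫ s sim-pass) s′
      ... | at-lim a′ g sm′ v≡ g≈ s =
        let (a″ , sm″ , e , s′) = sim-iterate lay n n< κ a′ sm′
        in a″ , sm″ , ≈-trans e (≈-trans (Rb-cong κ n (≈-trans (≈-sym g≈) (≈-reflexive (cong (λ β → pred β n) (sym v≡)))))
                                         (≈-reflexive (sym (Rb-suc κ _ n)))) ,
           sim-loop K refl (sim-dec K refl ⟫ s sim-pass) s′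

    module _ (W : ℕ) (W<b : suc (suc W) ≤ b) {n : ℕ} {a₁ : Vec ℕ (k + M)} {ins : Tuple Word ar} where

      private
        printing : ℕ → Vec ℕ (k + M) → Word → Store
        printing x a out = mk x 0 0 n 0 0 0 a a₁ ins out

        W⇒b : ∀ {v} → v < 2 ^ W → suc v < 2 ^ b
        W⇒b lt = ≤-trans (s≤s lt) (2^-mono-< (<⇒≤ W<b))

      sim-emitP : ∀ w {x a out} → length w + length out ≤ B → Sim (emitP w) (printing x a out) (printing x a (w ʳ++ out))
      sim-emitP []      le = sim-pass
      sim-emitP (s ∷ w) {out = out} le = sim-emit s (≤-trans (s≤s (m≤n+m (length out) (length w))) le) ⟫
        sim-emitP w (subst (_≤ B) (sym (+-suc (length w) (length out))) le)

      sim-fetch : ∀ t c {x a out} → lookup a t ≡ c → c + x < 2 ^ b →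
                  Sim (fetchP t) (printing x a out) (printing (c + x) (a [ t ]≔ 0) out)
      sim-fetch t c {x} {a} {out} eq lt = subst (λ e → Sim (fetchP t) (printing x e out) (printing (c + x) (a [ t ]≔ 0) out))
        (trans (cong (a [ t ]≔_) (sym eq)) (Vecₚ.[]≔-lookup a t)) (sim-transfer triple c {x} {0} lt)
        where
        triple : Triple (fil true t) X F (λ u v f → mk v 0 0 n 0 0 f (a [ t ]≔ u) a₁ ins out)
        triple = record { gx = Vecₚ.lookup∘update t a _ ; gy = refl ; gz = refl
                        ; sx = λ {u} {v} {f} → cong (λ e → mk v 0 0 n 0 0 f e a₁ ins out) (Vecₚ.[]≔-idempotent a t)
                        ; sy = refl ; sz = refl }

      sim-term : ∀ first p x {a out} → x < 2 ^ W → length (oneTerm first p x) + length out ≤ B →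
                 Sim (termP first p) (printing x a out) (printing 0 a (oneTerm first p x ʳ++ out))
      sim-term first p x {a} {out} lt le = via (cong (printing 0 a) (sym split))
        (sim-emitP s (≤-trans (≤-trans (≤-reflexive (sym (Listₚ.length-ʳ++ s))) (m≤n+m _ (length (bin p)))) le₁) ⟫ sim-emitP (bin p) le₁ ⟫
         sim-emit sSemi (≤-trans (s≤s (m≤n+m _ (length (bin x)))) le₂) ⟫
         sim-print x (W⇒b lt) (≤-trans (s≤s (bin-length x W lt)) W<b) (subst (_≤ B) (sym (+-suc (length (bin x)) _)) le₂))
        where
        s = separator first
        out₁ = s ʳ++ out
        out₂ = bin p ʳ++ out₁
        split : oneTerm first p x ʳ++ out ≡ bin x ʳ++ (sSemi ∷ out₂)
        split = trans (Listₚ.++-ʳ++ s) (Listₚ.++-ʳ++ (bin p))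
        le₂ : suc (length (bin x)) + length out₂ ≤ B
        le₂ = subst (_≤ B) (trans (length-step s _ out) (length-step (bin p) _ out₁)) le
        le₁ : length (bin p) + length out₁ ≤ B
        le₁ = ≤-trans (≤-reflexive (sym (Listₚ.length-ʳ++ (bin p)))) (≤-trans (m≤n+m _ (suc (length (bin x)))) le₂)

      Prints : Program → ℕ → Vec ℕ (k + M) → Word → Word → Set
      Prints p x a out w = Σ (Vec ℕ (k + M)) λ a′ → Sim p (printing x a out) (printing 0 a′ (w ʳ++ out))

      prints-term : ∀ first p x r {q a out} → x < 2 ^ W → length (remaining first ((p , x) ∷ r)) + length out ≤ B →
        Prints q 0 a (oneTerm first p x ʳ++ out) (remaining false r) →
        Prints (termP first p ▹ q) x a out (remaining first ((p , x) ∷ r))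
      prints-term first p x r {q} {a} {out} lt le (a′ , s) = a′ ,
        via (cong (printing 0 a′) (trans (sym (Listₚ.++-ʳ++ (oneTerm first p x))) (cong (_ʳ++ out) (sym (remaining-∷ first p x r)))))
          (sim-term first p x lt short ⟫ s)
        where
        short : length (oneTerm first p x) + length out ≤ B
        short = ≤-trans (+-monoˡ-≤ (length out) (≤-trans (m≤m+n _ (length (remaining false r)))
                  (≤-reflexive (trans (sym (Listₚ.length-++ (oneTerm first p x))) (cong length (sym (remaining-∷ first p x r))))))) le

      -- The first hypothesis bounds what `X` holds even if the pending term absorbs all terms that
      -- remain.
      sim-printFrom : ∀ q le es first p x {a out} → weight (topTerms q le es a) + x < 2 ^ W →
        length (remaining first (normFrom p x (topTerms q le es a))) + length out ≤ B →
        Prints (printFromP first p q le es) x a out (remaining first (normFrom p x (topTerms q le es a)))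
      sim-printFrom zero le es first p x {a} {out} lt len = prints-term first p x [] lt len
        (a , sim-emit sClose (subst (_≤ B) (trans (cong (λ w → length w + length out) (remaining-∷ first p x []))
                                     (length-step (oneTerm first p x) _ out)) len))
      sim-printFrom (suc q) le es first p x {a} {out} lt len with lookup a (fromℕ< le) in eq
      ... | zero = let (a′ , s) = sim-printFrom q _ es first p x lt len in a′ , sim-zero (fil true (fromℕ< le)) eq s
      ... | suc c with lookup es (fromℕ< le) ≟ p
      ... | yes refl =
        let t = fromℕ< le
            -- Fetching empties entry `t`, which is not among the entries still to be read.
            same = topTerms-update q (<⇒≤ le) es a t 0 (≤-reflexive (sym (Finₚ.toℕ-fromℕ< le)))
            T′ = topTerms q (<⇒≤ le) es a
            wt = subst (_< 2 ^ W) (trans (cong (_+ x) (+-comm (suc c) (weight T′))) (+-assoc (weight T′) (suc c) x)) lt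
            (a′ , s) = sim-printFrom q (<⇒≤ le) es first p (suc c + x) {a [ t ]≔ 0} {out}
                         (subst (λ r → weight r + (suc c + x) < 2 ^ W) (sym same) wt)
                         (subst (λ r → length (remaining first (normFrom p (suc c + x) r)) + length out ≤ B) (sym same) len)
        in a′ , sim-positive (fil true t) eq (sim-fetch t (suc c) eq (<⇒≤ (W⇒b (≤-trans (s≤s (m≤n+m _ _)) wt)))
                  ⟫ via (cong (λ r → printing 0 a′ (remaining first (normFrom p (suc c + x) r) ʳ++ out)) same) s)
      ... | no ne =
        let t = fromℕ< le
            e = lookup es t
            T′ = topTerms q (<⇒≤ le) es a
            same = topTerms-update q (<⇒≤ le) es a t 0 (≤-reflexive (sym (Finₚ.toℕ-fromℕ< le)))
            wt : suc c + weight T′ < 2 ^ W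
            wt = ≤-trans (s≤s (m≤m+n (suc c + weight T′) x)) lt
            wt′ : weight T′ + (suc c + 0) < 2 ^ W
            wt′ = subst (_< 2 ^ W) (trans (+-comm (suc c) (weight T′)) (cong (weight T′ +_) (sym (+-identityʳ (suc c))))) wt
            out′ = oneTerm first p x ʳ++ out
            len′ = subst (_≤ B) (trans (cong (λ w → length w + length out) (remaining-∷ first p x (normFrom e (suc c) T′)))
                                  (length-step (oneTerm first p x) _ out)) len
            len″ = subst (λ z → length (remaining false (normFrom e z T′)) + length out′ ≤ B) (sym (+-identityʳ (suc c))) len′
            (a′ , s) = sim-printFrom q (<⇒≤ le) es false e (suc c + 0) {a [ t ]≔ 0} {out′}
                         (subst (λ r → weight r + (suc c + 0) < 2 ^ W) (sym same) wt′)
                         (subst (λ r → length (remaining false (normFrom e (suc c + 0) r)) + length out′ ≤ B) (sym same) len″)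
            (a″ , s″) = prints-term first p x (normFrom e (suc c) T′) {fetchP t ▹ printFromP false e q (<⇒≤ le) es} {a}
                         (≤-trans (s≤s (m≤n+m x _)) lt) len
                         (a′ , (sim-fetch t (suc c) eq (<⇒≤ (W⇒b (≤-trans (s≤s (m≤n+m _ _)) wt′)))
                            ⟫ via (cong₂ (λ z r → printing 0 a′ (remaining false (normFrom e z r) ʳ++ out′)) (+-identityʳ (suc c)) same) s))
        in a″ , sim-positive (fil true t) eq s″

      sim-printTerms : ∀ q le es {a out} → weight (topTerms q le es a) < 2 ^ W →
        length (remaining true (norm (topTerms q le es a))) + length out ≤ B →
        Prints (printTermsP q le es) 0 a out (remaining true (norm (topTerms q le es a)))
      sim-printTerms zero le es {a} lt len = a , sim-emit sClose len
      sim-printTerms (suc q) le es {a} {out} lt len with lookup a (fromℕ< le) in eq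
      ... | zero = let (a′ , s) = sim-printTerms q _ es lt len in a′ , sim-zero (fil true (fromℕ< le)) eq s
      ... | suc c =
        let t = fromℕ< le
            e = lookup es t
            T′ = topTerms q (<⇒≤ le) es a
            same = topTerms-update q (<⇒≤ le) es a t 0 (≤-reflexive (sym (Finₚ.toℕ-fromℕ< le)))
            wt′ : weight T′ + (suc c + 0) < 2 ^ W
            wt′ = subst (_< 2 ^ W) (trans (+-comm (suc c) (weight T′)) (cong (weight T′ +_) (sym (+-identityʳ (suc c))))) lt
            len″ = subst (λ z → length (remaining true (normFrom e z T′)) + length out ≤ B) (sym (+-identityʳ (suc c))) len
            (a′ , s) = sim-printFrom q (<⇒≤ le) es true e (suc c + 0) {a [ t ]≔ 0} {out}
                         (subst (λ r → weight r + (suc c + 0) < 2 ^ W) (sym same) wt′)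
                         (subst (λ r → length (remaining true (normFrom e (suc c + 0) r)) + length out ≤ B) (sym same) len″)
        in a′ , sim-positive (fil true t) eq (sim-fetch t (suc c) eq (<⇒≤ (W⇒b (≤-trans (s≤s (m≤n+m _ _)) wt′)))
                  ⟫ via (cong₂ (λ z r → printing 0 a′ (remaining true (normFrom e z r) ʳ++ out)) (+-identityʳ (suc c)) same) s)

-- Bounds on values and on the length of the output

n<2^n : ∀ n → n < 2 ^ n
n<2^n zero    = s≤s z≤n
n<2^n (suc n) = ≤-trans (s≤s (n<2^n n))
  (≤-trans (+-monoˡ-≤ (2 ^ n) (m^n>0 2 n)) (≤-reflexive (cong (2 ^ n +_) (sym (+-identityʳ (2 ^ n))))))

L-ωpow : ∀ p c n → L (ωpow p c) n ≡ c * L (ω^ p) n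
L-ωpow p zero    n = refl
L-ωpow p (suc c) n = trans (L-⊕ (ωpow p c) (ω^ p) n) (cong (L (ω^ p) n +_) (L-ωpow p c n))

-- With ℓ for the value at p, the value at p + 1 is 1 + (n + 1) ℓ, which is less than (n + 2)(ℓ +
-- 1).
L-ω^ : ∀ p n → L (ω^ p) n < (2 + n) ^ suc p
L-ω^ zero    n = s≤s (s≤s z≤n)
L-ω^ (suc p) n = begin-strict
  suc (L (ωpow p (suc n)) n)          ≡⟨ cong suc (L-ωpow p (suc n) n) ⟩
  suc (suc n * ℓ)                     <⟨ +-monoʳ-≤ 2 (m≤n+m (suc n * ℓ) n) ⟩
  2 + n + suc n * ℓ                   ≤⟨ +-monoʳ-≤ (2 + n) (m≤n+m (suc n * ℓ) ℓ) ⟩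
  2 + n + (2 + n) * ℓ                 ≡⟨ sym (*-suc (2 + n) ℓ) ⟩
  (2 + n) * suc ℓ                     ≤⟨ *-monoʳ-≤ (2 + n) (L-ω^ p n) ⟩
  (2 + n) * (2 + n) ^ suc p           ∎
  where
  open ≤-Reasoning
  ℓ = L (ω^ p) n

module Bounds (k U : ℕ) where

  -- Bounds the contribution of one entry to L: a coefficient below 2^U, times L of ω^e, which is
  -- below (n+2)^(e+1) and hence at most 2^((U+1)k), since e < k.
  power : ℕ
  power = 2 ^ U * 2 ^ (suc U * k)

  L-value : ∀ {r} (es cs : Vec ℕ r) n → suc n ≤ 2 ^ U → (∀ t → lookup es t < k) → (∀ t → lookup cs t < 2 ^ U) →
            L (value es cs) n ≤ r * power
  L-value []       []       n n≤ e< c< = z≤n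
  L-value (e ∷ es) (c ∷ cs) n n≤ e< c< = ≤-trans (≤-reflexive (L-⊕ (value es cs) (ωpow e c) n))
    (+-mono-≤ (≤-trans (≤-reflexive (L-ωpow e c n)) (*-mono-≤ (<⇒≤ (c< Fin.zero)) ω-bound))
              (L-value es cs n n≤ (e< ∘ Fin.suc) (c< ∘ Fin.suc)))
    where
    2+n≤ : 2 + n ≤ 2 ^ suc U
    2+n≤ = ≤-trans (s≤s n≤) (2^-mono-< (n<1+n U))
    ω-bound : L (ω^ e) n ≤ 2 ^ (suc U * k)
    ω-bound = ≤-trans (<⇒≤ (L-ω^ e n)) (≤-trans (^-monoˡ-≤ (suc e) 2+n≤)
      (≤-trans (≤-reflexive (^-*-assoc 2 (suc U) (suc e))) (^-monoʳ-≤ 2 (*-monoʳ-≤ (suc U) (e< Fin.zero)))))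

  width : ℕ → ℕ
  width r = r + (U + suc U * k)

  r*power< : ∀ r → r * power < 2 ^ width r
  r*power< r = ≤-trans (*-monoˡ-< power ⦃ m*n≢0 (2 ^ U) (2 ^ (suc U * k)) ⦃ m^n≢0 2 U ⦄ ⦃ m^n≢0 2 (suc U * k) ⦄ ⦄ (n<2^n r))
    (≤-reflexive (trans (cong (2 ^ r *_) (sym (^-distribˡ-+-* 2 U (suc U * k)))) (sym (^-distribˡ-+-* 2 r (U + suc U * k)))))

weight-normFrom : ∀ p q r → weight (normFrom p q r) ≡ q + weight r
weight-normFrom p q [] = refl
weight-normFrom p q ((e , zero) ∷ r) = weight-normFrom p q r
weight-normFrom p q ((e , suc c) ∷ r) with e ≟ p
... | yes _ = trans (weight-normFrom p (suc c + q) r) (trans (cong (_+ weight r) (+-comm (suc c) q)) (+-assoc q (suc c) (weight r)))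
... | no _  = cong (q +_) (weight-normFrom e (suc c) r)

weight-norm : ∀ r → weight (norm r) ≡ weight r
weight-norm []                = refl
weight-norm ((e , zero) ∷ r)  = weight-norm r
weight-norm ((e , suc c) ∷ r) = weight-normFrom e (suc c) r

length-normFrom : ∀ p q r → length (normFrom p q r) ≤ suc (length r)
length-normFrom p q [] = ≤-refl
length-normFrom p q ((e , zero) ∷ r) = ≤-trans (length-normFrom p q r) (n≤1+n _)
length-normFrom p q ((e , suc c) ∷ r) with e ≟ p
... | yes _ = ≤-trans (length-normFrom p (suc c + q) r) (n≤1+n _)
... | no _  = s≤s (length-normFrom e (suc c) r)

length-norm : ∀ r → length (norm r) ≤ length r
length-norm []                = z≤n
length-norm ((e , zero) ∷ r)  = ≤-trans (length-norm r) (n≤1+n _)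
length-norm ((e , suc c) ∷ r) = length-normFrom e (suc c) r

ExponentsBelow : ℕ → Terms → Set
ExponentsBelow k = All (λ x → proj₁ x < k)

normFrom-exponents : ∀ {k} p q r → p < k → ExponentsBelow k r → ExponentsBelow k (normFrom p q r)
normFrom-exponents p q [] lt a = lt ∷ []
normFrom-exponents p q ((e , zero) ∷ r) lt (_ ∷ a) = normFrom-exponents p q r lt a
normFrom-exponents p q ((e , suc c) ∷ r) lt (e< ∷ a) with e ≟ p
... | yes _ = normFrom-exponents p (suc c + q) r lt a
... | no _  = lt ∷ normFrom-exponents e (suc c) r e< a

norm-exponents : ∀ {k} r → ExponentsBelow k r → ExponentsBelow k (norm r)
norm-exponents []                a        = []
norm-exponents ((e , zero) ∷ r)  (_ ∷ a)  = norm-exponents r a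
norm-exponents ((e , suc c) ∷ r) (lt ∷ a) = normFrom-exponents e (suc c) r lt a

-- Each term costs two numerals of at most W + 1 digits, each preceded by a semicolon; one closing
-- parenthesis is added at the end.
length-afterTerm : ∀ W r → ExponentsBelow (2 ^ W) r → weight r < 2 ^ W →
                   length (afterTerm r) ≤ suc (length r * (2 * (2 + W)))
length-afterTerm W [] a lt = ≤-refl
length-afterTerm W ((p , c) ∷ r) (p< ∷ a) lt = s≤s (begin
  length (bin p ++ sSemi ∷ (bin c ++ afterTerm r))              ≡⟨ Listₚ.length-++ (bin p) ⟩
  length (bin p) + suc (length (bin c ++ afterTerm r))          ≡⟨ cong (λ z → length (bin p) + suc z) (Listₚ.length-++ (bin c)) ⟩
  length (bin p) + suc (length (bin c) + length (afterTerm r))  ≤⟨ +-mono-≤ (bin-length p W p<) (s≤s (+-mono-≤ (bin-length c W c<)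
                                                                    (length-afterTerm W r a (≤-trans (s≤s (m≤n+m (weight r) c)) lt)))) ⟩
  suc W + suc (suc W + suc rest)                                ≡⟨ arith W rest ⟩
  2 * (2 + W) + rest                                            ∎)
  where
  open ≤-Reasoning
  rest = length r * (2 * (2 + W))
  c< : c < 2 ^ W
  c< = ≤-trans (s≤s (m≤m+n c (weight r))) lt
  arith : ∀ W z → suc W + suc (suc W + suc z) ≡ 2 * (2 + W) + z
  arith = solve 2 (λ W z → con 1 :+ W :+ (con 1 :+ (con 1 :+ W :+ (con 1 :+ z))) := con 2 :* (con 2 :+ W) :+ z) refl
    where open +-*-Solver

topTerms-exponents : ∀ {r k} q (le : q ≤ r) es cs → (∀ t → lookup es t < k) → ExponentsBelow k (topTerms q le es cs)
topTerms-exponents zero    le es cs lt = []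
topTerms-exponents (suc q) le es cs lt = lt (fromℕ< le) ∷ topTerms-exponents q _ es cs lt

topTerms-weight : ∀ {r X} q (le : q ≤ r) es cs → (∀ t → lookup cs t ≤ X) → weight (topTerms q le es cs) ≤ q * X
topTerms-weight zero    le es cs lt = z≤n
topTerms-weight (suc q) le es cs lt = +-mono-≤ (lt (fromℕ< le)) (topTerms-weight q _ es cs lt)

topTerms-length : ∀ {r} q (le : q ≤ r) es cs → length (topTerms q le es cs) ≡ q
topTerms-length zero    le es cs = refl
topTerms-length (suc q) le es cs = cong suc (topTerms-length q _ es cs)

-- From simulations to machines

zip-cells : ∀ ls {rs τ} → Zip ls rs τ → ∀ p → cells τ p ≡ nth (ls ʳ++ rs) p
zip-cells [] {rs} {f at zero} z p = trans (cong f (sym (+-identityʳ p))) (rightOf z p)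
zip-cells (x ∷ ls) {rs} {f at suc h} (zipped (eq , l) r) p = zip-cells ls {x ∷ rs} {f at h} (zipped l back) p
  where
  back : ∀ i → f (i + h) ≡ nth (x ∷ rs) i
  back zero    = eq
  back (suc i) = trans (cong f (sym (+-suc i h))) (r i)

tuple : ∀ {A : Set} {n} → Vec A n → Tuple A n
tuple []       = tt
tuple (x ∷ xs) = x , tuple xs

pick-tuple : ∀ {A : Set} {n} (xs : Vec A n) i → pick i (tuple xs) ≡ lookup xs i
pick-tuple (x ∷ xs) Fin.zero    = refl
pick-tuple (x ∷ xs) (Fin.suc i) = pick-tuple xs i

length≤total : ∀ {n} (ws : Vec Word n) i → length (lookup ws i) ≤ totalLen ws
length≤total (w ∷ ws) Fin.zero    = m≤m+n (length w) (totalLen ws)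
length≤total (w ∷ ws) (Fin.suc i) = ≤-trans (length≤total ws i) (m≤n+m (totalLen ws) (length w))

module Finish (ar r : ℕ) where
  open Programs ar r

  blankStore : Vec Word ar → Store
  blankStore ws = mk 0 0 0 0 0 0 0 (Vec.replicate r 0) (Vec.replicate r 0) (tuple ws) []

  module _ (p : Program) where
    open Compile ar work′ p

    listTape-nth : ∀ w q → listTape machine w q ≡ nth (map inp w) q
    listTape-nth []      q       = refl
    listTape-nth (x ∷ w) zero    = refl
    listTape-nth (x ∷ w) (suc q) = listTape-nth w q

    module _ (b B : ℕ) (b<B : b < B) where
      open Proofs b B b<B

      blank-register : ∀ {ws} x → get x (blankStore ws) ≡ 0
      blank-register (sc i) = zeros i
        where
        zeros : ∀ (i : Fin 7) → pick i (0 , 0 , 0 , 0 , 0 , 0 , 0 , tt) ≡ 0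
        zeros = λ { 0F → refl ; 1F → refl ; 2F → refl ; 3F → refl ; 4F → refl ; 5F → refl ; 6F → refl }
      blank-register (fil true t)  = Vecₚ.lookup-replicate t 0
      blank-register (fil false t) = Vecₚ.lookup-replicate t 0

      blank-represents : ∀ ws → totalLen ws ≤ B → blankStore ws ~ initial ws
      blank-represents ws le = represents (λ _ → z≤n) tapes
        where
        tapes : ∀ j → rep (blankStore ws) j (initial ws j)
        tapes Fin.zero = zipped tt λ i → refl
        tapes (Fin.suc j) with splitAt ar j
        ... | inj₁ i = subst (λ w → InputTape w (listTape machine (lookup ws i) at 0)) (sym (pick-tuple ws i))
          ((λ q → trans (cong (listTape machine (lookup ws i)) (+-identityʳ q)) (listTape-nth (lookup ws i) q)) ,
           ≤-trans (length≤total ws i) le)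
        -- A blank tape is a register without digits, which holds 0.
        ... | inj₂ w = blank , [] , refl , zipped tt (λ { zero → refl ; (suc i) → refl }) , sym (blank-register (register w)) , z≤n

      finish : ∀ ws (P : Word → Set) → totalLen ws ≤ B →
        Runs p (blankStore ws) (λ τ → Σ Word λ w → rout τ ≡ w ʳ++ [] × P w) →
        Σ ℕ λ s → Σ Word λ w → step machine (run machine s (init machine ws)) ≡ nothing
          × Output machine (run machine s (init machine ws)) w × P w
          × (∀ s' → s' ≤ s → ∀ t → head (run machine s' (init machine ws)) t ≤ B)
      finish ws P le (τ , s , w , eq , pw) with simulate s (initial ws) (blank-represents ws le)
      ... | c′ , e , r′ with exec⇒halts e
      ... | n , st , mt , bd = n , w , st , output , pw , bd
        where
        output : Output machine (run machine n (init machine ws)) w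
        output q _ = trans (∼tape mt Fin.zero q) (trans (zip-cells (map inp (rout τ)) (~tape r′ Fin.zero) q)
          (trans (cong (λ l → nth l q) (trans (sym (Listₚ.map-ʳ++ inp (rout τ)))
            (cong (map inp) (trans (cong (_ʳ++ []) eq) (Listₚ.reverse-involutive w))))) (sym (listTape-nth w q))))

readAll-sound : ∀ w {n} → readNum w ≡ just (n , []) → w ≡ bin n
readAll-sound w {n} eq = trans (readNum-sound w eq) (Listₚ.++-identityʳ (bin n))

readAll-complete : ∀ n → readNum (bin n) ≡ just (n , [])
readAll-complete n = trans (cong readNum (sym (Listₚ.++-identityʳ (bin n)))) (readNum-complete n [] tt)

codes-norm : ∀ {α} r → α ≈ sumTerms 𝟎 r → Codes α (encNF (norm r))
codes-norm {α} r e = go (norm r) (norm-positive r) (norm-linked r) (≈-trans e (≈-sym (norm-sum 𝟎 r)))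
  where
  go : ∀ nf → All Positive nf → Linked Apart nf → α ≈ sumTerms 𝟎 nf → Codes α (encNF nf)
  go []       pos lk e = inj₁ (e , refl)
  go (x ∷ nf) pos lk e = inj₂ (x ∷ nf , (s≤s z≤n , pos , lk) , ≈-trans e (≈-sym (evalNF≈ (x ∷ nf))) , refl)

-- Choice of the space bound, and the three machines

module Main (k m : ℕ) (1≤k : 1 ≤ k) where

  M r : ℕ
  M = m + k
  r = k + M

  open Accept k m

  code-sound : ∀ w {nf} → acceptCode w ≡ just nf → InΨ k m (sumTerms 𝟎 nf) × Codes (sumTerms 𝟎 nf) w
  code-sound w {nf} eq with acceptCode-sound w eq
  ... | refl , pos , sh , lk = shape⇒InΨ (fromℕ< 1≤k) m nf sh ≈-refl , codes nf pos lk
    where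
    codes : ∀ nf → All Positive nf → Linked Apart nf → Codes (sumTerms 𝟎 nf) (encNF nf)
    codes []       pos lk = inj₁ (≈𝟎 , refl)
    codes (x ∷ nf) pos lk = inj₂ (x ∷ nf , (s≤s z≤n , pos , lk) , ≈-sym (evalNF≈ (x ∷ nf)) , refl)

  code-complete : ∀ {α w} → InΨ k m α → Codes α w → Σ Terms λ nf → acceptCode w ≡ just nf × α ≈ sumTerms 𝟎 nf
  code-complete ψ (inj₁ (e , refl)) = [] , refl , e
  code-complete ψ (inj₂ (nf , (_ , pos , lk) , e , refl)) =
    nf , acceptCode-complete nf pos (InΨ⇒shape nf pos lk e′ ψ) lk , e′
    where e′ = ≈-trans e (evalNF≈ nf)

  -- The constant of the linear space bound. An output has at most r terms of 2b symbols and two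
  -- parentheses, so (2 + 2r) b cells suffice, and b is at most (r + k + 4)(U + 1).
  factor : ℕ
  factor = (2 + r * 2) * (r + k + 4)

  module Sizes (U : ℕ) where
    open Bounds k U public

    -- All counts and coefficients are below 2^W. Registers get more digits than W because printing
    -- stacks a numeral of up to W + 1 digits, for which W + 2 are required.
    W b B : ℕ
    W = width r
    b = 3 + W
    B = factor * suc U

    b≤ : b ≤ (r + k + 4) * suc U
    b≤ = begin
      3 + (r + (U + suc U * k))                      ≤⟨ +-monoʳ-≤ 3 (+-monoˡ-≤ (U + suc U * k) (m≤m*n r (suc U))) ⟩
      -- The slack 1 + 3U completes the sum to a multiple of U + 1.
      3 + (r * suc U + (U + suc U * k))              ≤⟨ m≤n+m _ (1 + 3 * U) ⟩
      1 + 3 * U + (3 + (r * suc U + (U + suc U * k))) ≡⟨ arith r k U ⟩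
      (r + k + 4) * suc U                            ∎
      where
      open ≤-Reasoning
      open +-*-Solver
      arith : ∀ r k U → 1 + 3 * U + (3 + (r * suc U + (U + suc U * k))) ≡ (r + k + 4) * suc U
      arith = solve 3 (λ r k U → con 1 :+ con 3 :* U :+ (con 3 :+ (r :* (con 1 :+ U) :+ (U :+ (con 1 :+ U) :* k)))
                              := (r :+ k :+ con 4) :* (con 1 :+ U)) refl

    output≤B : 2 + r * (2 * b) ≤ B
    output≤B = begin
      2 + r * (2 * b)                        ≤⟨ +-monoˡ-≤ (r * (2 * b)) (*-monoʳ-≤ 2 (s≤s (z≤n {2 + W}))) ⟩
      2 * b + r * (2 * b)                    ≡⟨ cong (2 * b +_) (sym (*-assoc r 2 b)) ⟩
      2 * b + r * 2 * b                      ≡⟨ sym (*-distribʳ-+ b 2 (r * 2)) ⟩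
      (2 + r * 2) * b                        ≤⟨ *-monoʳ-≤ (2 + r * 2) b≤ ⟩
      (2 + r * 2) * ((r + k + 4) * suc U)    ≡⟨ sym (*-assoc (2 + r * 2) (r + k + 4) (suc U)) ⟩
      factor * suc U                         ∎
      where open ≤-Reasoning

    1≤r : 1 ≤ r
    1≤r = ≤-trans 1≤k (m≤m+n k M)

    b<B : b < B
    b<B = ≤-trans (s≤s (≤-trans (≤-trans (m≤n*m b 2) (m≤n*m (2 * b) r ⦃ >-nonZero 1≤r ⦄)) (n≤1+n _))) output≤B

    U≤B : U ≤ B
    U≤B = ≤-trans (≤-trans (≤-trans (m≤m+n U (suc U * k)) (m≤n+m _ r)) (m≤n+m W 3)) (<⇒≤ b<B)

    U≤W : suc U ≤ W
    U≤W = ≤-trans (+-mono-≤ 1≤r (m≤m+n U (suc U * k))) ≤-refl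

    U<b : U < b
    U<b = ≤-trans U≤W (m≤n+m W 3)

    V<b : suc U < b
    V<b = ≤-trans (s≤s U≤W) (m≤n+m (suc W) 2)

    W+2≤b : suc (suc W) ≤ b
    W+2≤b = n≤1+n _

  module Counting (h : Bool) where
    open Programs 2 r
    open Leaves 2 k m hiding (module Correct)
    open Parsing 2 k m 1≤k Fin.zero hiding (module Correct)

    jn : Fin 2
    jn = 1F

    leafP : Layout k M → Program
    leafP lay = inc F ▹ countP h lay ▹ transfer K X F ▹ printP

    mainP : Program
    mainP = readAllP jn (transfer X N F ▹ inc N ▹ codeP leafP)

    Coded : Vec Word 2 → Word → Set
    Coded ws w = (∀ α n c → InΨ k m α → Codes α c → ws ≡ c ∷ bin n ∷ [] → w ≡ bin (measure h α n))
               × (¬ Valid2 k m ws → w ≡ botW)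

    measure-cong : ∀ h {α β} n → α ≈ β → measure h α n ≡ measure h β n
    measure-cong true  = L-cong
    measure-cong false = G-cong

    measure≤L : ∀ h α n → measure h α n ≤ L α n
    measure≤L true  α n = ≤-refl
    measure≤L false α n = G≤L α n

    coded-bot : ∀ wc wn → (∀ n nf → readNum wn ≡ just (n , []) → acceptCode wc ≡ just nf → ⊥) → Coded (wc ∷ wn ∷ []) botW
    coded-bot wc wn invalid = (λ { α n c ψ cd refl → let (nf , eq , _) = code-complete ψ cd in
                                ⊥-elim (invalid n nf (readAll-complete n) eq) }) , λ _ → refl

    -- `readNum` and `acceptCode` are functions, so whichever α and n the words are taken to denote
    -- agree with those read. The input being valid, the clause for ⊥ is vacuous.
    coded-measure : ∀ wc wn n nf → readNum wn ≡ just (n , []) → acceptCode wc ≡ just nf →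
                    Coded (wc ∷ wn ∷ []) (bin (measure h (sumTerms 𝟎 nf) n))
    coded-measure wc wn n nf rd ac =
      (λ { α n′ c ψ cd refl → let (nf′ , ac′ , e) = code-complete ψ cd in
             cong bin (trans (cong₂ (λ l n → measure h (sumTerms 𝟎 l) n) (just-injective (trans (sym ac) ac′))
                                    (cong proj₁ (just-injective (trans (sym rd) (readAll-complete n′)))))
                             (sym (measure-cong h n′ e))) }) ,
      λ ¬v → contradiction (sumTerms 𝟎 nf , n , wc , proj₁ (code-sound wc ac) , proj₂ (code-sound wc ac) ,
                            cong (λ w → wc ∷ w ∷ []) (readAll-sound wn rd)) ¬v

    module _ (wc wn : Word) where
      U : ℕ
      U = totalLen (wc ∷ wn ∷ [])

      open Sizes U
      open Proofs b B b<B
      -- Coefficients of the input are below 2^U, but n + 1 is only known to be at most 2^U; hence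
      -- the exponent U + 1.
      open Leaves.Correct 2 k m b B (suc U) b<B V<b using (sim-count)

      Goal : Store → Set
      Goal τ = Σ Word λ w → rout τ ≡ w ʳ++ [] × Coded (wc ∷ wn ∷ []) w

      len-n : length wn ≤ U
      len-n = length≤total (wc ∷ wn ∷ []) jn

      len-c : length wc ≤ U
      len-c = length≤total (wc ∷ wn ∷ []) Fin.zero

      bot : Coded (wc ∷ wn ∷ []) botW → ∀ τ → rout τ ≡ sBot ∷ [] → Goal τ
      bot cd τ eq = botW , eq , cd

      runs-leaf : ∀ {n nf} → suc n ≤ 2 ^ U → Coded (wc ∷ wn ∷ []) (bin (measure h (sumTerms 𝟎 nf) n)) →
        ∀ lay cs ins → value (expo lay) cs ≡ sumTerms 𝟎 nf → (∀ t → lookup cs t < 2 ^ U) →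
        Runs (leafP lay) (mk 0 0 0 (suc n) 0 0 0 cs cs ins []) Goal
      runs-leaf {n} {nf} n≤ cd lay cs ins v≡ c< =
        let ℓ< = ≤-trans (s≤s (L-value (expo lay) cs n n≤ (expo-< lay) c<)) (r*power< r)
            v = measure h (value (expo lay) cs) n
            v< = ≤-trans (s≤s (measure≤L h (value (expo lay) cs) n)) ℓ<
            small = λ t → ≤-trans (c< t) (^-monoʳ-≤ 2 (n≤1+n U))
            (a′ , s) = sim-count h lay n (≤-trans (s≤s n≤) (2^-mono-< (n<1+n U)))
                         (L (value (expo lay) cs) n) cs 0 refl small (≤-trans ℓ< (^-monoʳ-≤ 2 (m≤n+m W 3)))
        in _ , (sim-inc F refl (2^-mono-< (s≤s (z≤n {2 + W})))
             ⟫ s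
             ⟫ via (cong (λ e → mk e 0 0 (suc n) 0 0 0 cs a′ ins []) (+-identityʳ v))
                 (sim-transfer (K-triple {suc n} {cs} {a′} {ins}) v
                   (subst (_< 2 ^ b) (sym (+-identityʳ v)) (≤-trans v< (^-monoʳ-≤ 2 (m≤n+m W 3)))))
             ⟫ sim-print v (≤-trans (s≤s v<) (2^-mono-< (m≤n+m (suc W) 2)))
                 (≤-trans (s≤s (bin-length v W v<)) W+2≤b)
                 (≤-trans (≤-reflexive (+-identityʳ _)) (≤-trans (bin-length v W v<) (≤-trans (m≤n+m (suc W) 2) (<⇒≤ b<B))))) ,
           bin v , refl , subst (λ α → Coded (wc ∷ wn ∷ []) (bin (measure h α n))) (sym v≡) cd
        where
        K-triple : ∀ {n a a′ ins} → Triple K X F (λ κ x f → mk x 0 0 n κ 0 f a a′ ins [])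
        K-triple = record { gx = refl ; gy = refl ; gz = refl ; sx = refl ; sy = refl ; sz = refl }

      -- The parsing lemmas fix the contents of `N` and `I`, so they are instantiated afresh once a
      -- number has been stored.
      module Stage₀ = Parsing.Correct 2 k m 1≤k Fin.zero leafP b B U b<B U<b Goal 0 0

      runs-main : Runs mainP (Finish.blankStore 2 r (wc ∷ wn ∷ [])) Goal
      runs-main = Stage₀.runs-readAll jn wn refl len-n
          (λ ¬rd {τ} → bot (coded-bot wc wn λ n nf rd _ → ¬rd n rd) τ) number-read
        where
        X-N : ∀ {ins} → Triple X N F (λ x n f → mk x 0 0 n 0 0 f Stage₀.blankFile Stage₀.blankFile ins [])
        X-N = record { gx = refl ; gy = refl ; gz = refl ; sx = refl ; sy = refl ; sz = refl }
        number-read : ∀ n → readNum wn ≡ just (n , []) →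
          Runs (transfer X N F ▹ inc N ▹ codeP leafP) (Stage₀.parsed n Stage₀.blankFile (wc , [] , tt)) Goal
        number-read n rd =
          sim-transfer X-N n (subst (_< 2 ^ b) (sym (+-identityʳ n)) (<-trans n< (2^-mono-< U<b))) ⟫ʳ
          via (cong (λ e → mk 0 0 0 (suc e) 0 0 0 Stage₀.blankFile Stage₀.blankFile (wc , [] , tt) []) (+-identityʳ n))
            (sim-inc N refl (subst (λ e → suc e < 2 ^ b) (sym (+-identityʳ n))
              (≤-trans (s≤s n<) (2^-mono-< U<b)))) ⟫ʳ
          Stage₁.runs-code wc refl len-c (post (acceptCode wc) refl)
          where
          n< : n < 2 ^ U
          n< = ≤-trans (proj₁ (readNum-bound wn rd)) (^-monoʳ-≤ 2 len-n)
          module Stage₁ = Parsing.Correct 2 k m 1≤k Fin.zero leafP b B U b<B U<b Goal (suc n) 0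
          post : ∀ x → acceptCode wc ≡ x → Stage₁.Post 𝟎 x
          post nothing   ac {τ} = bot (coded-bot wc wn λ n′ nf _ ac′ → contradiction (trans (sym ac) ac′) λ ()) τ
          post (just nf) ac = runs-leaf {n} {nf} n< (coded-measure wc wn n nf rd ac)

    counted : E2 2 Coded
    counted = Compile.machine 2 work′ mainP , factor , λ { (wc ∷ wn ∷ []) →
      let open Sizes (totalLen (wc ∷ wn ∷ [])) in
      Finish.finish 2 r mainP b B b<B (wc ∷ wn ∷ []) (Coded (wc ∷ wn ∷ [])) U≤B (runs-main wc wn) }

  module Descending where
    open Programs 3 r
    open Leaves 3 k m hiding (module Correct)

    ji jc jn : Fin 3
    ji = 0F
    jc = 1F
    jn = 2F

    open Parsing 3 k m 1≤k jc hiding (module Correct)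

    leafP : Layout k M → Program
    leafP lay = inc F ▹ countP true lay ▹ subtractP ▹ iterateP lay ▹ emit sOpen ▹ printTermsP r ≤-refl (expo lay)

    codeStageP numberStageP mainP : Program
    codeStageP   = transfer X N F ▹ inc N ▹ codeP leafP
    numberStageP = transfer X I F ▹ readAllP jn codeStageP
    mainP        = readAllP ji numberStageP

    module _ (wi wc wn : Word) where
      ws : Vec Word 3
      ws = wi ∷ wc ∷ wn ∷ []

      U : ℕ
      U = totalLen ws

      open Sizes U
      open Proofs b B b<B
      open Leaves.Correct 3 k m b B (suc U) b<B V<b using (sim-count; sim-subtract; sim-iterate; sim-printTerms)

      Goal : Store → Set
      Goal τ = Σ Word λ w → rout τ ≡ w ʳ++ [] × CodedR k m ws w

      coded-bot : (∀ i n nf → readNum wi ≡ just (i , []) → readNum wn ≡ just (n , []) → acceptCode wc ≡ just nf → ⊥) →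
                  CodedR k m ws botW
      coded-bot invalid = (λ { i α n c ψ cd refl → let (nf , eq , _) = code-complete ψ cd in
                             ⊥-elim (invalid i n nf (readAll-complete i) (readAll-complete n) eq) }) , λ _ → refl

      bot : CodedR k m ws botW → ∀ τ → rout τ ≡ sBot ∷ [] → Goal τ
      bot cd τ eq = botW , eq , cd

      coded-R : ∀ i n nf T → readNum wi ≡ just (i , []) → readNum wn ≡ just (n , []) → acceptCode wc ≡ just nf →
                sumTerms 𝟎 T ≈ R i (sumTerms 𝟎 nf) n → CodedR k m ws (encNF (norm T))
      coded-R i n nf T ri rn ac e =
        (λ { i′ α n′ c ψ cd refl → let (nf′ , ac′ , e′) = code-complete ψ cd in
               codes-norm T (result (just-injective (trans (sym ri) (readAll-complete i′)))
                                    (just-injective (trans (sym rn) (readAll-complete n′)))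
                                    (just-injective (trans (sym ac) ac′)) e′) }) ,
        λ ¬v → contradiction (i , sumTerms 𝟎 nf , n , wc , proj₁ (code-sound wc ac) , proj₂ (code-sound wc ac) ,
                              cong₂ (λ u v → u ∷ wc ∷ v ∷ []) (readAll-sound wi ri) (readAll-sound wn rn)) ¬v
        where
        result : ∀ {i′ n′ nf′ α} → (i , []) ≡ (i′ , []) → (n , []) ≡ (n′ , []) → nf ≡ nf′ → α ≈ sumTerms 𝟎 nf′ → R i′ α n′ ≈ sumTerms 𝟎 T
        result {α = α} refl refl refl e′ = ≈-trans (≈-reflexive (cong (λ l → Rb (l ∸ i) α n) (L-cong n e′)))
          (≈-trans (Rb-cong (L (sumTerms 𝟎 nf) n ∸ i) n e′) (≈-sym e))

      runs-leaf : ∀ {i n nf} → suc n ≤ 2 ^ U →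
        (∀ T → sumTerms 𝟎 T ≈ R i (sumTerms 𝟎 nf) n → CodedR k m ws (encNF (norm T))) →
        ∀ lay cs ins → value (expo lay) cs ≡ sumTerms 𝟎 nf → (∀ t → lookup cs t < 2 ^ U) →
        Runs (leafP lay) (mk 0 0 0 (suc n) 0 i 0 cs cs ins []) Goal
      runs-leaf {i} {n} {nf} n≤ coded lay cs ins v≡ c< =
        let ℓ = L (value (expo lay) cs) n
            ℓ< = ≤-trans (s≤s (L-value (expo lay) cs n n≤ (expo-< lay) c<)) (r*power< r)
            small = λ t → ≤-trans (c< t) (^-monoʳ-≤ 2 (n≤1+n U))
            n<V = ≤-trans (s≤s n≤) (2^-mono-< (n<1+n U))
            (a₁ , s₁) = sim-count true lay n n<V ℓ cs 0 refl small (≤-trans ℓ< (^-monoʳ-≤ 2 (m≤n+m W 3)))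
            (a₂ , sm₂ , e₂ , s₂) = sim-iterate {0} {0} {a₁} {ins} {[]} lay n n<V (ℓ ∸ i) cs small
            T = topTerms r ≤-refl (expo lay) a₂
            nf₂ = norm T
            wT : weight T < 2 ^ W
            wT = ≤-trans (s≤s (topTerms-weight r ≤-refl (expo lay) a₂ (λ t → <⇒≤ (sm₂ t)))) (weight<)
            length≤ : length (remaining true nf₂) + 1 ≤ B
            length≤ = ≤-trans (≤-trans (≤-reflexive (+-comm _ 1)) (s≤s (≤-trans (length-remaining nf₂)
              (≤-trans (length-afterTerm W nf₂ (norm-exponents T (All.map (λ lt → ≤-trans lt k≤)
                           (topTerms-exponents r ≤-refl (expo lay) a₂ (expo-< lay))))
                         (subst (_< 2 ^ W) (sym (weight-norm T)) wT))
                (s≤s (*-mono-≤ (≤-trans (length-norm T) (≤-reflexive (topTerms-length r ≤-refl (expo lay) a₂)))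
                               (*-monoʳ-≤ 2 (n≤1+n (2 + W))))))))) output≤B
            (a₃ , s₃) = sim-printTerms W W+2≤b {suc n} {a₁} {ins} r ≤-refl (expo lay) {a₂} {sOpen ∷ []} wT length≤
        in _ , (sim-inc F refl (2^-mono-< (s≤s (z≤n {2 + W})))
             ⟫ s₁ ⟫ sim-subtract i ℓ ⟫ s₂ ⟫ sim-emit sOpen (≤-trans (s≤s z≤n) b<B) ⟫ s₃) ,
           encNF nf₂ , cong (_ʳ++ []) (sym (encNF-remaining nf₂)) ,
           coded T (≈-trans (≈-reflexive (topTerms-sum ≤-refl (expo lay) a₂)) (≈-trans e₂ (≈-reflexive (cong (λ α → R i α n) v≡))))
        where
        -- Exponents are part of the output, so their numerals must obey the same length bound.
        k≤ : k ≤ 2 ^ W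
        k≤ = ≤-trans (<⇒≤ (n<2^n k)) (^-monoʳ-≤ 2 (≤-trans (m≤n*m k (suc U)) (≤-trans (m≤n+m (suc U * k) U) (m≤n+m _ r))))
        weight< : r * 2 ^ suc U < 2 ^ W
        weight< = ≤-trans (*-monoˡ-< (2 ^ suc U) ⦃ m^n≢0 2 (suc U) ⦄ (n<2^n r)) (≤-trans (≤-reflexive (sym (^-distribˡ-+-* 2 r (suc U))))
          (^-monoʳ-≤ 2 (+-monoʳ-≤ r (≤-trans (m≤m*n (suc U) k ⦃ >-nonZero 1≤k ⦄) (m≤n+m (suc U * k) U)))))

      module Stage₀ = Parsing.Correct 3 k m 1≤k jc leafP b B U b<B U<b Goal 0 0

      blankFile : Vec ℕ r
      blankFile = Stage₀.blankFile

      X-I : ∀ {ins} → Triple X I F (λ x i f → mk x 0 0 0 0 i f blankFile blankFile ins [])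
      X-I = record { gx = refl ; gy = refl ; gz = refl ; sx = refl ; sy = refl ; sz = refl }

      X-N : ∀ {i ins} → Triple X N F (λ x n f → mk x 0 0 n 0 i f blankFile blankFile ins [])
      X-N = record { gx = refl ; gy = refl ; gz = refl ; sx = refl ; sy = refl ; sz = refl }

      moved : ∀ {n} → n < 2 ^ U → n + 0 < 2 ^ b
      moved {n} n< = subst (_< 2 ^ b) (sym (+-identityʳ n)) (<-trans n< (2^-mono-< U<b))

      runs-number : ∀ i → readNum wi ≡ just (i , []) →
                    Runs numberStageP (Stage₀.parsed i blankFile ([] , wc , wn , tt)) Goal
      runs-number i ri =
          via (cong (λ e → mk 0 0 0 0 0 e 0 blankFile blankFile ([] , wc , wn , tt) []) (+-identityʳ i))
             (sim-transfer X-I i (moved (≤-trans (proj₁ (readNum-bound wi ri)) (^-monoʳ-≤ 2 (length≤total ws ji))))) ⟫ʳ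
          Stage₁.runs-readAll jn wn refl len-n (λ ¬rn {τ} → bot (coded-bot λ _ n nf _ rn _ → ¬rn n rn) τ) number-read
        where
        module Stage₁ = Parsing.Correct 3 k m 1≤k jc leafP b B U b<B U<b Goal 0 i
        len-n : length wn ≤ U
        len-n = length≤total ws jn
        number-read : ∀ n → readNum wn ≡ just (n , []) →
                      Runs codeStageP (Stage₁.parsed n blankFile ([] , wc , [] , tt)) Goal
        number-read n rn =
          sim-transfer X-N n (moved n<) ⟫ʳ
          via (cong (λ e → mk 0 0 0 (suc e) 0 i 0 blankFile blankFile ([] , wc , [] , tt) []) (+-identityʳ n))
            (sim-inc N refl (subst (λ e → suc e < 2 ^ b) (sym (+-identityʳ n))
              (≤-trans (s≤s n<) (2^-mono-< U<b)))) ⟫ʳ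
          Stage₂.runs-code wc refl (length≤total ws jc) (post (acceptCode wc) refl)
          where
          n< : n < 2 ^ U
          n< = ≤-trans (proj₁ (readNum-bound wn rn)) (^-monoʳ-≤ 2 len-n)
          module Stage₂ = Parsing.Correct 3 k m 1≤k jc leafP b B U b<B U<b Goal (suc n) i
          post : ∀ x → acceptCode wc ≡ x → Stage₂.Post 𝟎 x
          post nothing   ac {τ} = bot (coded-bot λ _ _ _ _ _ ac′ → contradiction (trans (sym ac) ac′) λ ()) τ
          post (just nf) ac = runs-leaf {i} {n} {nf} n< (λ T → coded-R i n nf T ri rn ac)

      runs-main : Runs mainP (Finish.blankStore 3 r ws) Goal
      runs-main = Stage₀.runs-readAll ji wi refl (length≤total ws ji)
        (λ ¬ri {τ} → bot (coded-bot λ i _ _ ri _ _ → ¬ri i ri) τ) runs-number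

    descended : E2 3 (CodedR k m)
    descended = Compile.machine 3 work′ mainP , factor , λ { (wi ∷ wc ∷ wn ∷ []) →
      let open Sizes (totalLen (wi ∷ wc ∷ wn ∷ [])) in
      Finish.finish 3 r mainP b B b<B (wi ∷ wc ∷ wn ∷ []) (CodedR k m (wi ∷ wc ∷ wn ∷ [])) U≤B (runs-main wi wc wn) }

theorem9p19 : (k m : ℕ) → 1 ≤ k → 1 ≤ m →
    E2 3 (CodedR k m) × E2 2 (CodedL k m) × E2 2 (CodedG k m)
theorem9p19 k m 1≤k _ = descended , counted true , counted false
  where
  open Main k m 1≤k
  open Descending using (descended)
  open Counting using (counted)
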